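{- Let $k\ge 2$ and let $\mathcal{G}$ and $\mathcal{F}$ be $k$-uniform hypergraphs. Then $ex_{\mathcal{F}}(n,\mathcal{G})=\Theta(n^k)$ (as $n\to\infty$) if and only if there is no homomorphism from $\mathcal{G}$ to $\mathcal{F}$.
   Context: For $k$-uniform hypergraphs $\mathcal{F}$ and $\mathcal{G}$, consider $n$-vertex $k$-uniform hypergraphs $\mathcal{R}$ whose edge set is the union of pairwise edge-disjoint subhypergraphs each isomorphic to $\mathcal{F}$ (these are called $\mathcal{F}$-copies; each $\mathcal{F}$-copy is thought of as a single colour). A subhypergraph of $\mathcal{R}$ is rainbow if its edges come from pairwise distinct $\mathcal{F}$-copies. The $\mathcal{F}$-multicolor Turán number $ex_{\mathcal{F}}(n,\mathcal{G})$ is the maximum number of $\mathcal{F}$-copies in such an $n$-vertex $\mathcal{R}$ that contains no rainbow copy of $\mathcal{G}$. A homomorphism from $\mathcal{G}$ to $\mathcal{F}$ is a map $\varphi:V(\mathcal{G})\to V(\mathcal{F})$ such that $\varphi(e)\in E(\mathcal{F})$ for every edge $e\in E(\mathcal{G})$. -}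

module Defs where

open import Data.Nat using (ℕ; _≤_; _*_; _^_)
open import Data.Bool using (Bool; true)
import Data.Bool.Properties as BoolP
open import Data.Fin using (Fin; _≟_)
open import Data.Fin.Properties using (any?)
open import Data.Fin.Subset using (Subset; ∣_∣)
open import Data.Vec using (tabulate; lookup)
open import Data.Product using (Σ; ∃; _×_)
open import Relation.Nullary using (¬_; does)
open import Relation.Nullary.Decidable using (_×-dec_)
open import Relation.Binary.PropositionalEquality using (_≡_)
open import Function.Definitions using (Injective)

image : ∀ {a b} → (Fin a → Fin b) → Subset a → Subset b
image φ e = tabulate λ j →
  does (any? λ i → (lookup e i BoolP.≟ true) ×-dec (φ i ≟ j))

record Hypergraph (k : ℕ) : Set where
  field
    nV      : ℕ
    nE      : ℕ
    edge    : Fin nE → Subset nV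
    uniform : ∀ i → ∣ edge i ∣ ≡ k
    simple  : Injective _≡_ _≡_ edge
open Hypergraph public

IsEdge : ∀ {k} (H : Hypergraph k) → Subset (nV H) → Set
IsEdge H s = ∃ λ i → edge H i ≡ s

Homomorphism : ∀ {k} → Hypergraph k → Hypergraph k → Set
Homomorphism G F =
  Σ (Fin (nV G) → Fin (nV F)) λ φ → ∀ e → IsEdge F (image φ (edge G e))

-- An n-vertex hypergraph R given as a union of pairwise edge-disjoint F-copies.
-- Copy a is the image of F under the injective vertex map emb a.
record FPacking {k} (F : Hypergraph k) (n : ℕ) : Set where
  field
    copies   : ℕ
    emb      : Fin copies → Fin (nV F) → Fin n
    embInj   : ∀ a → Injective _≡_ _≡_ (emb a)
    disjoint : ∀ a b e f →
               image (emb a) (edge F e) ≡ image (emb b) (edge F f) → a ≡ b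
open FPacking public

RainbowCopy : ∀ {k} (G F : Hypergraph k) {n} → FPacking F n → Set
RainbowCopy G F {n} R =
  Σ (Fin (nV G) → Fin n) λ ψ → Injective _≡_ _≡_ ψ ×
  Σ (Fin (nE G) → Fin (copies R)) λ col → Injective _≡_ _≡_ col ×
  (∀ e → ∃ λ f → image ψ (edge G e) ≡ image (emb R (col e)) (edge F f))

-- ex_F(n,G) = Θ(n^k), spelled out: ex_F(n,G) ≤ C n^k for all n, and
-- ex_F(n,G) ≥ n^k / D for all n ≥ N (witnessed by a rainbow-G-free R).
ExIsThetaNk : ∀ (k : ℕ) (G F : Hypergraph k) → Set
ExIsThetaNk k G F =
  (∃ λ C → ∀ n (R : FPacking F n) → ¬ RainbowCopy G F R → copies R ≤ C * n ^ k)
  ×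
  (∃ λ D → ∃ λ N → ∀ n → N ≤ n →
     ∃ λ (R : FPacking F n) → ¬ RainbowCopy G F R × n ^ k ≤ D * copies R)

{-# OPTIONS --safe #-}

-- If there is no homomorphism, blow up the vertices of F and place one copy of F along the graph of each polynomial of
-- degree < k with small natural coefficients: two of them meeting in an edge agree at k points, hence coincide, and
-- projecting a copy of G to the vertices of F would give a homomorphism.
--
-- Conversely, let φ : G → F be a homomorphism and let R contain n^k / D copies of F.  Colour a partial map
-- z : V(G) ⇀ [n] by whether some copy a of F restricts to it, that is z = emb a ∘ φ on its domain.  Regularising this
-- colouring by colourings of (k−1)-tuples, these by colourings of (k−2)-tuples, and so on, gives a counting lemma: for
-- all but a small proportion of k-tuples (at every level), the number of maps y with the same pattern as a given y₀ is
-- positive up to a constant depending on D only.  As each tuple on an edge of G comes from at most one copy, some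
-- y₀ = emb a ∘ φ avoids the exceptional tuples.  So a positive proportion of all y : V(G) → [n] map every edge of G
-- into an edge of some copy.  Only O(1/n) of them are not injective or use the same copy twice, so a rainbow copy of G
-- exists for large n.
--
-- Uniformity is tested against products of functions that each miss a coordinate, which makes the energy increment
-- immediate.  The error that is small only in mean square is handled by Cauchy–Schwarz, counting a complex doubled
-- along a face.
module Submission where

open import Defs
open import Data.Nat using (ℕ; zero; suc; z≤n; s≤s; _≤_; _<_; _^_)
import Data.Nat as ℕ
import Data.Nat.Properties as ℕP
import Data.Nat.DivMod as ℕD
import Data.Nat.Tactic.RingSolver as ℕSolver
open import Data.Bool using (Bool; true; false; if_then_else_; not; _∧_; _∨_)
import Data.Bool.Properties as BoolP
open import Data.Fin using (Fin; zero; suc; _↑ˡ_; _↑ʳ_; splitAt; toℕ)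
import Data.Fin as Fin
import Data.Fin.Properties as FinP
import Data.Fin.Subset.Properties as SubsetP
open import Data.Fin.Subset using (Subset; _∩_; ⊤) renaming (∣_∣ to card)
open import Data.Integer using (-[1+_]; +0)
import Data.Integer as ℤ
import Data.Integer.Properties as ℤP
import Data.Integer.Tactic.RingSolver as ℤSolver
open import Data.List using (List; []; _∷_; length; map; filter; _++_)
import Data.List.Properties as ListP
open import Data.List.Membership.Propositional using (_∈_)
import Data.List.Membership.Propositional.Properties as ∈P
open import Data.List.Relation.Unary.Any using (here; there)
import Data.List.Relation.Unary.All as All
open import Data.List.Relation.Unary.AllPairs using ([]; _∷_)
open import Data.List.Relation.Unary.Unique.Propositional using (Unique)
import Data.List.Relation.Unary.Unique.Propositional.Properties as UniqueP
open import Data.Maybe using (Maybe; just; nothing; is-just)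
import Data.Maybe as Maybe
import Data.Maybe.Properties as MaybeP
open import Data.Product using (Σ; ∃; _×_; _,_; proj₁; proj₂)
open import Data.Rational using (ℚ; mkℚ; 0ℚ; 1ℚ; _+_; _*_; _-_; -_; ∣_∣; 1/_; *≤*; toℚᵘ) renaming (_≤_ to _≤ℚ_; _<_ to _<ℚ_)
import Data.Rational as ℚ
import Data.Rational.Properties as ℚP
open ℚP using (≤-trans; <⇒≤; *-identityʳ; *-identityˡ; *-assoc; *-comm; *-zeroʳ; *-zeroˡ; ≤-reflexive; ≤-refl; +-mono-≤; +-identityˡ; +-identityʳ; ≤-<-trans; <-≤-trans; +-comm; +-assoc; <-irrefl; +-monoˡ-≤; +-monoʳ-≤)
open import Data.Rational.Unnormalised using (mkℚᵘ; *≡*)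
import Data.Rational.Unnormalised as ℚᵘ
import Data.Rational.Unnormalised.Properties as ℚᵘP
open import Data.Sum using (_⊎_; inj₁; inj₂; [_,_]′)
open import Data.Unit using (tt) renaming (⊤ to Unit)
open import Data.Empty using (⊥)
open import Data.Vec using (Vec; []; _∷_; lookup; tabulate; _[_]≔_; zipWith)
import Data.Vec as Vec
import Data.Vec.Properties as VecP
open import Data.Vec.Relation.Binary.Pointwise.Extensional using (ext; Pointwise-≡⇒≡)
open import Function using (_∘_)
open import Function.Bundles using (_⇔_; mk⇔)
open import Relation.Binary.Definitions using (DecidableEquality)
open import Relation.Binary.PropositionalEquality using (_≡_; _≢_; refl; sym; trans; cong; cong₂; subst; subst₂; module ≡-Reasoning)
open import Relation.Nullary using (¬_; Dec; yes; no; does; contradiction)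
open import Relation.Nullary.Decidable using (dec⇒maybe; dec-true; dec-false; decidable-stable; ¬?)
import Relation.Nullary.Decidable as Dec
import Tactic.RingSolver.Core.AlmostCommutativeRing as ACR
open import Tactic.RingSolver using (solve-∀)

-- Rational arithmetic

-- The obstacle is the order of the constants. When a top edge is replaced by its density, the
-- remainder without correlation costs an absolute error `ε`, which has to be small against a
-- product of lower densities. These are bounded below only by `δ₀`, and `δ₀` deteriorates with the
-- number of facet colours. Making the facet colouring uniform increases that number, so a single
-- colouring chases its own tail. Hence two scales: the lower tower is built over a coarse `q`,
-- which fixes `δ₀`; only then is `ε` chosen, and `q′` is an `ε`-uniform refinement of `q`. The
-- price is the gap between the two densities. Its mean square is the energy gained from `q` to
-- `q′`, and it has to lie below a threshold `η` that does not involve `q`. As the energy is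
-- bounded, replacing `q` by `q′` while the gain is larger ends after boundedly many rounds. The gap
-- may still be far larger than `δ₀`, so it must be estimated relative to the count itself, which is
-- what the doubled complex achieves.

ℚ-ring : ACR.AlmostCommutativeRing _ _
ℚ-ring = ACR.fromCommutativeRing ℚP.+-*-commutativeRing λ x → dec⇒maybe (0ℚ ℚP.≟ x)

2ℚ 3ℚ : ℚ
2ℚ = 1ℚ + 1ℚ
3ℚ = 1ℚ + 2ℚ

≤-by : ∀ {a b c} → 0ℚ ≤ℚ c → b ≡ a + c → a ≤ℚ b
≤-by {a} {b} {c} 0≤c eq = subst₂ _≤ℚ_ (+-identityʳ a) (sym eq) (+-monoʳ-≤ a 0≤c)

0≤-diff : ∀ {a b} → a ≤ℚ b → 0ℚ ≤ℚ b - a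
0≤-diff {a} {b} a≤b = subst (_≤ℚ b - a) (ℚP.+-inverseʳ a) (+-monoˡ-≤ (- a) a≤b)

diff-≤ : ∀ {a b} → 0ℚ ≤ℚ b - a → a ≤ℚ b
diff-≤ {a} {b} p = ≤-by p (lem a b)
  where lem : ∀ a b → b ≡ a + (b - a)
        lem = solve-∀ ℚ-ring

0≤-+ : ∀ {a b} → 0ℚ ≤ℚ a → 0ℚ ≤ℚ b → 0ℚ ≤ℚ a + b
0≤-+ p q = +-mono-≤ p q

*-monoʳ : ∀ {c a b} → 0ℚ ≤ℚ c → a ≤ℚ b → c * a ≤ℚ c * b
*-monoʳ {c} 0≤c a≤b = ℚP.*-monoˡ-≤-nonNeg c {{ℚ.nonNegative 0≤c}} a≤b

*-monoˡ : ∀ {c a b} → 0ℚ ≤ℚ c → a ≤ℚ b → a * c ≤ℚ b * c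
*-monoˡ {c} 0≤c a≤b = ℚP.*-monoʳ-≤-nonNeg c {{ℚ.nonNegative 0≤c}} a≤b

0≤-* : ∀ {a b} → 0ℚ ≤ℚ a → 0ℚ ≤ℚ b → 0ℚ ≤ℚ a * b
0≤-* {a} {b} p q = subst (_≤ℚ a * b) (*-zeroʳ a) (*-monoʳ p q)

*-mono : ∀ {a b c d} → 0ℚ ≤ℚ a → a ≤ℚ b → 0ℚ ≤ℚ c → c ≤ℚ d → a * c ≤ℚ b * d
*-mono 0≤a a≤b 0≤c c≤d = ≤-trans (*-monoˡ 0≤c a≤b) (*-monoʳ (≤-trans 0≤a a≤b) c≤d)

0<-* : ∀ {a b} → 0ℚ <ℚ a → 0ℚ <ℚ b → 0ℚ <ℚ a * b
0<-* {a} {b} p q = subst (_<ℚ a * b) (*-zeroʳ a) (ℚP.*-monoʳ-<-pos a {{ℚ.positive p}} q)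

0<-+ : ∀ {a b} → 0ℚ <ℚ a → 0ℚ ≤ℚ b → 0ℚ <ℚ a + b
0<-+ p q = ℚP.+-mono-<-≤ p q

0≤1 : 0ℚ ≤ℚ 1ℚ
0≤1 = *≤* (ℤ.+≤+ z≤n)

0<1 : 0ℚ <ℚ 1ℚ
0<1 = ℚ.*<* (ℤ.+<+ (s≤s z≤n))

0≤2 : 0ℚ ≤ℚ 2ℚ
0≤2 = 0≤-+ 0≤1 0≤1

0<2 : 0ℚ <ℚ 2ℚ
0<2 = 0<-+ 0<1 0≤1

0<3 : 0ℚ <ℚ 3ℚ
0<3 = 0<-+ 0<1 0≤2

*-≤1 : ∀ {a b} → 0ℚ ≤ℚ a → a ≤ℚ 1ℚ → 0ℚ ≤ℚ b → b ≤ℚ 1ℚ → a * b ≤ℚ 1ℚ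
*-≤1 = *-mono

*-shrink : ∀ {a b} → 0ℚ ≤ℚ a → b ≤ℚ 1ℚ → a * b ≤ℚ a
*-shrink {a} {b} 0≤a b≤1 = subst (a * b ≤ℚ_) (*-identityʳ a) (*-monoʳ 0≤a b≤1)

*-shrinkˡ : ∀ {a b} → 0ℚ ≤ℚ b → a ≤ℚ 1ℚ → a * b ≤ℚ b
*-shrinkˡ {a} {b} 0≤b a≤1 = subst (a * b ≤ℚ_) (*-identityˡ b) (*-monoˡ 0≤b a≤1)

x≤∣x∣ : ∀ x → x ≤ℚ ∣ x ∣
x≤∣x∣ x with ℚP.≤-total 0ℚ x
... | inj₁ 0≤x = ≤-reflexive (sym (ℚP.0≤p⇒∣p∣≡p 0≤x))
... | inj₂ x≤0 = ≤-trans x≤0 (ℚP.0≤∣p∣ x)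

-x≤∣x∣ : ∀ x → - x ≤ℚ ∣ x ∣
-x≤∣x∣ x = subst (- x ≤ℚ_) (ℚP.∣-p∣≡∣p∣ x) (x≤∣x∣ (- x))

∣∣-intro : ∀ {x c} → x ≤ℚ c → - x ≤ℚ c → ∣ x ∣ ≤ℚ c
∣∣-intro {x} p q with ℚP.∣p∣≡p∨∣p∣≡-p x
... | inj₁ eq = subst (_≤ℚ _) (sym eq) p
... | inj₂ eq = subst (_≤ℚ _) (sym eq) q

0≤-sq : ∀ a → 0ℚ ≤ℚ a * a
0≤-sq a with ℚP.≤-total 0ℚ a
... | inj₁ p = 0≤-* p p
... | inj₂ p = subst (0ℚ ≤ℚ_) (lem a) (0≤-* (ℚP.neg-antimono-≤ p) (ℚP.neg-antimono-≤ p))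
  where lem : ∀ a → - a * - a ≡ a * a
        lem = solve-∀ ℚ-ring

sq-mono : ∀ {a b} → 0ℚ ≤ℚ a → a ≤ℚ b → a * a ≤ℚ b * b
sq-mono p q = *-mono p q p q

sq-∣∣ : ∀ a → ∣ a ∣ * ∣ a ∣ ≡ a * a
sq-∣∣ a with ℚP.∣p∣≡p∨∣p∣≡-p a
... | inj₁ eq = cong₂ _*_ eq eq
... | inj₂ eq = trans (cong₂ _*_ eq eq) (lem a)
  where lem : ∀ a → - a * - a ≡ a * a
        lem = solve-∀ ℚ-ring

sq-cancel-≤ : ∀ {a b} → 0ℚ ≤ℚ b → a * a ≤ℚ b * b → a ≤ℚ b
sq-cancel-≤ {a} {b} 0≤b h with ℚP.≤-total a b
... | inj₁ p = p
... | inj₂ b≤a with b ℚP.<? a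
...   | no ¬b<a = ℚP.≮⇒≥ ¬b<a
...   | yes b<a = contradiction (<-≤-trans lt h) (<-irrefl refl)
  where 0<a : 0ℚ <ℚ a
        0<a = ≤-<-trans 0≤b b<a
        lt : b * b <ℚ a * a
        lt = ≤-<-trans (*-monoʳ 0≤b b≤a) (ℚP.*-monoˡ-<-pos a {{ℚ.positive 0<a}} b<a)

≤0-or-0< : ∀ p → p ≤ℚ 0ℚ ⊎ 0ℚ <ℚ p
≤0-or-0< p with 0ℚ ℚP.<? p
... | yes q = inj₂ q
... | no ¬q = inj₁ (ℚP.≮⇒≥ ¬q)

-- The junk value is inv 0 = 0.
opaque
  inv : ℚ → ℚ
  inv p with p ℚP.≟ 0ℚ
  ... | yes _ = 0ℚ
  ... | no p≢0 = 1/_ p {{ℚ.≢-nonZero p≢0}}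

  inv-* : ∀ {p} → 0ℚ <ℚ p → inv p * p ≡ 1ℚ
  inv-* {p} 0<p with p ℚP.≟ 0ℚ
  ... | yes p≡0 = contradiction (sym p≡0) (ℚP.<⇒≢ 0<p)
  ... | no p≢0 = ℚP.*-inverseˡ p {{ℚ.≢-nonZero p≢0}}

  0<inv : ∀ {p} → 0ℚ <ℚ p → 0ℚ <ℚ inv p
  0<inv {p} 0<p with p ℚP.≟ 0ℚ
  ... | yes p≡0 = contradiction (sym p≡0) (ℚP.<⇒≢ 0<p)
  ... | no p≢0 = ℚP.positive⁻¹ _ {{ℚP.1/pos⇒pos p {{ℚ.positive 0<p}}}}

  0≤inv : ∀ {p} → 0ℚ ≤ℚ p → 0ℚ ≤ℚ inv p
  0≤inv {p} 0≤p with ≤0-or-0< p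
  ... | inj₂ 0<p = <⇒≤ (0<inv 0<p)
  ... | inj₁ p≤0 with p ℚP.≟ 0ℚ
  ...   | yes _ = ≤-refl
  ...   | no p≢0 = contradiction (ℚP.≤-antisym p≤0 0≤p) p≢0

*-cancel-≤ : ∀ {c a b} → 0ℚ <ℚ c → c * a ≤ℚ c * b → a ≤ℚ b
*-cancel-≤ {c} 0<c h = ℚP.*-cancelˡ-≤-pos c {{ℚ.positive 0<c}} h

fromℕ : ℕ → ℚ
fromℕ zero = 0ℚ
fromℕ (suc n) = 1ℚ + fromℕ n

0≤fromℕ : ∀ n → 0ℚ ≤ℚ fromℕ n
0≤fromℕ zero = ≤-refl
0≤fromℕ (suc n) = 0≤-+ 0≤1 (0≤fromℕ n)

0<fromℕ-suc : ∀ n → 0ℚ <ℚ fromℕ (suc n)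
0<fromℕ-suc n = 0<-+ 0<1 (0≤fromℕ n)

fromℕ-mono : ∀ {m n} → m ≤ n → fromℕ m ≤ℚ fromℕ n
fromℕ-mono {n = n} z≤n = 0≤fromℕ n
fromℕ-mono (s≤s p) = +-monoʳ-≤ 1ℚ (fromℕ-mono p)

fromℕ-+ : ∀ m n → fromℕ (m ℕ.+ n) ≡ fromℕ m + fromℕ n
fromℕ-+ zero n = sym (+-identityˡ _)
fromℕ-+ (suc m) n = trans (cong (λ x → 1ℚ + x) (fromℕ-+ m n)) (sym (+-assoc 1ℚ (fromℕ m) (fromℕ n)))

fromℕ-* : ∀ m n → fromℕ (m ℕ.* n) ≡ fromℕ m * fromℕ n
fromℕ-* zero n = sym (*-zeroˡ (fromℕ n))
fromℕ-* (suc m) n = trans (fromℕ-+ n (m ℕ.* n)) (trans (cong (λ x → fromℕ n + x) (fromℕ-* m n)) (lem (fromℕ m) (fromℕ n)))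
  where lem : ∀ a b → b + a * b ≡ (1ℚ + a) * b
        lem = solve-∀ ℚ-ring

fromℕ-cancel-≤ : ∀ {m n} → fromℕ m ≤ℚ fromℕ n → m ≤ n
fromℕ-cancel-≤ {m} {n} h with m ℕP.≤? n
... | yes p = p
... | no p = contradiction (<-≤-trans lt (≤-trans (fromℕ-mono (ℕP.≰⇒> p)) h)) (<-irrefl refl)
  where lt : fromℕ n <ℚ fromℕ (suc n)
        lt = subst (_<ℚ fromℕ (suc n)) (+-identityˡ (fromℕ n)) (ℚP.+-monoˡ-< (fromℕ n) 0<1)

toℚᵘ-fromℕ : ∀ n → toℚᵘ (fromℕ n) ℚᵘ.≃ mkℚᵘ (ℤ.+ n) 0
toℚᵘ-fromℕ zero = *≡* refl
toℚᵘ-fromℕ (suc n) = ℚᵘP.≃-trans (ℚP.toℚᵘ-homo-+ 1ℚ (fromℕ n))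
  (ℚᵘP.≃-trans (ℚᵘP.+-congʳ (toℚᵘ 1ℚ) (toℚᵘ-fromℕ n)) (*≡* lem))
  where lem : (ℤ.+ 1 ℤ.* ℤ.+ 1 ℤ.+ ℤ.+ n ℤ.* ℤ.+ 1) ℤ.* ℤ.+ 1 ≡ ℤ.+ suc n ℤ.* ℤ.+ 1
        lem = cong (ℤ._* ℤ.+ 1) (cong (λ x → ℤ.+ 1 ℤ.+ x) (ℤP.*-identityʳ (ℤ.+ n)))

archimedean : ∀ p → Σ ℕ λ n → p ≤ℚ fromℕ n
archimedean p@(mkℚ (-[1+ k ]) d _) = 0 , *≤* (subst (ℤ._≤ +0) (sym (ℤP.*-identityʳ -[1+ k ])) ℤ.-≤+)
archimedean p@(mkℚ (ℤ.+ k) d _) = k , ℚP.toℚᵘ-cancel-≤ (ℚᵘP.≤-trans {j = mkℚᵘ (ℤ.+ k) 0} (ℚᵘ.*≤* lem) (ℚᵘP.≤-reflexive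
    (ℚᵘP.≃-sym (toℚᵘ-fromℕ k))))
  where lem : ℤ.+ k ℤ.* ℤ.+ 1 ℤ.≤ ℤ.+ k ℤ.* ℤ.+ suc d
        lem = ℤP.*-monoˡ-≤-nonNeg (ℤ.+ k) (ℤ.+≤+ (s≤s z≤n))

infixr 8 _^ℚ_
_^ℚ_ : ℚ → ℕ → ℚ
p ^ℚ zero = 1ℚ
p ^ℚ suc n = p * p ^ℚ n

0<^ : ∀ {p} n → 0ℚ <ℚ p → 0ℚ <ℚ p ^ℚ n
0<^ zero _ = 0<1
0<^ (suc n) 0<p = 0<-* 0<p (0<^ n 0<p)

^-≤1 : ∀ {p} n → 0ℚ <ℚ p → p ≤ℚ 1ℚ → p ^ℚ n ≤ℚ 1ℚ
^-≤1 zero _ _ = ≤-refl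
^-≤1 (suc n) 0<p p≤1 = *-≤1 (<⇒≤ 0<p) p≤1 (<⇒≤ (0<^ n 0<p)) (^-≤1 n 0<p p≤1)

^-antitone : ∀ {p m n} → 0ℚ <ℚ p → p ≤ℚ 1ℚ → m ≤ n → p ^ℚ n ≤ℚ p ^ℚ m
^-antitone {n = n} 0<p p≤1 z≤n = ^-≤1 n 0<p p≤1
^-antitone 0<p p≤1 (s≤s h) = *-monoʳ (<⇒≤ 0<p) (^-antitone 0<p p≤1 h)

fromℕ-^ : ∀ m n → fromℕ (m ^ n) ≡ fromℕ m ^ℚ n
fromℕ-^ m zero = +-identityʳ 1ℚ
fromℕ-^ m (suc n) = trans (fromℕ-* m (m ^ n)) (cong (λ x → fromℕ m * x) (fromℕ-^ m n))

ind : Bool → ℚ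
ind true = 1ℚ
ind false = 0ℚ

opaque
  lessᵇ : ℚ → ℚ → Bool
  lessᵇ a b = does (a ℚP.<? b)

  lessᵇ-cases : ∀ a b → lessᵇ a b ≡ true × a <ℚ b ⊎ lessᵇ a b ≡ false × b ≤ℚ a
  lessᵇ-cases a b with a ℚP.<? b
  ... | yes p = inj₁ (dec-true (a ℚP.<? b) p , p)
  ... | no p = inj₂ (dec-false (a ℚP.<? b) p , ℚP.≮⇒≥ p)

lessᵇ-false : ∀ {a b} → lessᵇ a b ≡ false → b ≤ℚ a
lessᵇ-false {a} {b} h with lessᵇ-cases a b
... | inj₁ (eq , _) = contradiction (trans (sym eq) h) λ ()
... | inj₂ (_ , p) = p

0≤ind : ∀ b → 0ℚ ≤ℚ ind b
0≤ind true = 0≤1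
0≤ind false = ≤-refl

ind≤1 : ∀ b → ind b ≤ℚ 1ℚ
ind≤1 true = ≤-refl
ind≤1 false = 0≤1

ind-idem : ∀ b → ind b * ind b ≡ ind b
ind-idem true = *-identityʳ 1ℚ
ind-idem false = *-zeroʳ 0ℚ

ind-∧ : ∀ b c → ind (b ∧ c) ≡ ind b * ind c
ind-∧ true c = sym (*-identityˡ (ind c))
ind-∧ false c = sym (*-zeroˡ (ind c))

-- The existence of a violating test is a question about all functions on tuples. It is decided only
-- under double negation, which is enough because the hard direction ends in a refutation.
¬¬-bind : ∀ {a b} {A : Set a} {B : Set b} → ¬ ¬ A → (A → ¬ ¬ B) → ¬ ¬ B
¬¬-bind m f ¬b = m λ a → f a ¬b

¬¬-em : ∀ {a} (A : Set a) → ¬ ¬ (A ⊎ ¬ A)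
¬¬-em A k = k (inj₂ λ a → k (inj₁ a))

does-⇔ : ∀ {a b} {A : Set a} {B : Set b} (p : Dec A) (q : Dec B) → (A → B) → (B → A) → does p ≡ does q
does-⇔ (yes a) q f g = sym (dec-true q (f a))
does-⇔ (no ¬a) q f g = sym (dec-false q (λ b → ¬a (g b)))

-- Averages

-- Kept apart from `Mean` so that Fubini can be applied with a plain sum as well as with another
-- average inside.
record Linear {X : Set} (ℓ : (X → ℚ) → ℚ) : Set where
  field
    cong-≡ : ∀ {f g} → (∀ x → f x ≡ g x) → ℓ f ≡ ℓ g
    add    : ∀ f g → ℓ (λ x → f x + g x) ≡ ℓ f + ℓ g
    scale  : ∀ a f → ℓ (λ x → a * f x) ≡ a * ℓ f

  scaleʳ : ∀ a f → ℓ (λ x → f x * a) ≡ ℓ f * a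
  scaleʳ a f = trans (cong-≡ λ x → *-comm (f x) a) (trans (scale a f) (*-comm a (ℓ f)))

  null : ℓ (λ _ → 0ℚ) ≡ 0ℚ
  null = trans (cong-≡ λ _ → sym (*-zeroˡ 0ℚ)) (trans (scale 0ℚ (λ _ → 0ℚ)) (*-zeroˡ (ℓ λ _ → 0ℚ)))

  neg : ∀ f → ℓ (λ x → - f x) ≡ - ℓ f
  neg f = trans (cong-≡ λ x → lem (f x)) (trans (scale (- 1ℚ) f) (sym (lem (ℓ f))))
    where lem : ∀ a → - a ≡ - 1ℚ * a
          lem = solve-∀ ℚ-ring

  sub : ∀ f g → ℓ (λ x → f x - g x) ≡ ℓ f - ℓ g
  sub f g = trans (add f (λ x → - g x)) (cong (λ t → ℓ f + t) (neg g))

open Linear public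

sumF : ∀ {m} → (Fin m → ℚ) → ℚ
sumF {zero} f = 0ℚ
sumF {suc m} f = f zero + sumF (λ i → f (suc i))

interchange : ∀ a b c d → (a + b) + (c + d) ≡ (a + c) + (b + d)
interchange = solve-∀ ℚ-ring

sumF-linear : ∀ {m} → Linear (sumF {m})
sumF-linear {zero} = record { cong-≡ = λ _ → refl ; add = λ _ _ → refl ; scale = λ a _ → sym (*-zeroʳ a) }
sumF-linear {suc m} = record
  { cong-≡ = λ h → cong₂ _+_ (h zero) (cong-≡ sumF-linear λ i → h (suc i))
  ; add    = λ f g → trans (cong (λ t → f zero + g zero + t) (add sumF-linear (λ i → f (suc i)) (λ i → g (suc i))))
                           (interchange (f zero) (g zero) (sumF λ i → f (suc i)) (sumF λ i → g (suc i)))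
  ; scale  = λ a f → trans (cong (λ t → a * f zero + t) (scale sumF-linear a (λ i → f (suc i))))
                           (sym (ℚP.*-distribˡ-+ a (f zero) (sumF λ i → f (suc i))))
  }

sumF-mono : ∀ {m} {f g : Fin m → ℚ} → (∀ i → f i ≤ℚ g i) → sumF f ≤ℚ sumF g
sumF-mono {zero} h = ≤-refl
sumF-mono {suc m} h = +-mono-≤ (h zero) (sumF-mono λ i → h (suc i))

sumF-nonneg : ∀ {m} {f : Fin m → ℚ} → (∀ i → 0ℚ ≤ℚ f i) → 0ℚ ≤ℚ sumF f
sumF-nonneg {m} {f} h = subst (_≤ℚ sumF f) (null (sumF-linear {m})) (sumF-mono h)

sumF-term : ∀ {m} {f : Fin m → ℚ} → (∀ i → 0ℚ ≤ℚ f i) → ∀ i → f i ≤ℚ sumF f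
sumF-term {f = f} h zero = ≤-by (sumF-nonneg λ i → h (suc i)) refl
sumF-term {f = f} h (suc i) = ≤-trans (sumF-term (λ i → h (suc i)) i) (≤-by (h zero) (+-comm (f zero) _))

sumF-1 : ∀ m → sumF {m} (λ _ → 1ℚ) ≡ fromℕ m
sumF-1 zero = refl
sumF-1 (suc m) = cong (λ t → 1ℚ + t) (sumF-1 m)

sumF-comm : ∀ {m} {Y : Set} {ℓ : (Y → ℚ) → ℚ} → Linear ℓ → (G : Fin m → Y → ℚ) →
  sumF (λ i → ℓ (G i)) ≡ ℓ (λ y → sumF (λ i → G i y))
sumF-comm {zero} L G = sym (null L)
sumF-comm {suc m} {ℓ = ℓ} L G = trans (cong (λ t → ℓ (G zero) + t) (sumF-comm L (λ i → G (suc i))))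
  (sym (add L (G zero) (λ y → sumF (λ i → G (suc i) y))))

sumL : {A : Set} → List A → (A → ℚ) → ℚ
sumL [] f = 0ℚ
sumL (a ∷ as) f = f a + sumL as f

sumL-linear : ∀ {A : Set} (as : List A) → Linear (sumL as)
sumL-linear [] = record { cong-≡ = λ _ → refl ; add = λ _ _ → refl ; scale = λ a _ → sym (*-zeroʳ a) }
sumL-linear (x ∷ as) = record
  { cong-≡ = λ h → cong₂ _+_ (h x) (cong-≡ (sumL-linear as) h)
  ; add    = λ f g → trans (cong (λ t → f x + g x + t) (add (sumL-linear as) f g))
                           (interchange (f x) (g x) (sumL as f) (sumL as g))
  ; scale  = λ a f → trans (cong (λ t → a * f x + t) (scale (sumL-linear as) a f))
                           (sym (ℚP.*-distribˡ-+ a (f x) (sumL as f)))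
  }

sumL-mono : ∀ {A : Set} (as : List A) {f g : A → ℚ} → (∀ {a} → a ∈ as → f a ≤ℚ g a) → sumL as f ≤ℚ sumL as g
sumL-mono [] h = ≤-refl
sumL-mono (a ∷ as) h = +-mono-≤ (h (here refl)) (sumL-mono as λ i → h (there i))

sumL-nonneg : ∀ {A : Set} (as : List A) {f : A → ℚ} → (∀ a → 0ℚ ≤ℚ f a) → 0ℚ ≤ℚ sumL as f
sumL-nonneg as {f} h = subst (_≤ℚ sumL as f) (null (sumL-linear as)) (sumL-mono as λ {a} _ → h a)

sumL-term : ∀ {A : Set} {as : List A} {f : A → ℚ} → (∀ a → 0ℚ ≤ℚ f a) → ∀ {a} → a ∈ as → f a ≤ℚ sumL as f
sumL-term {as = _ ∷ as} h (here refl) = ≤-by (sumL-nonneg as h) refl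
sumL-term {as = b ∷ as} {f} h (there i) = ≤-trans (sumL-term h i) (≤-by (h b) (+-comm (f b) _))

sumL-const : ∀ {A : Set} (as : List A) c → sumL as (λ _ → c) ≡ fromℕ (length as) * c
sumL-const [] c = sym (*-zeroˡ c)
sumL-const (_ ∷ as) c = trans (cong (λ t → c + t) (sumL-const as c)) (lem c (fromℕ (length as)))
  where lem : ∀ c l → c + l * c ≡ (1ℚ + l) * c
        lem = solve-∀ ℚ-ring

-- `In` marks the points that carry mass; averages over tuples of a prescribed support live inside
-- the type of all tuples. `comm` is Fubini: a finite average is a weighted sum, hence commutes with
-- every linear functional.
record Mean {X : Set} (In : X → Set) (E : (X → ℚ) → ℚ) : Set₁ where
  field
    linear : Linear E
    mono   : ∀ {f g} → (∀ x → In x → f x ≤ℚ g x) → E f ≤ℚ E g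
    unit   : E (λ _ → 1ℚ) ≡ 1ℚ
    pos    : ∀ {f} x → (∀ x → 0ℚ ≤ℚ f x) → In x → 0ℚ <ℚ f x → 0ℚ <ℚ E f
    comm   : ∀ {Y : Set} {ℓ : (Y → ℚ) → ℚ} → Linear ℓ → (F : X → Y → ℚ) →
             E (λ x → ℓ (F x)) ≡ ℓ (λ y → E (λ x → F x y))

  cong-on : ∀ {f g} → (∀ x → In x → f x ≡ g x) → E f ≡ E g
  cong-on h = ℚP.≤-antisym (mono λ x i → ≤-reflexive (h x i)) (mono λ x i → ≤-reflexive (sym (h x i)))

  nonneg : ∀ {f} → (∀ x → In x → 0ℚ ≤ℚ f x) → 0ℚ ≤ℚ E f
  nonneg {f} h = subst (_≤ℚ E f) (null linear) (mono h)

  const : ∀ c → E (λ _ → c) ≡ c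
  const c = trans (cong-≡ linear λ _ → sym (*-identityʳ c)) (trans (scale linear c (λ _ → 1ℚ)) (trans (cong
      (λ t → c * t) unit) (*-identityʳ c)))

  upper : ∀ {f c} → (∀ x → In x → f x ≤ℚ c) → E f ≤ℚ c
  upper {f} {c} h = subst (E f ≤ℚ_) (const c) (mono h)

  abs-≤ : ∀ {f g} → (∀ x → In x → ∣ f x ∣ ≤ℚ g x) → ∣ E f ∣ ≤ℚ E g
  abs-≤ {f} {g} h = ∣∣-intro (mono λ x i → ≤-trans (x≤∣x∣ (f x)) (h x i))
    (subst (_≤ℚ E g) (neg linear f) (mono λ x i → ≤-trans (-x≤∣x∣ (f x)) (h x i)))

  -- E_x E_y (f(x) g(y) − f(y) g(x))² ≥ 0
  cauchy-schwarz : ∀ (f g : X → ℚ) → E (λ x → f x * g x) * E (λ x → f x * g x) ≤ℚ E (λ x → f x * f x) * E (λ x → g x * g x)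
  cauchy-schwarz f g = *-cancel-≤ {2ℚ} {FG * FG} {FF * GG} 0<2 (diff-≤ {2ℚ * (FG * FG)} {2ℚ * (FF * GG)} (subst (0ℚ ≤ℚ_)
      (trans step₂ (final FF FG GG))
      (nonneg {λ x → E (D x)} λ x _ → nonneg {D x} λ y _ → 0≤-sq (f x * g y - f y * g x))))
    where
      D : X → X → ℚ
      D x y = (f x * g y - f y * g x) * (f x * g y - f y * g x)
      FF FG GG : ℚ
      FF = E (λ x → f x * f x)
      FG = E (λ x → f x * g x)
      GG = E (λ x → g x * g x)
      expand : ∀ a b c d → (a * d - c * b) * (a * d - c * b) ≡ (a * a * (d * d) + b * b * (c * c)) + (- 2ℚ * (a * b)) * (c * d)
      expand = solve-∀ ℚ-ring
      final : ∀ p q r → p * r + r * p + (- 2ℚ * q) * q ≡ 2ℚ * (p * r) - 2ℚ * (q * q)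
      final = solve-∀ ℚ-ring
      step₁ : ∀ x → E (λ y → (f x * g y - f y * g x) * (f x * g y - f y * g x))
        ≡ (f x * f x * GG + g x * g x * FF) + (- 2ℚ * (f x * g x)) * FG
      step₁ x = trans (cong-≡ linear λ y → expand (f x) (g x) (f y) (g y))
        (trans (add linear (λ y → f x * f x * (g y * g y) + g x * g x * (f y * f y)) (λ y → (- 2ℚ * (f x * g x)) *
            (f y * g y))) (cong₂ _+_
          (trans (add linear (λ y → f x * f x * (g y * g y)) (λ y → g x * g x * (f y * f y)))
            (cong₂ _+_ (scale linear (f x * f x) (λ y → g y * g y)) (scale linear (g x * g x) (λ y → f y * f y))))
          (scale linear (- 2ℚ * (f x * g x)) (λ y → f y * g y))))
      step₂ : E (λ x → E (λ y → (f x * g y - f y * g x) * (f x * g y - f y * g x)))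
        ≡ (FF * GG + GG * FF) + (- 2ℚ * FG) * FG
      step₂ = trans (cong-≡ linear step₁)
        (trans (add linear (λ x → f x * f x * GG + g x * g x * FF) (λ x → (- 2ℚ * (f x * g x)) * FG)) (cong₂ _+_
          (trans (add linear (λ x → f x * f x * GG) (λ x → g x * g x * FF))
            (cong₂ _+_ (scaleʳ linear GG (λ x → f x * f x)) (scaleʳ linear FF (λ x → g x * g x))))
          (trans (scaleʳ linear FG (λ x → - 2ℚ * (f x * g x))) (cong (_* FG) (scale linear (- 2ℚ) (λ x → f x * g x))))))

avgWeight : ℕ → ℚ
avgWeight n = inv (fromℕ (suc n))

opaque
  avg : ∀ {n} → (Fin (suc n) → ℚ) → ℚ
  avg {n} f = avgWeight n * sumF f

  avg-sumF : ∀ {n} (f : Fin (suc n) → ℚ) → avg f ≡ avgWeight n * sumF f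
  avg-sumF f = refl

  avg-linear : ∀ {n} → Linear (avg {n})
  avg-linear {n} = record
    { cong-≡ = λ h → cong (λ t → c * t) (cong-≡ sumF-linear h)
    ; add    = λ f g → trans (cong (λ t → c * t) (add sumF-linear f g)) (ℚP.*-distribˡ-+ c (sumF f) (sumF g))
    ; scale  = λ a f → trans (cong (λ t → c * t) (scale sumF-linear a f)) (lem c a (sumF f))
    }
    where
      c : ℚ
      c = avgWeight n
      lem : ∀ a b c → a * (b * c) ≡ b * (a * c)
      lem = solve-∀ ℚ-ring

  0<avgWeight : ∀ n → 0ℚ <ℚ avgWeight n
  0<avgWeight n = 0<inv (0<fromℕ-suc n)

  avg-mono : ∀ {n} {f g : Fin (suc n) → ℚ} → (∀ a → f a ≤ℚ g a) → avg f ≤ℚ avg g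
  avg-mono {n} h = *-monoʳ (<⇒≤ (0<avgWeight n)) (sumF-mono h)

  avg-1 : ∀ {n} → avg {n} (λ _ → 1ℚ) ≡ 1ℚ
  avg-1 {n} = trans (cong (λ t → avgWeight n * t) (sumF-1 (suc n))) (inv-* (0<fromℕ-suc n))

  avg-const : ∀ {n} c → avg {n} (λ _ → c) ≡ c
  avg-const {n} c = trans (cong-≡ (avg-linear {n}) λ _ → sym (*-identityʳ c))
    (trans (scale (avg-linear {n}) c (λ _ → 1ℚ)) (trans (cong (λ t → c * t) (avg-1 {n})) (*-identityʳ c)))

  avg-pos : ∀ {n} {f : Fin (suc n) → ℚ} a → (∀ a → 0ℚ ≤ℚ f a) → 0ℚ <ℚ f a → 0ℚ <ℚ avg f
  avg-pos {n} a h p = 0<-* (0<avgWeight n) (<-≤-trans p (sumF-term h a))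

  avg-comm : ∀ {n} {Y : Set} {ℓ : (Y → ℚ) → ℚ} → Linear ℓ → (G : Fin (suc n) → Y → ℚ) →
    avg (λ i → ℓ (G i)) ≡ ℓ (λ y → avg (λ i → G i y))
  avg-comm {n} L G = trans (cong (λ t → avgWeight n * t) (sumF-comm L G))
    (sym (scale L (avgWeight n) (λ y → sumF (λ i → G i y))))

E : ∀ {n} w → (Vec (Fin (suc n)) w → ℚ) → ℚ
E zero f = f []
E (suc w) f = avg (λ a → E w (λ x → f (a ∷ x)))

E-linear : ∀ {n} w → Linear (E {n} w)
E-linear zero = record { cong-≡ = λ h → h [] ; add = λ _ _ → refl ; scale = λ _ _ → refl }
E-linear (suc w) = record
  { cong-≡ = λ h → cong-≡ avg-linear λ a → cong-≡ (E-linear w) λ x → h (a ∷ x)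
  ; add    = λ f g → trans (cong-≡ avg-linear λ a → add (E-linear w) (λ x → f (a ∷ x)) (λ x → g (a ∷ x)))
                           (add avg-linear (λ a → E w (λ x → f (a ∷ x))) (λ a → E w (λ x → g (a ∷ x))))
  ; scale  = λ c f → trans (cong-≡ avg-linear λ a → scale (E-linear w) c (λ x → f (a ∷ x)))
                           (scale avg-linear c (λ a → E w (λ x → f (a ∷ x))))
  }

Everywhere : {X : Set} → X → Set
Everywhere _ = Unit

E-mono : ∀ {n} w {f g : Vec (Fin (suc n)) w → ℚ} → (∀ x → f x ≤ℚ g x) → E w f ≤ℚ E w g
E-mono zero h = h []
E-mono (suc w) h = avg-mono λ a → E-mono w λ x → h (a ∷ x)

E-mean : ∀ {n} w → Mean Everywhere (E {n} w)
E-mean w = record { linear = E-linear w ; mono = λ h → E-mono w λ x → h x tt ; unit = unit′ w ; pos = λ x h _ → pos′ w x h ; comm = comm′ w }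
  where
    unit′ : ∀ {n} w → E {n} w (λ _ → 1ℚ) ≡ 1ℚ
    unit′ zero = refl
    unit′ (suc w) = trans (cong-≡ avg-linear λ _ → unit′ w) avg-1
    nonneg′ : ∀ {n} w {f : Vec (Fin (suc n)) w → ℚ} → (∀ x → 0ℚ ≤ℚ f x) → 0ℚ ≤ℚ E w f
    nonneg′ w {f} h = subst (_≤ℚ E w f) (null (E-linear w)) (E-mono w h)
    pos′ : ∀ {n} w {f : Vec (Fin (suc n)) w → ℚ} x → (∀ x → 0ℚ ≤ℚ f x) → 0ℚ <ℚ f x → 0ℚ <ℚ E w f
    pos′ zero [] h p = p
    pos′ (suc w) (a ∷ x) h p = avg-pos a (λ b → nonneg′ w λ y → h (b ∷ y)) (pos′ w x (λ y → h (a ∷ y)) p)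
    comm′ : ∀ {n} w {Y : Set} {ℓ : (Y → ℚ) → ℚ} → Linear ℓ → (F : Vec (Fin (suc n)) w → Y → ℚ) →
      E w (λ x → ℓ (F x)) ≡ ℓ (λ y → E w (λ x → F x y))
    comm′ zero L F = refl
    comm′ (suc w) L F = trans (cong-≡ avg-linear λ a → comm′ w L (λ x → F (a ∷ x)))
      (avg-comm L (λ a y → E w (λ x → F (a ∷ x) y)))

E-++ : ∀ {n} w w′ (f : Vec (Fin (suc n)) (w ℕ.+ w′) → ℚ) → E (w ℕ.+ w′) f ≡ E w (λ x → E w′ (λ y → f (x Vec.++ y)))
E-++ zero w′ f = refl
E-++ (suc w) w′ f = cong-≡ avg-linear λ a → E-++ w w′ (λ x → f (a ∷ x))

E-resample : ∀ {n w} (u : Fin w) (f : Vec (Fin (suc n)) w → ℚ) → E w (λ y → avg (λ a → f (y [ u ]≔ a))) ≡ E w f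
E-resample {w = suc w} zero f = trans (cong-≡ avg-linear λ _ → sym (avg-comm (E-linear w) (λ a x → f (a ∷ x))))
  (avg-const (avg (λ a → E w (λ x → f (a ∷ x)))))
E-resample (suc u) f = cong-≡ avg-linear λ b → E-resample u (λ x → f (b ∷ x))

-- Conditional expectation

module Cond {X K : Set} {In : X → Set} {𝔼 : (X → ℚ) → ℚ} (M : Mean In 𝔼) (_≟_ : DecidableEquality K) (key : X → K) where
  open Mean M

  hit : X → K → ℚ
  hit x k = ind (does (key x ≟ k))

  mass : K → ℚ
  mass k = 𝔼 (λ x → hit x k)

  -- Conditional expectation of `f` on the cell of `z`. A cell outside the support may have mass 0,
  -- where the junk value of `inv` gives 0: nonnegativity holds everywhere, the upper bound only on
  -- `In`.
  Π : (X → ℚ) → X → ℚ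
  Π f z = 𝔼 (λ x → f x * hit x (key z)) * inv (mass (key z))

  Π-cong-key : ∀ f {z z′} → key z ≡ key z′ → Π f z ≡ Π f z′
  Π-cong-key f eq = cong (λ k → 𝔼 (λ x → f x * hit x k) * inv (mass k)) eq

  hit-self : ∀ {x z} → key x ≡ key z → hit x (key z) ≡ 1ℚ
  hit-self {x} {z} eq = cong ind (dec-true (key x ≟ key z) eq)

  mass-nonneg : ∀ k → 0ℚ ≤ℚ mass k
  mass-nonneg k = nonneg λ x _ → 0≤ind (does (key x ≟ k))

  mass-pos : ∀ {z} → In z → 0ℚ <ℚ mass (key z)
  mass-pos {z} i = pos z (λ x → 0≤ind (does (key x ≟ key z))) i (subst (0ℚ <ℚ_) (sym (hit-self refl)) 0<1)

  Π-nonneg : ∀ {f} → (∀ x → 0ℚ ≤ℚ f x) → ∀ z → 0ℚ ≤ℚ Π f z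
  Π-nonneg h z = 0≤-* (nonneg λ x _ → 0≤-* (h x) (0≤ind (does (key x ≟ key z)))) (0≤inv (mass-nonneg (key z)))

  Π-mass : ∀ f {z} → In z → Π f z * mass (key z) ≡ 𝔼 (λ x → f x * hit x (key z))
  Π-mass f {z} i = trans (*-assoc (𝔼 (λ x → f x * hit x (key z))) (inv (mass (key z))) (mass (key z)))
    (trans (cong (λ t → 𝔼 (λ x → f x * hit x (key z)) * t) (inv-* (mass-pos i))) (*-identityʳ _))

  Π-≤1 : ∀ {f} → (∀ x → f x ≤ℚ 1ℚ) → ∀ {z} → In z → Π f z ≤ℚ 1ℚ
  Π-≤1 {f} h {z} i = *-cancel-≤ {mass (key z)} {Π f z} {1ℚ} (mass-pos i)
    (subst₂ _≤ℚ_ (trans (sym (Π-mass f i)) (*-comm (Π f z) (mass (key z)))) (sym (*-identityʳ (mass (key z))))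
      (mono λ x _ → *-shrinkˡ (0≤ind (does (key x ≟ key z))) (h x)))

  Measurable : (X → ℚ) → Set
  Measurable T = ∀ x z → key x ≡ key z → T x ≡ T z

  -- As a double average over pairs in a common cell, the left side lets `T` and the inverse mass be
  -- read off at either point. After exchanging the averages, the inner one is the mass of the cell
  -- and cancels its inverse.
  𝔼-Π : ∀ f T → Measurable T → 𝔼 (λ z → Π f z * T z) ≡ 𝔼 (λ x → f x * T x)
  𝔼-Π f T meas = begin
    𝔼 (λ z → Π f z * T z)
      ≡⟨ Linear.cong-≡ linear (λ z → trans (*-assoc (𝔼 (λ x → f x * hit x (key z))) (inv (mass (key z))) (T z))
           (sym (Linear.scaleʳ linear (inv (mass (key z)) * T z) (λ x → f x * hit x (key z))))) ⟩
    𝔼 (λ z → 𝔼 (λ x → f x * hit x (key z) * (inv (mass (key z)) * T z)))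
      ≡⟨ comm linear (λ z x → f x * hit x (key z) * (inv (mass (key z)) * T z)) ⟩
    𝔼 (λ x → 𝔼 (λ z → f x * hit x (key z) * (inv (mass (key z)) * T z)))
      ≡⟨ Linear.cong-≡ linear (λ x → trans (Linear.cong-≡ linear (pointwise x))
           (Linear.scale linear (f x * (inv (mass (key x)) * T x)) (λ z → hit z (key x)))) ⟩
    𝔼 (λ x → f x * (inv (mass (key x)) * T x) * mass (key x))
      ≡⟨ cong-on (λ x i → trans (rearrange (f x) (inv (mass (key x))) (T x) (mass (key x)))
           (trans (cong (f x * T x *_) (inv-* (mass-pos i))) (*-identityʳ (f x * T x)))) ⟩
    𝔼 (λ x → f x * T x) ∎
    where
      open ≡-Reasoning
      rearrange : ∀ a b c d → a * (b * c) * d ≡ a * c * (b * d)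
      rearrange = solve-∀ ℚ-ring
      case₁ : ∀ a b → a * 1ℚ * b ≡ a * b * 1ℚ
      case₁ = solve-∀ ℚ-ring
      case₀ : ∀ a b c → a * 0ℚ * b ≡ a * c * 0ℚ
      case₀ = solve-∀ ℚ-ring
      pointwise : ∀ x z → f x * hit x (key z) * (inv (mass (key z)) * T z) ≡ f x * (inv (mass (key x)) * T x) * hit z (key x)
      pointwise x z with key x ≟ key z
      ... | yes eq = trans (case₁ (f x) _) (cong₂ _*_ (cong (f x *_) (cong₂ _*_ (cong (inv ∘ mass) (sym eq)) (sym (meas x z eq))))
                       (sym (hit-self (sym eq))))
      ... | no neq = trans (case₀ (f x) _ (inv (mass (key x)) * T x))
                       (cong (f x * (inv (mass (key x)) * T x) *_) (sym (cong ind (dec-false (key z ≟ key x) λ eq → neq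
                           (sym eq)))))

  𝔼-Π-1 : ∀ f → 𝔼 (Π f) ≡ 𝔼 f
  𝔼-Π-1 f = trans (Linear.cong-≡ linear λ z → sym (*-identityʳ (Π f z)))
    (trans (𝔼-Π f (λ _ → 1ℚ) (λ _ _ _ → refl)) (Linear.cong-≡ linear λ z → *-identityʳ (f z)))

module Cond₂ {X K K′ : Set} {In : X → Set} {𝔼 : (X → ℚ) → ℚ} (M : Mean In 𝔼)
  (_≟_ : DecidableEquality K) (key : X → K) (_≟′_ : DecidableEquality K′) (key′ : X → K′)
  (refines : ∀ x z → key′ x ≡ key′ z → key x ≡ key z) where
  open Mean M
  module C = Cond M _≟_ key
  module C′ = Cond M _≟′_ key′

  -- The coarse projection is constant on the fine cells, so by `𝔼-Π` for both partitions its inner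
  -- product with the fine projection is its own square norm.
  pythagoras : ∀ f → 𝔼 (λ z → C′.Π f z * C′.Π f z) ≡
    𝔼 (λ z → C.Π f z * C.Π f z) + 𝔼 (λ z → (C′.Π f z - C.Π f z) * (C′.Π f z - C.Π f z))
  pythagoras f = trans (final AA BB) (cong (BB +_) (sym step))
    where
      A B : X → ℚ
      A = C′.Π f
      B = C.Π f
      AA AB BB : ℚ
      AA = 𝔼 (λ z → A z * A z)
      AB = 𝔼 (λ z → A z * B z)
      BB = 𝔼 (λ z → B z * B z)
      AB≡BB : AB ≡ BB
      AB≡BB = trans (C′.𝔼-Π f B (λ x z eq → C.Π-cong-key f {x} {z} (refines x z eq))) (sym (C.𝔼-Π f B
          λ x z → C.Π-cong-key f {x} {z}))
      expand : ∀ a b → (a - b) * (a - b) ≡ a * a + (- 2ℚ * (a * b) + b * b)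
      expand = solve-∀ ℚ-ring
      final : ∀ a b → a ≡ b + (a + (- 2ℚ * b + b))
      final = solve-∀ ℚ-ring
      step : 𝔼 (λ z → (A z - B z) * (A z - B z)) ≡ AA + (- 2ℚ * BB + BB)
      step = trans (Linear.cong-≡ linear λ z → expand (A z) (B z))
        (trans (Linear.add linear (λ z → A z * A z) (λ z → - 2ℚ * (A z * B z) + B z * B z)) (cong (AA +_)
          (trans (Linear.add linear (λ z → - 2ℚ * (A z * B z)) (λ z → B z * B z)) (cong (_+ BB)
            (trans (Linear.scale linear (- 2ℚ) (λ z → A z * B z)) (cong (- 2ℚ *_) AB≡BB))))))

  -- `T` does not distinguish points of a fine cell, so in the correlation `f` may be replaced by
  -- its fine projection. What remains is the difference of the two projections, and Cauchy-Schwarz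
  -- gives its mean square.
  correlation-increment : ∀ f T {ε} → 0ℚ ≤ℚ ε → C′.Measurable T → (∀ z → T z * T z ≤ℚ 1ℚ) →
    ε ≤ℚ ∣ 𝔼 (λ z → (f z - C.Π f z) * T z) ∣ →
    ε * ε ≤ℚ 𝔼 (λ z → (C′.Π f z - C.Π f z) * (C′.Π f z - C.Π f z))
  correlation-increment f T {ε} 0≤ε meas T≤1 big =
    ≤-trans (subst (ε * ε ≤ℚ_) (sq-∣∣ GT) (sq-mono 0≤ε (subst (λ t → ε ≤ℚ ∣ t ∣) eq big)))
      (≤-trans (cauchy-schwarz G T) (*-shrink (nonneg λ z _ → 0≤-sq (G z)) (upper λ z _ → T≤1 z)))
    where
      G : X → ℚ
      G z = C′.Π f z - C.Π f z
      GT : ℚ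
      GT = 𝔼 (λ z → G z * T z)
      distrib : ∀ a b t → (a - b) * t ≡ a * t - b * t
      distrib = solve-∀ ℚ-ring
      split : ∀ (u v : X → ℚ) → 𝔼 (λ z → (u z - v z) * T z) ≡ 𝔼 (λ z → u z * T z) - 𝔼 (λ z → v z * T z)
      split u v = trans (Linear.cong-≡ linear λ z → distrib (u z) (v z) (T z)) (Linear.sub linear (λ z → u z * T z)
          (λ z → v z * T z))
      eq : 𝔼 (λ z → (f z - C.Π f z) * T z) ≡ GT
      eq = trans (split f (C.Π f)) (trans (cong (_- 𝔼 (λ z → C.Π f z * T z)) (sym (C′.𝔼-Π f T meas))) (sym (split (C′.Π f)
          (C.Π f))))

-- Partial tuples

-- The support is part of the value, so tuples of all levels form one type and a single function
-- colours them all.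
Partial : Set → ℕ → Set
Partial A v = Vec (Maybe A) v

module _ {A : Set} where

  supp : ∀ {v} → Partial A v → Subset v
  supp = Vec.map is-just

  level : ∀ {v} → Partial A v → ℕ
  level z = card (supp z)

  infixl 6 _↾_ _⇂_ _∖_
  infix 4 _≼_

  _↾_ : ∀ {v} → Partial A v → Subset v → Partial A v
  z ↾ b = zipWith (λ a c → if c then a else nothing) z b

  _⇂_ : ∀ {v} → Vec A v → Subset v → Partial A v
  x ⇂ b = zipWith (λ a c → if c then just a else nothing) x b

  _∖_ : ∀ {v} → Partial A v → Fin v → Partial A v
  z ∖ r = z [ r ]≔ nothing

  lookup-↾ : ∀ {v} (z : Partial A v) b r → lookup (z ↾ b) r ≡ (if lookup b r then lookup z r else nothing)
  lookup-↾ z b r = VecP.lookup-zipWith _ r z b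

  lookup-⇂ : ∀ {v} (x : Vec A v) b r → lookup (x ⇂ b) r ≡ (if lookup b r then just (lookup x r) else nothing)
  lookup-⇂ x b r = VecP.lookup-zipWith _ r x b

  lookup-supp : ∀ {v} (z : Partial A v) r → lookup (supp z) r ≡ is-just (lookup z r)
  lookup-supp z r = VecP.lookup-map r is-just z

  supp-⇂ : ∀ {v} (x : Vec A v) b → supp (x ⇂ b) ≡ b
  supp-⇂ [] [] = refl
  supp-⇂ (a ∷ x) (true ∷ b) = cong (true ∷_) (supp-⇂ x b)
  supp-⇂ (a ∷ x) (false ∷ b) = cong (false ∷_) (supp-⇂ x b)

  ↾-⊤ : ∀ {v} (z : Partial A v) → z ↾ ⊤ ≡ z
  ↾-⊤ [] = refl
  ↾-⊤ (a ∷ z) = cong (a ∷_) (↾-⊤ z)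

  ∖-as-↾ : ∀ {v} (z : Partial A v) r → z ∖ r ≡ z ↾ (⊤ [ r ]≔ false)
  ∖-as-↾ (a ∷ z) zero = cong (nothing ∷_) (sym (↾-⊤ z))
  ∖-as-↾ (a ∷ z) (suc r) = cong (a ∷_) (∖-as-↾ z r)

  ⇂-↾ : ∀ {v} (x : Vec A v) b c → x ⇂ b ↾ c ≡ x ⇂ (b ∩ c)
  ⇂-↾ [] [] [] = refl
  ⇂-↾ (a ∷ x) (true ∷ b) (c ∷ cs) = cong (_ ∷_) (⇂-↾ x b cs)
  ⇂-↾ (a ∷ x) (false ∷ b) (true ∷ cs) = cong (_ ∷_) (⇂-↾ x b cs)
  ⇂-↾ (a ∷ x) (false ∷ b) (false ∷ cs) = cong (_ ∷_) (⇂-↾ x b cs)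

  level-↾ : ∀ {v} (z : Partial A v) b → level (z ↾ b) ≤ level z
  level-↾ [] [] = z≤n
  level-↾ (just a ∷ z) (true ∷ b) = s≤s (level-↾ z b)
  level-↾ (just a ∷ z) (false ∷ b) = ℕP.m≤n⇒m≤1+n (level-↾ z b)
  level-↾ (nothing ∷ z) (true ∷ b) = level-↾ z b
  level-↾ (nothing ∷ z) (false ∷ b) = level-↾ z b

  level-∖ : ∀ {v} (z : Partial A v) r {a} → lookup z r ≡ just a → suc (level (z ∖ r)) ≡ level z
  level-∖ (just _ ∷ z) zero eq = refl
  level-∖ (just _ ∷ z) (suc r) eq = cong suc (level-∖ z r eq)
  level-∖ (nothing ∷ z) (suc r) eq = level-∖ z r eq

  _≼_ : ∀ {v} → Partial A v → Partial A v → Set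
  t ≼ s = ∀ r u → lookup t r ≡ just u → lookup s r ≡ just u

  ≼-level : ∀ {v} (t s : Partial A v) → t ≼ s → level t ≤ level s
  ≼-level [] [] h = z≤n
  ≼-level (just a ∷ t) (c ∷ s) h with refl ← h zero a refl = s≤s (≼-level t s λ r → h (suc r))
  ≼-level (nothing ∷ t) (just a ∷ s) h = ℕP.m≤n⇒m≤1+n (≼-level t s λ r → h (suc r))
  ≼-level (nothing ∷ t) (nothing ∷ s) h = ≼-level t s λ r → h (suc r)

  ≼-antisym : ∀ {v} (t s : Partial A v) → t ≼ s → level s ≤ level t → t ≡ s
  ≼-antisym [] [] h l = refl
  ≼-antisym (just a ∷ t) (c ∷ s) h l with refl ← h zero a refl = cong (just a ∷_) (≼-antisym t s (λ r → h (suc r)) (ℕP.≤-pred l))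
  ≼-antisym (nothing ∷ t) (just a ∷ s) h l = contradiction (ℕP.≤-trans l (≼-level t s λ r → h (suc r))) ℕP.1+n≰n
  ≼-antisym (nothing ∷ t) (nothing ∷ s) h l = cong (nothing ∷_) (≼-antisym t s (λ r → h (suc r)) l)

  ↾-≼ : ∀ {v} (z : Partial A v) b → z ↾ b ≼ z
  ↾-≼ z b r u eq with lookup b r | trans (sym (lookup-↾ z b r)) eq
  ... | true | p = p

  ≼-↾ : ∀ {v} (t s : Partial A v) → t ≼ s → s ↾ supp t ≡ t
  ≼-↾ [] [] h = refl
  ≼-↾ (just a ∷ t) (c ∷ s) h with refl ← h zero a refl = cong (just a ∷_) (≼-↾ t s λ r → h (suc r))
  ≼-↾ (nothing ∷ t) (c ∷ s) h = cong (nothing ∷_) (≼-↾ t s λ r → h (suc r))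

  ↾-idem⇒≼ : ∀ {v} (t s : Partial A v) → s ↾ supp t ≡ t → t ≼ s
  ↾-idem⇒≼ t s eq r u h = ↾-≼ s (supp t) r u (trans (cong (λ z → lookup z r) eq) h)

  module _ (_≟_ : DecidableEquality A) where

    _≟ᴾ_ : ∀ {v} → DecidableEquality (Partial A v)
    _≟ᴾ_ = VecP.≡-dec (MaybeP.≡-dec _≟_)

    _≼?_ : ∀ {v} (t s : Partial A v) → Dec (t ≼ s)
    t ≼? s with (s ↾ supp t) ≟ᴾ t
    ... | yes eq = yes (↾-idem⇒≼ t s eq)
    ... | no neq = no λ h → neq (≼-↾ t s h)

    ¬≼-witness : ∀ {v} (t s : Partial A v) → ¬ (t ≼ s) → Σ (Fin v) λ r → Σ A λ u → lookup t r ≡ just u × lookup s r ≢ just u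
    ¬≼-witness t s ¬h with FinP.any? (λ r → (BoolP._≟_ (is-just (lookup t r)) true) Dec.×-dec ¬? (MaybeP.≡-dec _≟_ (lookup t r) (lookup s r)))
    ... | no ¬w = contradiction (λ r u eq → decidable-stable (MaybeP.≡-dec _≟_ (lookup s r) (just u))
            λ ne → ¬w (r , cong is-just eq , λ e → ne (trans (sym e) eq))) ¬h
    ... | yes (r , j , ne) with lookup t r in eq
    ...   | just u = r , u , eq , λ e → ne (sym e)

-- Patterns, their evaluation, and resampling along a pattern

Point : ℕ → ℕ → Set
Point n w = Vec (Fin (suc n)) w

-- A face of a `v`-partite complex on the vertices `Fin w`: position `r` holds its vertex in part
-- `r`, if there is one. Faces and tuples thus have the same shape, and `ev` composes a face with a
-- map of the vertices.
Edge : ℕ → ℕ → Set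
Edge v w = Partial (Fin w) v

vec-ext : ∀ {A : Set} {n} {xs ys : Vec A n} → (∀ r → lookup xs r ≡ lookup ys r) → xs ≡ ys
vec-ext h = Pointwise-≡⇒≡ (ext h)

ev : ∀ {A : Set} {w v} → Vec A w → Partial (Fin w) v → Partial A v
ev y = Vec.map (Maybe.map (lookup y))

lookup-ev : ∀ {A : Set} {w v} (y : Vec A w) (t : Partial (Fin w) v) r → lookup (ev y t) r ≡ Maybe.map (lookup y) (lookup t r)
lookup-ev y t r = VecP.lookup-map r _ t

ev-cong : ∀ {A : Set} {w w′ v} (y : Vec A w) (y′ : Vec A w′) (t : Partial (Fin w) v) (t′ : Partial (Fin w′) v) →
  (∀ r → Maybe.map (lookup y) (lookup t r) ≡ Maybe.map (lookup y′) (lookup t′ r)) → ev y t ≡ ev y′ t′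
ev-cong y y′ t t′ h = vec-ext λ r → trans (lookup-ev y t r) (trans (h r) (sym (lookup-ev y′ t′ r)))

ev-↾ : ∀ {A : Set} {w v} (y : Vec A w) (t : Partial (Fin w) v) b → ev y (t ↾ b) ≡ ev y t ↾ b
ev-↾ y [] [] = refl
ev-↾ y (a ∷ t) (true ∷ b) = cong (_ ∷_) (ev-↾ y t b)
ev-↾ y (a ∷ t) (false ∷ b) = cong (_ ∷_) (ev-↾ y t b)

supp-ev : ∀ {A : Set} {w v} (y : Vec A w) (t : Partial (Fin w) v) → supp (ev y t) ≡ supp t
supp-ev y [] = refl
supp-ev y (just _ ∷ t) = cong (true ∷_) (supp-ev y t)
supp-ev y (nothing ∷ t) = cong (false ∷_) (supp-ev y t)

-- If `s` names a vertex twice, the first position wins; `Inj s` excludes this where the values are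
-- read back.
overwrite : ∀ {A : Set} {w v} → Vec A w → Partial (Fin w) v → Partial A v → Vec A w
overwrite y [] [] = y
overwrite y (just u ∷ s) (just a ∷ z) = overwrite y s z [ u ]≔ a
overwrite y (just u ∷ s) (nothing ∷ z) = overwrite y s z
overwrite y (nothing ∷ s) (_ ∷ z) = overwrite y s z

Inj : ∀ {A : Set} {v} → Partial A v → Set
Inj s = ∀ r r′ u → lookup s r ≡ just u → lookup s r′ ≡ just u → r ≡ r′

overwrite-in : ∀ {A : Set} {w v} (y : Vec A w) (s : Partial (Fin w) v) (z : Partial A v) → Inj s →
  ∀ r {u a} → lookup s r ≡ just u → lookup z r ≡ just a → lookup (overwrite y s z) u ≡ a
overwrite-in y (just u ∷ s) (just a ∷ z) inj zero refl refl = VecP.lookup∘update u (overwrite y s z) a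
overwrite-in y (just u′ ∷ s) (just a′ ∷ z) inj (suc r) {u} p q =
  trans (VecP.lookup∘update′ (λ { refl → contradiction (inj zero (suc r) u refl p) λ () }) (overwrite y s z) a′)
    (overwrite-in y s z (λ r r′ u p q → FinP.suc-injective (inj (suc r) (suc r′) u p q)) r p q)
overwrite-in y (just _ ∷ s) (nothing ∷ z) inj (suc r) p q =
  overwrite-in y s z (λ r r′ u p q → FinP.suc-injective (inj (suc r) (suc r′) u p q)) r p q
overwrite-in y (nothing ∷ s) (_ ∷ z) inj (suc r) p q =
  overwrite-in y s z (λ r r′ u p q → FinP.suc-injective (inj (suc r) (suc r′) u p q)) r p q

overwrite-cong : ∀ {A : Set} {w v} (y : Vec A w) (s : Partial (Fin w) v) (z z′ : Partial A v) u →
  (∀ r → lookup s r ≡ just u → lookup z r ≡ lookup z′ r) → lookup (overwrite y s z) u ≡ lookup (overwrite y s z′) u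
overwrite-cong y [] [] [] u h = refl
overwrite-cong y (nothing ∷ s) (_ ∷ z) (_ ∷ z′) u h = overwrite-cong y s z z′ u λ r → h (suc r)
overwrite-cong y (just u′ ∷ s) (a ∷ z) (a′ ∷ z′) u h with u Fin.≟ u′
overwrite-cong y (just u′ ∷ s) (a ∷ z) (a′ ∷ z′) u h | yes refl with a | a′ | h zero refl
... | just b | _ | refl = trans (VecP.lookup∘update u (overwrite y s z) b) (sym (VecP.lookup∘update u (overwrite y s z′) b))
... | nothing | _ | refl = overwrite-cong y s z z′ u λ r → h (suc r)
overwrite-cong y (just u′ ∷ s) (a ∷ z) (a′ ∷ z′) u h | no ne = trans (drop a z) (trans (overwrite-cong y s z z′ u λ r → h
    (suc r)) (sym (drop a′ z′)))
  where drop : ∀ a z → lookup (overwrite y (just u′ ∷ s) (a ∷ z)) u ≡ lookup (overwrite y s z) u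
        drop (just a) z = VecP.lookup∘update′ ne (overwrite y s z) a
        drop nothing z = refl

overwrite-out : ∀ {A : Set} {w v} (y : Vec A w) (s : Partial (Fin w) v) (z : Partial A v) u →
  (∀ r → lookup s r ≢ just u) → lookup (overwrite y s z) u ≡ lookup y u
overwrite-out y [] [] u h = refl
overwrite-out y (nothing ∷ s) (_ ∷ z) u h = overwrite-out y s z u λ r → h (suc r)
overwrite-out y (just u′ ∷ s) (just a ∷ z) u h =
  trans (VecP.lookup∘update′ (λ eq → h zero (cong just (sym eq))) (overwrite y s z) a) (overwrite-out y s z u λ r → h (suc r))
overwrite-out y (just u′ ∷ s) (nothing ∷ z) u h = overwrite-out y s z u λ r → h (suc r)

ev-overwrite : ∀ {A : Set} {w v} (y : Vec A w) (s : Partial (Fin w) v) (z : Partial A v) → Inj s → supp z ≡ supp s →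
  ev (overwrite y s z) s ≡ z
ev-overwrite y s z inj eq = vec-ext λ r → trans (lookup-ev (overwrite y s z) s r) (case′ r (lookup s r) refl (lookup z r) refl)
  where
    support : ∀ r → is-just (lookup z r) ≡ is-just (lookup s r)
    support r = trans (sym (lookup-supp z r)) (trans (cong (λ e → lookup e r) eq) (lookup-supp s r))
    case′ : ∀ r m → lookup s r ≡ m → ∀ m′ → lookup z r ≡ m′ → Maybe.map (lookup (overwrite y s z)) m ≡ lookup z r
    case′ r (just u) p (just a) q = trans (cong just (overwrite-in y s z inj r p q)) (sym q)
    case′ r nothing p nothing q = sym q
    case′ r (just u) p nothing q = contradiction (trans (sym (cong is-just q)) (trans (support r) (cong is-just p))) λ ()
    case′ r nothing p (just a) q = contradiction (trans (sym (cong is-just p)) (trans (sym (support r)) (cong is-just q))) λ ()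

-- The coordinates outside `e` are averaged out trivially, so that all supports share one sample
-- space.
Eₛ : ∀ {n v} → Subset v → (Partial (Fin (suc n)) v → ℚ) → ℚ
Eₛ {v = v} e g = E v (λ x → g (x ⇂ e))

Eₛ-mean : ∀ {n v} (e : Subset v) → Mean (λ z → supp z ≡ e) (Eₛ {n} e)
Eₛ-mean {n} {v} e = record
  { linear = record { cong-≡ = λ h → cong-≡ (E-linear v) λ x → h (x ⇂ e)
                    ; add = λ f g → add (E-linear v) (λ x → f (x ⇂ e)) (λ x → g (x ⇂ e))
                    ; scale = λ a f → scale (E-linear v) a (λ x → f (x ⇂ e)) }
  ; mono = λ h → E-mono v λ x → h (x ⇂ e) (supp-⇂ x e)
  ; unit = Mean.unit (E-mean v)
  ; pos = λ {f} z h eq p → Mean.pos (E-mean v) (fill z) (λ x → h (x ⇂ e)) tt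
            (subst (λ t → 0ℚ <ℚ f t) (sym (trans (cong (fill z ⇂_) (sym eq)) (fill-⇂ z))) p)
  ; comm = λ L F → Mean.comm (E-mean v) L (λ x → F (x ⇂ e))
  }
  where
    fill : ∀ {v} → Partial (Fin (suc n)) v → Vec (Fin (suc n)) v
    fill = Vec.map (Maybe.fromMaybe zero)
    fill-⇂ : ∀ {v} (z : Partial (Fin (suc n)) v) → fill z ⇂ supp z ≡ z
    fill-⇂ [] = refl
    fill-⇂ (just a ∷ z) = cong (just a ∷_) (fill-⇂ z)
    fill-⇂ (nothing ∷ z) = cong (nothing ∷_) (fill-⇂ z)

-- Each vertex of `s` is resampled in turn by `E-resample`. This is how the vertices outside a face
-- are frozen while the tuple on the face varies.
E-overwrite : ∀ {n w v} (s : Partial (Fin w) v) (F : Vec (Fin (suc n)) w → ℚ) →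
  E w (λ y → Eₛ (supp s) (λ z → F (overwrite y s z))) ≡ E w F
E-overwrite [] F = refl
E-overwrite {w = w} {suc v} (nothing ∷ s) F =
  trans (cong-≡ (E-linear w) λ y → avg-const (Eₛ (supp s) (λ z → F (overwrite y s z)))) (E-overwrite s F)
E-overwrite {w = w} {suc v} (just u ∷ s) F =
  trans (cong-≡ (E-linear w) λ y → avg-comm (Mean.linear (Eₛ-mean (supp s))) (λ a z → F (overwrite y s z [ u ]≔ a)))
    (trans (E-overwrite s (λ y → avg (λ a → F (y [ u ]≔ a)))) (E-resample u F))

-- Regularity

-- Bit strings can be refined without changing the type of colours. Only a bound on the length has
-- to be tracked, and `codes` turns it into a finite list of colours.
Colour : Set
Colour = List Bool

_≟ᶜ_ : DecidableEquality Colour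
_≟ᶜ_ = ListP.≡-dec BoolP._≟_

codes : ℕ → List Colour
codes zero = [] ∷ []
codes (suc M) = [] ∷ map (true ∷_) (codes M) ++ map (false ∷_) (codes M)

∈-codes : ∀ M κ → length κ ≤ M → κ ∈ codes M
∈-codes zero [] _ = here refl
∈-codes (suc M) [] _ = here refl
∈-codes (suc M) (true ∷ κ) (s≤s h) = there (∈P.∈-++⁺ˡ (∈P.∈-map⁺ (true ∷_) (∈-codes M κ h)))
∈-codes (suc M) (false ∷ κ) (s≤s h) = there (∈P.∈-++⁺ʳ _ (∈P.∈-map⁺ (false ∷_) (∈-codes M κ h)))

masks : ∀ v → List (Subset v)
masks zero = [] ∷ []
masks (suc v) = map (true ∷_) (masks v) ++ map (false ∷_) (masks v)

∈-masks : ∀ {v} (e : Subset v) → e ∈ masks v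
∈-masks [] = here refl
∈-masks (true ∷ e) = ∈P.∈-++⁺ˡ (∈P.∈-map⁺ (true ∷_) (∈-masks e))
∈-masks (false ∷ e) = ∈P.∈-++⁺ʳ _ (∈P.∈-map⁺ (false ∷_) (∈-masks e))

allF : ∀ {v} → (Fin v → Bool) → Bool
allF {zero} b = true
allF {suc v} b = b zero ∧ allF (λ r → b (suc r))

allF-cong : ∀ {v} {b b′ : Fin v → Bool} → (∀ r → b r ≡ b′ r) → allF b ≡ allF b′
allF-cong {zero} h = refl
allF-cong {suc v} h = cong₂ _∧_ (h zero) (allF-cong λ r → h (suc r))

toList-++-injective : ∀ {A : Set} {n}
    (xs xs′ : Vec A n) {ys ys′} → Vec.toList xs ++ ys ≡ Vec.toList xs′ ++ ys′ → xs ≡ xs′ × ys ≡ ys′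
toList-++-injective [] [] eq = refl , eq
toList-++-injective (x ∷ xs) (x′ ∷ xs′) eq with ListP.∷-injective eq
... | refl , eq′ with toList-++-injective xs xs′ eq′
...   | refl , eq″ = refl , eq″

-- The q-colours of the facets of z; supp z is recorded as well.
faceKey : {A K : Set} {v : ℕ} → (Partial A v → K) → Partial A v → Partial K v
faceKey q z = tabulate λ r → Maybe.map (λ _ → q (z ∖ r)) (lookup z r)

lookup-faceKey : ∀ {A K : Set} {v} (q : Partial A v → K) z r → lookup (faceKey q z) r ≡ Maybe.map (λ _ → q (z ∖ r)) (lookup z r)
lookup-faceKey q z r = VecP.lookup∘tabulate _ r

faceKey-≡ : ∀ {A K : Set} {v} {q : Partial A v → K} {z z′} → faceKey q z ≡ faceKey q z′ → ∀ r →
  Maybe.map (λ _ → q (z ∖ r)) (lookup z r) ≡ Maybe.map (λ _ → q (z′ ∖ r)) (lookup z′ r)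
faceKey-≡ {q = q} {z} {z′} eq r = trans (sym (lookup-faceKey q z r)) (trans (cong (λ k → lookup k r) eq) (lookup-faceKey q z′ r))

module Regularity {n v : ℕ} where

  Tuple : Set
  Tuple = Partial (Fin (suc n)) v

  Refines : (q q′ : Tuple → Colour) → Set
  Refines q q′ = ∀ z z′ → q′ z ≡ q′ z′ → q z ≡ q z′

  refines-refl : ∀ q → Refines q q
  refines-refl _ _ _ eq = eq

  refines-trans : ∀ q q′ q″ → Refines q q′ → Refines q′ q″ → Refines q q″
  refines-trans _ _ _ r r′ z z′ eq = r z z′ (r′ z z′ eq)

  faceKey-refines : ∀ q q′ → Refines q q′ → ∀ z z′ → faceKey q′ z ≡ faceKey q′ z′ → faceKey q z ≡ faceKey q z′
  faceKey-refines q q′ ref z z′ eq = vec-ext λ r →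
    trans (lookup-faceKey q z r) (trans (go (lookup z r) (lookup z′ r) (faceKey-≡ {q = q′} {z} {z′} eq r)) (sym
        (lookup-faceKey q z′ r)))
    where
      go : ∀ {r} (m m′ : Maybe (Fin (suc n))) → Maybe.map (λ _ → q′ (z ∖ r)) m ≡ Maybe.map (λ _ → q′ (z′ ∖ r)) m′ →
        Maybe.map (λ _ → q (z ∖ r)) m ≡ Maybe.map (λ _ → q (z′ ∖ r)) m′
      go nothing nothing _ = refl
      go (just _) (just _) eq = cong just (ref _ _ (MaybeP.just-injective eq))

  _≟ᵏ_ : DecidableEquality (Partial Colour v)
  _≟ᵏ_ = _≟ᴾ_ _≟ᶜ_

  module Faces (e : Subset v) (q : Tuple → Colour) = Cond (Eₛ-mean {n} e) _≟ᵏ_ (faceKey q)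

  isColour : (Tuple → Colour) → Colour → Tuple → ℚ
  isColour c κ z = ind (does (c z ≟ᶜ κ))

  -- A position outside the support counts as true, so the product runs over the facets of `z` only
  -- and every factor misses a coordinate of `z`.
  test : (Fin v → Tuple → Bool) → Tuple → Bool
  test A z = allF λ r → Maybe.maybe′ (λ _ → A r (z ∖ r)) true (lookup z r)

  -- The prefix always has `v` bits, so equal refined colours have equal test bits and equal old
  -- colours, whatever the lengths of the old ones.
  refine : (Fin v → Tuple → Bool) → (Tuple → Colour) → Tuple → Colour
  refine A q z = Vec.toList (tabulate λ r → A r z) ++ q z

  refine-refines : ∀ A q → Refines q (refine A q)
  refine-refines A q z z′ eq = proj₂ (toList-++-injective (tabulate λ r → A r z) (tabulate λ r → A r z′) eq)

  length-refine : ∀ A q z → length (refine A q z) ≡ v ℕ.+ length (q z)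
  length-refine A q z = trans (ListP.length-++ (Vec.toList (tabulate λ r → A r z))) (cong (ℕ._+ length (q z))
      (VecP.length-toList (tabulate λ r → A r z)))

  test-measurable : ∀ A q z z′ → faceKey (refine A q) z ≡ faceKey (refine A q) z′ → test A z ≡ test A z′
  test-measurable A q z z′ eq = allF-cong λ r → go r (lookup z r) (lookup z′ r) (faceKey-≡ {q = refine A q} {z} {z′} eq r)
    where
      go : ∀ r (m m′ : Maybe (Fin (suc n))) → Maybe.map (λ _ → refine A q (z ∖ r)) m ≡ Maybe.map (λ _ → refine A q (z′ ∖ r)) m′ →
        Maybe.maybe′ (λ _ → A r (z ∖ r)) true m ≡ Maybe.maybe′ (λ _ → A r (z′ ∖ r)) true m′
      go r nothing nothing _ = refl
      go r (just _) (just _) eq = trans (sym (VecP.lookup∘tabulate (λ r′ → A r′ (z ∖ r)) r))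
        (trans (cong (λ t → lookup t r) (proj₁ (toList-++-injective (tabulate λ r′ → A r′ (z ∖ r)) (tabulate λ r′ → A r′
            (z′ ∖ r)) (MaybeP.just-injective eq)))) (VecP.lookup∘tabulate (λ r′ → A r′ (z′ ∖ r)) r))

  module Energy (M : ℕ) (c : Tuple → Colour) where

    total : (Subset v → Colour → ℚ) → ℚ
    total f = sumL (masks v) (λ e → sumL (codes M) (f e))

    total-mono : ∀ {f g} → (∀ e κ → f e κ ≤ℚ g e κ) → total f ≤ℚ total g
    total-mono h = sumL-mono (masks v) λ {e} _ → sumL-mono (codes M) λ {κ} _ → h e κ

    total-+ : ∀ f g → total (λ e κ → f e κ + g e κ) ≡ total f + total g
    total-+ f g = trans (cong-≡ (sumL-linear (masks v)) λ e → add (sumL-linear (codes M)) (f e) (g e))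
      (add (sumL-linear (masks v)) (λ e → sumL (codes M) (f e)) (λ e → sumL (codes M) (g e)))

    total-cong : ∀ {f g} → (∀ e κ → f e κ ≡ g e κ) → total f ≡ total g
    total-cong h = cong-≡ (sumL-linear (masks v)) λ e → cong-≡ (sumL-linear (codes M)) (h e)

    total-term : ∀ {f} → (∀ e κ → 0ℚ ≤ℚ f e κ) → ∀ e {κ} → κ ∈ codes M → f e κ ≤ℚ total f
    total-term {f} h e i = ≤-trans (sumL-term (h e) i) (sumL-term {f = λ e → sumL (codes M) (f e)} (λ e → sumL-nonneg
        (codes M) (h e)) (∈-masks e))

    density : (Tuple → Colour) → Subset v → Colour → Tuple → ℚ
    density q e κ = Faces.Π e q (isColour c κ)

    -- All supports and all colours enter one sum, so that a single colouring becomes uniform for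
    -- all of them at once.
    energy : (Tuple → Colour) → ℚ
    energy q = total λ e κ → Eₛ e (λ z → density q e κ z * density q e κ z)

    gain : (q q′ : Tuple → Colour) → Subset v → Colour → ℚ
    gain q q′ e κ = Eₛ e (λ z → (density q′ e κ z - density q e κ z) * (density q′ e κ z - density q e κ z))

    gain-nonneg : ∀ q q′ e κ → 0ℚ ≤ℚ gain q q′ e κ
    gain-nonneg q q′ e κ = Mean.nonneg (Eₛ-mean e) λ z _ → 0≤-sq (density q′ e κ z - density q e κ z)

    energy-gain : ∀ q q′ → Refines q q′ → energy q′ ≡ energy q + total (gain q q′)
    energy-gain q q′ ref = trans
      (total-cong λ e κ → Cond₂.pythagoras (Eₛ-mean e) _≟ᵏ_ (faceKey q) _≟ᵏ_ (faceKey q′) (faceKey-refines q q′ ref)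
          (isColour c κ))
      (total-+ (λ e κ → Eₛ e (λ z → density q e κ z * density q e κ z)) (gain q q′))

    maxEnergy : ℚ
    maxEnergy = total λ _ _ → 1ℚ

    density-nonneg : ∀ q e κ z → 0ℚ ≤ℚ density q e κ z
    density-nonneg q e κ = Faces.Π-nonneg e q λ x → 0≤ind (does (c x ≟ᶜ κ))

    density-≤1 : ∀ q e κ {z} → supp z ≡ e → density q e κ z ≤ℚ 1ℚ
    density-≤1 q e κ = Faces.Π-≤1 e q λ x → ind≤1 (does (c x ≟ᶜ κ))

    energy-≤ : ∀ q → energy q ≤ℚ maxEnergy
    energy-≤ q = total-mono λ e κ → Mean.upper (Eₛ-mean e) λ z i →
      *-≤1 (density-nonneg q e κ z) (density-≤1 q e κ i) (density-nonneg q e κ z) (density-≤1 q e κ i)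

    correlation : (Tuple → Colour) → Subset v → Colour → (Fin v → Tuple → Bool) → ℚ
    correlation q e κ A = ∣ Eₛ e (λ z → (isColour c κ z - density q e κ z) * ind (test A z)) ∣

    Uniform : (Tuple → Colour) → ℚ → Set
    Uniform q ε = ∀ e {κ} → κ ∈ codes M → ∀ A → correlation q e κ A ≤ℚ ε

    Violation : (Tuple → Colour) → ℚ → Set
    Violation q ε = Σ (Subset v) λ e → Σ Colour λ κ → κ ∈ codes M × Σ (Fin v → Tuple → Bool) λ A → ε ≤ℚ correlation q e κ A

    ¬violation⇒uniform : ∀ q {ε} → ¬ Violation q ε → Uniform q ε
    ¬violation⇒uniform q {ε} ¬w e {κ} i A with correlation q e κ A ℚP.≤? ε
    ... | yes h = h
    ... | no ¬h = contradiction (e , κ , i , A , <⇒≤ (ℚP.≰⇒> ¬h)) ¬w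

    -- The violating test becomes measurable once its factors are recorded in the facet colours. The
    -- gain at one `e` and `κ` suffices because all the others are nonnegative.
    violation-increment : ∀ q {ε} → 0ℚ ≤ℚ ε → (w : Violation q ε) → let A = proj₁ (proj₂ (proj₂ (proj₂ w))) in
      energy q + ε * ε ≤ℚ energy (refine A q)
    violation-increment q {ε} 0≤ε (e , κ , i , A , big) =
      subst (energy q + ε * ε ≤ℚ_) (sym (energy-gain q (refine A q) (refine-refines A q)))
        (+-monoʳ-≤ (energy q) (≤-trans
          (Cond₂.correlation-increment (Eₛ-mean e) _≟ᵏ_ (faceKey q) _≟ᵏ_ (faceKey (refine A q)) (faceKey-refines q
              (refine A q) (refine-refines A q))
            (isColour c κ) (λ z → ind (test A z)) 0≤ε (λ z z′ eq → cong ind (test-measurable A q z z′ eq))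
            (λ z → *-≤1 (0≤ind (test A z)) (ind≤1 (test A z)) (0≤ind (test A z)) (ind≤1 (test A z))) big)
          (total-term (gain-nonneg q (refine A q)) e i)))

    -- `fuel` counts the refinements that the energy bound still permits; with none left, a
    -- violation would push the energy above its maximum. Each refinement lengthens the colours by
    -- `v` bits.
    weak-regularity : ∀ {ε} → 0ℚ <ℚ ε → ∀ fuel q {L} → (∀ z → length (q z) ≤ L) → maxEnergy ≤ℚ energy q + fromℕ fuel * (ε * ε) →
      ¬ ¬ Σ (Tuple → Colour) λ q′ → Refines q q′ × (∀ z → length (q′ z) ≤ fuel ℕ.* v ℕ.+ L) × Uniform q′ ε
    weak-regularity {ε} 0<ε zero q len h = ¬¬-bind (¬¬-em (Violation q ε)) λ
      { (inj₁ w) → contradiction (<-≤-trans (≤-<-trans h (lt (energy q)))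
                     (≤-trans (violation-increment q (<⇒≤ 0<ε) w) (energy-≤ (refine (proj₁ (proj₂ (proj₂
                         (proj₂ w)))) q)))) (<-irrefl refl)
      ; (inj₂ ¬w) k → k (q , refines-refl q , len , ¬violation⇒uniform q ¬w) }
      where
        lt : ∀ a → a + 0ℚ * (ε * ε) <ℚ a + ε * ε
        lt a = ℚP.+-monoʳ-< a (subst (_<ℚ ε * ε) (sym (*-zeroˡ (ε * ε))) (0<-* 0<ε 0<ε))
    weak-regularity {ε} 0<ε (suc fuel) q {L} len h = ¬¬-bind (¬¬-em (Violation q ε)) λ
      { (inj₂ ¬w) k → k (q , refines-refl q , (λ z → ℕP.≤-trans (len z) (ℕP.m≤n+m L (suc fuel ℕ.* v))) , ¬violation⇒uniform q ¬w)
      ; (inj₁ w@(_ , _ , _ , A , _)) → ¬¬-bind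
          (weak-regularity 0<ε fuel (refine A q) {v ℕ.+ L} (λ z → subst (_≤ v ℕ.+ L) (sym (length-refine A q z))
              (ℕP.+-monoʳ-≤ v (len z)))
            (≤-trans h (subst (_≤ℚ energy (refine A q) + fromℕ fuel * (ε * ε)) (sym (rearrange (energy q) (fromℕ fuel)
                (ε * ε)))
              (+-monoˡ-≤ (fromℕ fuel * (ε * ε)) (violation-increment q (<⇒≤ 0<ε) w)))))
          λ { (q′ , ref , len′ , u) k → k (q′ , refines-trans q (refine A q) q′ (refine-refines A q) ref ,
                (λ z → subst (length (q′ z) ≤_) (arith (fuel ℕ.* v)) (len′ z)) , u) } }
      where
        rearrange : ∀ a f e → a + (1ℚ + f) * e ≡ a + e + f * e
        rearrange = solve-∀ ℚ-ring
        arith : ∀ a → a ℕ.+ (v ℕ.+ L) ≡ v ℕ.+ a ℕ.+ L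
        arith a = trans (sym (ℕP.+-assoc a v L)) (cong (ℕ._+ L) (ℕP.+-comm a v))

-- Complexes

prodL : {A : Set} → List A → (A → ℚ) → ℚ
prodL [] f = 1ℚ
prodL (a ∷ as) f = f a * prodL as f

prodL-++ : ∀ {A : Set} (as bs : List A) f → prodL (as ++ bs) f ≡ prodL as f * prodL bs f
prodL-++ [] bs f = sym (*-identityˡ (prodL bs f))
prodL-++ (a ∷ as) bs f = trans (cong (f a *_) (prodL-++ as bs f)) (sym (*-assoc (f a) (prodL as f) (prodL bs f)))

prodL-map : ∀ {A B : Set} (g : A → B) as f → prodL (map g as) f ≡ prodL as (λ a → f (g a))
prodL-map g [] f = refl
prodL-map g (a ∷ as) f = cong (f (g a) *_) (prodL-map g as f)

prodL-cong : ∀ {A : Set} {as : List A} {f g : A → ℚ} → (∀ {a} → a ∈ as → f a ≡ g a) → prodL as f ≡ prodL as g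
prodL-cong {as = []} h = refl
prodL-cong {as = a ∷ as} h = cong₂ _*_ (h (here refl)) (prodL-cong λ i → h (there i))

prodL-nonneg : ∀ {A : Set} {as : List A} {f : A → ℚ} → (∀ {a} → a ∈ as → 0ℚ ≤ℚ f a) → 0ℚ ≤ℚ prodL as f
prodL-nonneg {as = []} h = 0≤1
prodL-nonneg {as = a ∷ as} h = 0≤-* (h (here refl)) (prodL-nonneg λ i → h (there i))

prodL-≤1 : ∀ {A : Set} {as : List A} {f : A → ℚ} → (∀ {a} → a ∈ as → 0ℚ ≤ℚ f a) → (∀ {a} → a ∈ as → f a ≤ℚ 1ℚ) → prodL as f ≤ℚ 1ℚ
prodL-≤1 {as = []} h h′ = ≤-refl
prodL-≤1 {as = a ∷ as} h h′ = *-≤1 (h (here refl)) (h′ (here refl)) (prodL-nonneg λ i → h (there i)) (prodL-≤1 (λ i → h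
    (there i)) λ i → h′ (there i))

prodL-≥^ : ∀ {A : Set} {as : List A} {f : A → ℚ} {δ} → 0ℚ <ℚ δ → (∀ {a} → a ∈ as → δ ≤ℚ f a) → δ ^ℚ length as ≤ℚ prodL as f
prodL-≥^ {as = []} 0<δ h = ≤-refl
prodL-≥^ {as = a ∷ as} 0<δ h = *-mono (<⇒≤ 0<δ) (h (here refl)) (<⇒≤ (0<^ (length as) 0<δ)) (prodL-≥^ 0<δ λ i → h (there i))

prodL-filter : ∀ {A : Set} {P : A → Set} (P? : ∀ a → Dec (P a)) (as : List A) f →
  prodL as f ≡ prodL (filter P? as) f * prodL (filter (λ a → ¬? (P? a)) as) f
prodL-filter P? [] f = sym (*-identityʳ 1ℚ)
prodL-filter P? (a ∷ as) f with P? a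
... | yes _ = trans (cong (f a *_) (prodL-filter P? as f)) (sym (*-assoc (f a) (prodL (filter P? as) f) (prodL (filter
    (λ a → ¬? (P? a)) as) f)))
... | no _ = trans (cong (f a *_) (prodL-filter P? as f)) (lem (f a) (prodL (filter P? as) f) (prodL (filter (λ a → ¬?
    (P? a)) as) f))
  where lem : ∀ a b c → a * (b * c) ≡ b * (a * c)
        lem = solve-∀ ℚ-ring

relabel : ∀ {A B : Set} {v} → (A → B) → Partial A v → Partial B v
relabel f = Vec.map (Maybe.map f)

lookup-relabel : ∀ {A B : Set} {v} (f : A → B) (t : Partial A v) r → lookup (relabel f t) r ≡ Maybe.map f (lookup t r)
lookup-relabel f t r = VecP.lookup-map r (Maybe.map f) t

relabel-just : ∀ {A B : Set} {v} (f : A → B) (t : Partial A v) r {b} → lookup (relabel f t) r ≡ just b →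
  Σ A λ a → lookup t r ≡ just a × f a ≡ b
relabel-just f t r eq with lookup t r | trans (sym (lookup-relabel f t r)) eq
... | just a | refl = a , refl , refl

relabel-↾ : ∀ {A B : Set} {v} (f : A → B) (t : Partial A v) b → relabel f t ↾ b ≡ relabel f (t ↾ b)
relabel-↾ f [] [] = refl
relabel-↾ f (a ∷ t) (true ∷ b) = cong (_ ∷_) (relabel-↾ f t b)
relabel-↾ f (a ∷ t) (false ∷ b) = cong (_ ∷_) (relabel-↾ f t b)

supp-relabel : ∀ {A B : Set} {v} (f : A → B) (t : Partial A v) → supp (relabel f t) ≡ supp t
supp-relabel f [] = refl
supp-relabel f (just _ ∷ t) = cong (true ∷_) (supp-relabel f t)
supp-relabel f (nothing ∷ t) = cong (false ∷_) (supp-relabel f t)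

relabel-injective : ∀ {A B : Set} {v} {f : A → B} →
    (∀ {a a′} → f a ≡ f a′ → a ≡ a′) → ∀ {t t′ : Partial A v} → relabel f t ≡ relabel f t′ → t ≡ t′
relabel-injective inj {[]} {[]} eq = refl
relabel-injective inj {a ∷ t} {a′ ∷ t′} eq with VecP.∷-injective eq
... | eq₁ , eq₂ = cong₂ _∷_ (MaybeP.map-injective inj eq₁) (relabel-injective inj eq₂)

Labelled : ∀ {w v} → (Fin w → Fin v) → Edge v w → Set
Labelled lab t = ∀ r u → lookup t r ≡ just u → lab u ≡ r

labelled⇒inj : ∀ {w v} {lab : Fin w → Fin v} {t : Edge v w} → Labelled lab t → Inj t
labelled⇒inj l r r′ u p p′ = trans (sym (l r u p)) (l r′ u p′)

record Complex (v w : ℕ) : Set where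
  field
    lab      : Fin w → Fin v
    edges    : List (Edge v w)
    unique   : Unique edges
    labelled : ∀ {t} → t ∈ edges → Labelled lab t
    closed   : ∀ {t} → t ∈ edges → ∀ b → t ↾ b ∈ edges

open Complex public

subcomplex : ∀ {v w} (H : Complex v w) {P : Edge v w → Set} → (∀ t → Dec (P t)) → (∀ {t} b → P t → P
    (t ↾ b)) → Complex v w
subcomplex H P? down = record
  { lab = lab H
  ; edges = filter P? (edges H)
  ; unique = UniqueP.filter⁺ P? (unique H)
  ; labelled = λ i → labelled H (proj₁ (∈P.∈-filter⁻ P? i))
  ; closed = λ i b → let (i′ , p) = ∈P.∈-filter⁻ P? i in ∈P.∈-filter⁺ P? (closed H i′ b) (down b p)
  }

_⊑?_ : ∀ {w v} (t s : Edge v w) → Dec (t ≼ s)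
_⊑?_ = _≼?_ Fin._≟_

below : ∀ {v w} → ℕ → Complex v w → Complex v w
below j H = subcomplex H (λ t → level t ℕP.≤? j) (λ {t} b h → ℕP.≤-trans (level-↾ t b) h)

faces : ∀ {v w} → Edge v w → Complex v w → Complex v w
faces s H = subcomplex H (_⊑? s) (λ {t} b h r u eq → h r u (↾-≼ t b r u eq))

others : ∀ {v w} → Edge v w → Complex v w → List (Edge v w)
others s H = filter (λ t → ¬? (t ⊑? s)) (edges H)

-- Two copies of `H` glued along the faces of `s`: `ρ` embeds the second copy, sending the vertices
-- of `s` into the first half. The second-half twins of these vertices remain as isolated vertices,
-- over which averaging has no effect.
module Double {v w : ℕ} (H : Complex v w) (s : Edge v w) (ls : Labelled (lab H) s) where

  ρ : Fin w → Fin (w ℕ.+ w)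
  ρ u = if does (MaybeP.≡-dec Fin._≟_ (lookup s (lab H u)) (just u)) then u ↑ˡ w else w ↑ʳ u

  ρ-in : ∀ {u} → lookup s (lab H u) ≡ just u → ρ u ≡ u ↑ˡ w
  ρ-in {u} p = cong (if_then u ↑ˡ w else w ↑ʳ u) (dec-true (MaybeP.≡-dec Fin._≟_ (lookup s (lab H u)) (just u)) p)

  ρ-out : ∀ {u} → lookup s (lab H u) ≢ just u → ρ u ≡ w ↑ʳ u
  ρ-out {u} p = cong (if_then u ↑ˡ w else w ↑ʳ u) (dec-false (MaybeP.≡-dec Fin._≟_ (lookup s (lab H u)) (just u)) p)

  ρ-cases : ∀ u → lookup s (lab H u) ≡ just u × ρ u ≡ u ↑ˡ w ⊎ lookup s (lab H u) ≢ just u × ρ u ≡ w ↑ʳ u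
  ρ-cases u with MaybeP.≡-dec Fin._≟_ (lookup s (lab H u)) (just u)
  ... | yes p = inj₁ (p , refl)
  ... | no p = inj₂ (p , refl)

  lab₂ : Fin (w ℕ.+ w) → Fin v
  lab₂ u = [ lab H , lab H ]′ (splitAt w u)

  lab₂-ˡ : ∀ u → lab₂ (u ↑ˡ w) ≡ lab H u
  lab₂-ˡ u = cong [ lab H , lab H ]′ (FinP.splitAt-↑ˡ w u w)

  lab₂-ʳ : ∀ u → lab₂ (w ↑ʳ u) ≡ lab H u
  lab₂-ʳ u = cong [ lab H , lab H ]′ (FinP.splitAt-↑ʳ w w u)

  lab₂-ρ : ∀ u → lab₂ (ρ u) ≡ lab H u
  lab₂-ρ u with ρ-cases u
  ... | inj₁ (_ , eq) = trans (cong lab₂ eq) (lab₂-ˡ u)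
  ... | inj₂ (_ , eq) = trans (cong lab₂ eq) (lab₂-ʳ u)

  ˡ≢ʳ : ∀ {u u′ : Fin w} → u ↑ˡ w ≢ w ↑ʳ u′
  ˡ≢ʳ {u} {u′} eq with trans (sym (FinP.splitAt-↑ˡ w u w)) (trans (cong (splitAt w) eq) (FinP.splitAt-↑ʳ w w u′))
  ... | ()

  ρ-injective : ∀ {u u′} → ρ u ≡ ρ u′ → u ≡ u′
  ρ-injective {u} {u′} eq with ρ-cases u | ρ-cases u′
  ... | inj₁ (_ , p) | inj₁ (_ , p′) = FinP.↑ˡ-injective w u u′ (trans (sym p) (trans eq p′))
  ... | inj₂ (_ , p) | inj₂ (_ , p′) = FinP.↑ʳ-injective w u u′ (trans (sym p) (trans eq p′))
  ... | inj₁ (_ , p) | inj₂ (_ , p′) = contradiction (trans (sym p) (trans eq p′)) ˡ≢ʳ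
  ... | inj₂ (_ , p) | inj₁ (_ , p′) = contradiction (trans (sym p′) (trans (sym eq) p)) ˡ≢ʳ

  left right : List (Partial (Fin (w ℕ.+ w)) v)
  left = map (relabel (_↑ˡ w)) (edges H)
  right = map (relabel ρ) (others s H)

  ρ-face : ∀ {t} → Labelled (lab H) t → t ≼ s → relabel ρ t ≡ relabel (_↑ˡ w) t
  ρ-face {t} lt h = vec-ext λ r → trans (lookup-relabel ρ t r) (trans (go r (lookup t r) refl) (sym (lookup-relabel (_↑ˡ w) t r)))
    where
      go : ∀ r m → lookup t r ≡ m → Maybe.map ρ m ≡ Maybe.map (_↑ˡ w) m
      go r nothing _ = refl
      go r (just u) eq = cong just (ρ-in (trans (cong (lookup s) (lt r u eq)) (h r u eq)))

  double : Complex v (w ℕ.+ w)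
  double = record { lab = lab₂ ; edges = left ++ right ; unique = uniq ; labelled = labl ; closed = clos }
    where
      uniq : Unique (left ++ right)
      uniq = UniqueP.++⁺ (UniqueP.map⁺ (relabel-injective λ {a} {a′} → FinP.↑ˡ-injective w a a′) (unique H))
        (UniqueP.map⁺ (relabel-injective ρ-injective) (UniqueP.filter⁺ (λ t → ¬? (t ⊑? s)) (unique H))) disj
        where
          disj : ∀ {t} → ¬ (t ∈ left × t ∈ right)
          disj (i , i′) with ∈P.∈-map⁻ (relabel (_↑ˡ w)) i | ∈P.∈-map⁻ (relabel ρ) i′
          ... | t , _ , refl | t′ , i″ , eq with ∈P.∈-filter⁻ (λ t → ¬? (t ⊑? s)) {xs = edges H} i″
          -- A face that is not below `s` has a vertex outside `s`, and `ρ` moves this vertex to the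
          -- second half, where no left face has one.
          ...   | it′ , t′⋠s with ¬≼-witness Fin._≟_ t′ s t′⋠s
          ...     | r , u , p , np with relabel-just (_↑ˡ w) t r (trans (cong (λ z → lookup z r) eq) (trans (lookup-relabel ρ t′ r) (cong (Maybe.map ρ) p)))
          ...       | u′ , _ , eq′ = ˡ≢ʳ (trans eq′ (ρ-out (λ q → np (trans (cong (lookup s) (sym (labelled H it′ r u p))) q))))
      labl : ∀ {t} → t ∈ left ++ right → Labelled lab₂ t
      labl i r u eq with ∈P.∈-++⁻ left i
      ... | inj₁ i₁ with ∈P.∈-map⁻ (relabel (_↑ˡ w)) i₁
      ...   | t , it , refl with relabel-just (_↑ˡ w) t r eq
      ...     | u′ , p , refl = trans (lab₂-ˡ u′) (labelled H it r u′ p)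
      labl i r u eq | inj₂ i₂ with ∈P.∈-map⁻ (relabel ρ) i₂
      ... | t , it , refl with relabel-just ρ t r eq
      ...   | u′ , p , refl = trans (lab₂-ρ u′) (labelled H (proj₁ (∈P.∈-filter⁻ (λ t → ¬? (t ⊑? s)) it)) r u′ p)
      clos : ∀ {t} → t ∈ left ++ right → ∀ b → t ↾ b ∈ left ++ right
      clos i b with ∈P.∈-++⁻ left i
      ... | inj₁ i₁ with ∈P.∈-map⁻ (relabel (_↑ˡ w)) i₁
      ...   | t , it , refl = ∈P.∈-++⁺ˡ (subst (_∈ left) (sym (relabel-↾ (_↑ˡ w) t b)) (∈P.∈-map⁺ (relabel (_↑ˡ w))
          (closed H it b)))
      clos i b | inj₂ i₂ with ∈P.∈-map⁻ (relabel ρ) i₂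
      ... | t , it , refl with ∈P.∈-filter⁻ (λ t → ¬? (t ⊑? s)) {xs = edges H} it
      ...   | it′ , _ with (t ↾ b) ⊑? s
      ...     | yes h = ∈P.∈-++⁺ˡ (subst (_∈ left) (sym (trans (relabel-↾ ρ t b) (ρ-face (labelled H (closed H it′ b)) h)))
                          (∈P.∈-map⁺ (relabel (_↑ˡ w)) (closed H it′ b)))
      ...     | no h = ∈P.∈-++⁺ʳ left (subst (_∈ right) (sym (relabel-↾ ρ t b))
                         (∈P.∈-map⁺ (relabel ρ) (∈P.∈-filter⁺ (λ t → ¬? (t ⊑? s)) (closed H it′ b) h)))

  length-double : length (edges double) ≤ length (edges H) ℕ.+ length (edges H)
  length-double = subst (_≤ length (edges H) ℕ.+ length (edges H))
    (sym (trans (ListP.length-++ left) (cong₂ ℕ._+_ (ListP.length-map (relabel (_↑ˡ w)) (edges H)) (ListP.length-map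
        (relabel ρ) (others s H)))))
    (ℕP.+-monoʳ-≤ (length (edges H)) (ListP.length-filter (λ t → ¬? (t ⊑? s)) (edges H)))

  module _ {A : Set} (y y′ : Vec A w) where

    ev-left : ∀ (t : Edge v w) → ev (y Vec.++ y′) (relabel (_↑ˡ w) t) ≡ ev y t
    ev-left t = ev-cong (y Vec.++ y′) y (relabel (_↑ˡ w) t) t λ r → trans (cong (Maybe.map (lookup (y Vec.++ y′)))
        (lookup-relabel (_↑ˡ w) t r)) (go (lookup t r))
      where go : ∀ m → Maybe.map (lookup (y Vec.++ y′)) (Maybe.map (_↑ˡ w) m) ≡ Maybe.map (lookup y) m
            go nothing = refl
            go (just u) = cong just (VecP.lookup-++ˡ y y′ u)

    ev-right : ∀ (x : Vec A w) (t : Edge v w) → (∀ u → lookup (y Vec.++ y′) (ρ u) ≡ lookup x u) → ev (y Vec.++ y′)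
        (relabel ρ t) ≡ ev x t
    ev-right x t h = ev-cong (y Vec.++ y′) x (relabel ρ t) t λ r → trans (cong (Maybe.map (lookup (y Vec.++ y′)))
        (lookup-relabel ρ t r)) (go (lookup t r))
      where go : ∀ m → Maybe.map (lookup (y Vec.++ y′)) (Maybe.map ρ m) ≡ Maybe.map (lookup x) m
            go nothing = refl
            go (just u) = cong just (h u)

    -- On a pair of maps, the second copy sees a second completion of the tuple that the first map
    -- puts on `s`.
    lookup-ρ : ∀ u → lookup (y Vec.++ y′) (ρ u) ≡ lookup (overwrite y′ s (ev y s)) u
    lookup-ρ u with ρ-cases u
    ... | inj₁ (p , eq) = trans (cong (lookup (y Vec.++ y′)) eq) (trans (VecP.lookup-++ˡ y y′ u)
            (sym (overwrite-in y′ s (ev y s) (labelled⇒inj {lab = lab H} {s} ls) (lab H u) p (trans (lookup-ev y s (lab H u))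
                (cong (Maybe.map (lookup y)) p)))))
    ... | inj₂ (p , eq) = trans (cong (lookup (y Vec.++ y′)) eq) (trans (VecP.lookup-++ʳ y y′ u)
            (sym (overwrite-out y′ s (ev y s) u λ r q → p (trans (cong (lookup s) (ls r u q)) q))))

  lookup-ρ-diag : ∀ {A : Set} (y : Vec A w) u → lookup (y Vec.++ y) (ρ u) ≡ lookup y u
  lookup-ρ-diag y u with ρ-cases u
  ... | inj₁ (p , eq) = trans (cong (lookup (y Vec.++ y)) eq) (VecP.lookup-++ˡ y y u)
  ... | inj₂ (p , eq) = trans (cong (lookup (y Vec.++ y)) eq) (VecP.lookup-++ʳ y y u)

-- Counting

allL : {A : Set} → (A → Bool) → List A → Bool
allL b [] = true
allL b (a ∷ as) = b a ∧ allL b as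

prodL-ind : ∀ {A : Set} (as : List A) (b : A → Bool) → prodL as (λ a → ind (b a)) ≡ ind (allL b as)
prodL-ind [] b = refl
prodL-ind (a ∷ as) b = trans (cong (ind (b a) *_) (prodL-ind as b)) (sym (ind-∧ (b a) (allL b as)))

∧-true : ∀ {a b} → a ∧ b ≡ true → a ≡ true × b ≡ true
∧-true {true} {true} _ = refl , refl

allL-∈ : ∀ {A : Set} {b : A → Bool} {as} → allL b as ≡ true → ∀ {a} → a ∈ as → b a ≡ true
allL-∈ h (here refl) = proj₁ (∧-true h)
allL-∈ {b = b} {x ∷ as} h (there i) = allL-∈ (proj₂ (∧-true {b x} h)) i

allL-intro : ∀ {A : Set} {b : A → Bool} {as} → (∀ {a} → a ∈ as → b a ≡ true) → allL b as ≡ true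
allL-intro {as = []} h = refl
allL-intro {as = a ∷ as} h = cong₂ _∧_ (h (here refl)) (allL-intro λ i → h (there i))

allF-lookup : ∀ {v} {b : Fin v → Bool} → allF b ≡ true → ∀ r → b r ≡ true
allF-lookup h zero = proj₁ (∧-true h)
allF-lookup {b = b} h (suc r) = allF-lookup (proj₂ (∧-true {b zero} h)) r

allF-intro : ∀ {v} {b : Fin v → Bool} → (∀ r → b r ≡ true) → allF b ≡ true
allF-intro {zero} h = refl
allF-intro {suc v} h = cong₂ _∧_ (h zero) (allF-intro λ r → h (suc r))

bool-ext : ∀ {a b} → (a ≡ true → b ≡ true) → (b ≡ true → a ≡ true) → a ≡ b
bool-ext {true} {true} f g = refl
bool-ext {true} {false} f g = sym (f refl)
bool-ext {false} {true} f g = g refl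
bool-ext {false} {false} f g = refl

does-true : ∀ {a} {A : Set a} (d : Dec A) → does d ≡ true → A
does-true (yes a) _ = a

module _ {n v : ℕ} where
  open Regularity {n} {v}

  agree : ∀ {w} → (Tuple → Colour) → (y y₀ : Point n w) → Edge v w → Bool
  agree col y y₀ t = does (col (ev y t) ≟ᶜ col (ev y₀ t))

  matches : ∀ {w} → (Tuple → Colour) → Complex v w → (y y₀ : Point n w) → ℚ
  matches col H y y₀ = prodL (edges H) (λ t → ind (agree col y y₀ t))

  frequency : ∀ {w} → (Tuple → Colour) → Complex v w → Point n w → ℚ
  frequency {w} col H y₀ = E w (λ y → matches col H y y₀)

  predicted : ∀ {w} → (Tuple → ℚ) → Complex v w → Point n w → ℚ
  predicted dens H y₀ = prodL (edges H) (λ t → dens (ev y₀ t))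

  -- A colouring of all levels ≤ j extending c, for which complexes with at most s faces obey a product formula
  -- whenever the pattern of y₀ avoids the exceptional set.
  record Tower (j s : ℕ) (θ δ : ℚ) (c : Tuple → Colour) : Set where
    field
      col       : Tuple → Colour
      dens      : Tuple → ℚ
      bad       : Tuple → Bool
      col-top   : ∀ z → level z ≡ j → col z ≡ c z
      bad-small : ∀ e → Eₛ e (λ z → ind (bad z)) ≤ℚ θ
      dens-≥    : ∀ z → level z ≤ j → bad z ≡ false → δ ≤ℚ dens z
      count     : ∀ {w} (H : Complex v w) → (∀ {t} → t ∈ edges H → level t ≤ j) → length (edges H) ≤ s →
                  ∀ y₀ → (∀ {t} → t ∈ edges H → bad (ev y₀ t) ≡ false) →
                  ∣ frequency col H y₀ - predicted dens H y₀ ∣ ≤ℚ θ * predicted dens H y₀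

  level-ev : ∀ {w} (y : Point n w) (t : Edge v w) → level (ev y t) ≡ level t
  level-ev y t = cong card (supp-ev y t)

  -- The other edges only see a proper part of σ, so integrating out the vertices of σ leaves a product of tests.
  module _ {w} (lab : Fin w → Fin v) (σ : Edge v w) (lσ : Labelled lab σ) (ts : List (Edge v w))
    (separated : ∀ {t} → t ∈ ts → Labelled lab t × Σ (Fin v) λ r → Σ (Fin w) λ u → lookup σ r ≡ just u × lookup t r ≢ just u)
    (col : Tuple → Colour) (y₀ : Point n w) where

    module _ (y : Point n w) where

      misses : Fin v → Edge v w → Bool
      misses r t = does (¬? (MaybeP.≡-dec Fin._≟_ (lookup σ r) (lookup t r)))

      -- An edge is tested at every position where it differs from `σ`. Deleting coordinate `r` is
      -- harmless there: by the labelling, the vertex of `σ` in part `r` could occur in the edge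
      -- only at position `r`.
      missTest : Fin v → Tuple → Bool
      missTest r x = allL (λ t → if misses r t then agree col (overwrite y σ x) y₀ t else true) ts

      ev-miss : ∀ {t} → Labelled lab t → ∀ r {u} → lookup σ r ≡ just u → lookup t r ≢ just u → ∀ z →
        ev (overwrite y σ (z ∖ r)) t ≡ ev (overwrite y σ z) t
      ev-miss {t} lt r {u} p np z = ev-cong (overwrite y σ (z ∖ r)) (overwrite y σ z) t t λ r′ → go r′ (lookup t r′) refl
        where
          go : ∀ r′ m → lookup t r′ ≡ m → Maybe.map (lookup (overwrite y σ (z ∖ r))) m ≡ Maybe.map (lookup (overwrite y σ z)) m
          go r′ nothing _ = refl
          go r′ (just u′) q = cong just (overwrite-cong y σ (z ∖ r) z u′ λ r″ q″ → VecP.lookup∘update′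
            (λ { refl → np (trans (cong (lookup t) (trans (sym (lσ r″ u′ q″)) (lt r′ u′ q))) (trans q (trans
                (sym q″) p))) }) z nothing)

      agree-miss : ∀ {t} → Labelled lab t → ∀ r {u} → lookup σ r ≡ just u → lookup t r ≢ just u → ∀ z →
        agree col (overwrite y σ (z ∖ r)) y₀ t ≡ agree col (overwrite y σ z) y₀ t
      agree-miss {t} lt r p np z = cong (λ x → does (col x ≟ᶜ col (ev y₀ t))) (ev-miss lt r p np z)

      is-just-support : ∀ {z : Tuple} → supp z ≡ supp σ → ∀ r → is-just (lookup z r) ≡ is-just (lookup σ r)
      is-just-support {z} eq r = trans (sym (lookup-supp z r)) (trans (cong (λ e → lookup e r) eq) (lookup-supp σ r))

      as-test : ∀ z → supp z ≡ supp σ → allL (agree col (overwrite y σ z) y₀) ts ≡ test missTest z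
      as-test z eq = bool-ext to from
        where
          to : allL (agree col (overwrite y σ z) y₀) ts ≡ true → test missTest z ≡ true
          to h = allF-intro λ r → go r (lookup z r) refl
            where
              go : ∀ r m → lookup z r ≡ m → Maybe.maybe′ (λ _ → missTest r (z ∖ r)) true m ≡ true
              go r nothing _ = refl
              go r (just a) p = allL-intro each
                where
                  each : ∀ {t} → t ∈ ts → (if misses r t then agree col (overwrite y σ (z ∖ r)) y₀ t else true) ≡ true
                  each {t} i with MaybeP.≡-dec Fin._≟_ (lookup σ r) (lookup t r)
                  ... | yes _ = refl
                  ... | no ne with lookup σ r in q | is-just-support {z} eq r
                  ...   | just u | _ = trans (agree-miss (proj₁ (separated i)) r q (λ e → ne (sym e)) z) (allL-∈ h i)
                  ...   | nothing | k = contradiction (trans (sym (cong is-just p)) k) λ ()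
          from : test missTest z ≡ true → allL (agree col (overwrite y σ z) y₀) ts ≡ true
          from h = allL-intro each
            where
              each : ∀ {t} → t ∈ ts → agree col (overwrite y σ z) y₀ t ≡ true
              each {t} i with separated i
              ... | lt , r , u , p , np = trans (sym (agree-miss lt r p np z)) (trans (sym (pick missed)) (allL-∈ atr i))
                where
                  missed : misses r t ≡ true
                  missed = dec-true (¬? (MaybeP.≡-dec Fin._≟_ (lookup σ r) (lookup t r))) (λ e → np (trans (sym e) p))
                  pick : misses r t ≡ true → (if misses r t then agree col (overwrite y σ
                      (z ∖ r)) y₀ t else true) ≡ agree col (overwrite y σ (z ∖ r)) y₀ t
                  pick m rewrite m = refl
                  atr : missTest r (z ∖ r) ≡ true
                  atr with lookup z r | allF-lookup h r | is-just-support {z} eq r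
                  ... | just _ | k | _ = k
                  ... | nothing | _ | k = contradiction (trans k (cong is-just p)) λ ()

    E-test-≤ : ∀ {ε} (U : Tuple → ℚ) → (∀ A → ∣ Eₛ (supp σ) (λ z → U z * ind (test A z)) ∣ ≤ℚ ε) →
      ∣ E w (λ y → U (ev y σ) * prodL ts (λ t → ind (agree col y y₀ t))) ∣ ≤ℚ ε
    E-test-≤ {ε} U small = subst (λ t → ∣ t ∣ ≤ℚ ε) (E-overwrite σ F)
      (subst (λ t → ∣ E w (λ y → Eₛ (supp σ) (λ z → F (overwrite y σ z))) ∣ ≤ℚ t) (Mean.const (E-mean w) ε)
        (Mean.abs-≤ (E-mean w) λ y _ → subst (λ t → ∣ t ∣ ≤ℚ ε) (sym (Mean.cong-on (Eₛ-mean (supp σ)) (pointwise y))) (small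
            (missTest y))))
      where
        F : Point n w → ℚ
        F y = U (ev y σ) * prodL ts (λ t → ind (agree col y y₀ t))
        pointwise : ∀ y z → supp z ≡ supp σ → F (overwrite y σ z) ≡ U z * ind (test (missTest y) z)
        pointwise y z eq = cong₂ _*_ (cong U (ev-overwrite y σ z (labelled⇒inj {lab = lab} {σ} lσ) eq))
          (trans (prodL-ind ts (agree col (overwrite y σ z) y₀)) (cong ind (as-test y z eq)))

map-≡-∈ : ∀ {A B : Set} {f g : A → B} {xs : List A} → map f xs ≡ map g xs → ∀ {x} → x ∈ xs → f x ≡ g x
map-≡-∈ eq (here refl) = ListP.∷-injectiveˡ eq
map-≡-∈ {xs = _ ∷ _} eq (there i) = map-≡-∈ (ListP.∷-injectiveʳ eq) i

map-cong-∈ : ∀ {A B : Set} {f g : A → B} {xs : List A} → (∀ {x} → x ∈ xs → f x ≡ g x) → map f xs ≡ map g xs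
map-cong-∈ {xs = []} h = refl
map-cong-∈ {xs = x ∷ xs} h = cong₂ _∷_ (h (here refl)) (map-cong-∈ λ i → h (there i))

hat-≤ : ∀ {x h θ} → θ ≤ℚ 1ℚ → 0ℚ ≤ℚ h → ∣ x - h ∣ ≤ℚ θ * h → x ≤ℚ 2ℚ * h
hat-≤ {x} {h} {θ} θ≤1 0≤h near = subst₂ _≤ℚ_ (e₁ x h) (e₂ h)
  (+-monoˡ-≤ h (≤-trans (x≤∣x∣ (x - h)) (≤-trans near (*-shrinkˡ 0≤h θ≤1))))
  where
    e₁ : ∀ x h → x - h + h ≡ x
    e₁ = solve-∀ ℚ-ring
    e₂ : ∀ h → h + h ≡ (1ℚ + 1ℚ) * h
    e₂ = solve-∀ ℚ-ring

-- On a top face the indicator of a colour is the sum of a density that is constant on the coarse cell, the deviation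
-- L between the fine and the coarse density, and a remainder U without correlation with lower levels.  The former is
-- small in mean square only, hence the need to count the complex doubled along the face.
module Step {n v : ℕ} (M j s : ℕ) (c q q′ : Partial (Fin (suc n)) v → Colour) (length-c : ∀ z → length (c z) ≤ M)
  (θ′ δ₀ ε α θ₁ : ℚ) (T₀ : Tower j (s ℕ.+ s) θ′ δ₀ q) (θ′≤1 : θ′ ≤ℚ 1ℚ) (0<δ₀ : 0ℚ <ℚ δ₀) (0≤α : 0ℚ ≤ℚ α)
  (uniform : Regularity.Energy.Uniform {n} {v} M c q′ ε) where

  open Regularity {n} {v}
  open Energy M c
  module T = Tower T₀

  -- Restrictions above level `j` get the dummy colour `[]`, so that `profile` carries precisely the
  -- lower-level information, indexed by all masks.
  entry : Tuple → Subset v → Colour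
  entry z b = if does (level (z ↾ b) ℕP.≤? j) then T.col (z ↾ b) else []

  profile : Tuple → List Colour
  profile z = map (entry z) (masks v)

  _≟ˡ_ : DecidableEquality (List Colour)
  _≟ˡ_ = ListP.≡-dec _≟ᶜ_

  module Prof (e : Subset v) = Cond (Eₛ-mean {n} e) _≟ˡ_ profile

  top : Tuple → ℚ
  top z = density q (supp z) (c z) z

  deviation : Subset v → Colour → Tuple → ℚ
  deviation e κ z = density q′ e κ z - density q e κ z

  -- With the sum over all colours, the mean of `spread e` is the `e`-th summand of
  -- `total (gain q q′)`.
  spread : Subset v → Tuple → ℚ
  spread e z = sumL (codes M) (λ κ → deviation e κ z * deviation e κ z)

  -- Conditioning on facets would be too coarse: the count prescribes the colours of all lower faces
  -- of a top edge, and the deviation has to be small in mean square on just that cell.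
  localSpread : Tuple → ℚ
  localSpread z = Prof.Π (supp z) (spread (supp z)) z

  lowHigh : {B : Set} → (Tuple → B) → (Tuple → B) → Tuple → B
  lowHigh f g z = if does (level z ℕP.≤? j) then f z else g z

  low : ∀ {B : Set} (f g : Tuple → B) z → level z ≤ j → lowHigh f g z ≡ f z
  low f g z h = cong (if_then f z else g z) (dec-true (level z ℕP.≤? j) h)

  high : ∀ {B : Set} (f g : Tuple → B) z → ¬ (level z ≤ j) → lowHigh f g z ≡ g z
  high f g z h = cong (if_then f z else g z) (dec-false (level z ℕP.≤? j) h)

  topBad : Tuple → Bool
  topBad z = lessᵇ (top z) θ₁ ∨ lessᵇ (α * α) (localSpread z)

  col : Tuple → Colour
  col = lowHigh T.col c

  dens : Tuple → ℚ
  dens = lowHigh T.dens top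

  bad : Tuple → Bool
  bad = lowHigh T.bad topBad

  ∨-false : ∀ {a b} → a ∨ b ≡ false → a ≡ false × b ≡ false
  ∨-false {false} {false} _ = refl , refl

  topBad-false : ∀ z → topBad z ≡ false → θ₁ ≤ℚ top z × localSpread z ≤ℚ α * α
  topBad-false z h = let (h₁ , h₂) = ∨-false h in
    lessᵇ-false h₁ , lessᵇ-false h₂

  -- A tuple of level `suc j` loses one level when a coordinate is deleted, and on level `j` the
  -- tower's colouring is `q`.
  profile⇒faceKey : ∀ z z′ → supp z ≡ supp z′ → level z ≡ suc j → profile z ≡ profile z′ → faceKey q z ≡ faceKey q z′
  profile⇒faceKey z z′ sz lz eq = vec-ext λ r → trans (lookup-faceKey q z r) (trans (go r (lookup z r) refl
      (lookup z′ r) refl) (sym (lookup-faceKey q z′ r)))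
    where
      support : ∀ r → is-just (lookup z r) ≡ is-just (lookup z′ r)
      support r = trans (sym (lookup-supp z r)) (trans (cong (λ e → lookup e r) sz) (lookup-supp z′ r))
      top-entry : ∀ x r → level (x ∖ r) ≡ j → entry x (⊤ [ r ]≔ false) ≡ q (x ∖ r)
      top-entry x r l = trans (cong (λ t → if does (level t ℕP.≤? j) then T.col t else []) (sym (∖-as-↾ x r)))
        (trans (cong (if_then T.col (x ∖ r) else []) (dec-true (level (x ∖ r) ℕP.≤? j) (ℕP.≤-reflexive l))) (T.col-top (x ∖ r) l))
      go : ∀ r m → lookup z r ≡ m → ∀ m′ → lookup z′ r ≡ m′ → Maybe.map (λ _ → q (z ∖ r)) m ≡ Maybe.map (λ _ → q (z′ ∖ r)) m′
      go r nothing p nothing p′ = refl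
      go r (just _) p nothing p′ = contradiction (trans (sym (cong is-just p)) (trans (support r) (cong is-just p′))) λ ()
      go r nothing p (just _) p′ = contradiction (trans (sym (cong is-just p)) (trans (support r) (cong is-just p′))) λ ()
      go r (just a) p (just a′) p′ = cong just (trans (sym (top-entry z r (ℕP.suc-injective (trans (level-∖ z r p) lz))))
        (trans (map-≡-∈ eq (∈-masks (⊤ [ r ]≔ false)))
          (top-entry z′ r (ℕP.suc-injective (trans (level-∖ z′ r p′) (trans (cong card (sym sz)) lz))))))

  module Count {w : ℕ} (H : Complex v w) (levels : ∀ {t} → t ∈ edges H → level t ≤ suc j) (size : length (edges H) ≤ s)
    (y₀ : Point n w) (good : ∀ {t} → t ∈ edges H → bad (ev y₀ t) ≡ false) where

    H₀ : Complex v w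
    H₀ = below j H

    high? : (t : Edge v w) → Dec (¬ (level t ≤ j))
    high? t = ¬? (level t ℕP.≤? j)

    tops : List (Edge v w)
    tops = filter high? (edges H)

    ∈tops⇒ : ∀ {t} → t ∈ tops → t ∈ edges H × ¬ (level t ≤ j)
    ∈tops⇒ = ∈P.∈-filter⁻ high?

    length-tops : length tops ≤ s
    length-tops = ℕP.≤-trans (ListP.length-filter high? (edges H)) size

    ∈H₀⇒ : ∀ {t} → t ∈ edges H₀ → t ∈ edges H × level t ≤ j
    ∈H₀⇒ = ∈P.∈-filter⁻ (λ t → level t ℕP.≤? j)

    ev-low : ∀ (y : Point n w) (t : Edge v w) → level t ≤ j → level (ev y t) ≤ j
    ev-low y t h = subst (_≤ j) (sym (level-ev y t)) h

    ev-high : ∀ (y : Point n w) (t : Edge v w) → ¬ (level t ≤ j) → ¬ (level (ev y t) ≤ j)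
    ev-high y t h h′ = h (subst (_≤ j) (level-ev y t) h′)

    good₀ : ∀ {t} → t ∈ edges H₀ → T.bad (ev y₀ t) ≡ false
    good₀ {t} i = let (i′ , l) = ∈H₀⇒ i in trans (sym (low T.bad topBad (ev y₀ t) (ev-low y₀ t l))) (good i′)

    size₀ : length (edges H₀) ≤ s
    size₀ = ℕP.≤-trans (ListP.length-filter (λ t → level t ℕP.≤? j) (edges H)) size

    dens₀-≥ : ∀ {t} → t ∈ edges H₀ → δ₀ ≤ℚ T.dens (ev y₀ t)
    dens₀-≥ {t} i = T.dens-≥ (ev y₀ t) (ev-low y₀ t (proj₂ (∈H₀⇒ i))) (good₀ i)

    0≤dens₀ : ∀ {t} → t ∈ edges H₀ → 0ℚ ≤ℚ T.dens (ev y₀ t)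
    0≤dens₀ i = ≤-trans (<⇒≤ 0<δ₀) (dens₀-≥ i)

    hat₀ : ℚ
    hat₀ = predicted T.dens H₀ y₀

    0≤hat₀ : 0ℚ ≤ℚ hat₀
    0≤hat₀ = prodL-nonneg 0≤dens₀

    ag : Point n w → Edge v w → ℚ
    ag y t = ind (agree col y y₀ t)

    R₀ : Point n w → ℚ
    R₀ y = matches T.col H₀ y y₀

    ag-low : ∀ y {t} → t ∈ edges H₀ → ag y t ≡ ind (agree T.col y y₀ t)
    ag-low y {t} i = let l = proj₂ (∈H₀⇒ i) in
      cong₂ (λ a b → ind (does (a ≟ᶜ b))) (low T.col c (ev y t) (ev-low y t l)) (low T.col c (ev y₀ t) (ev-low y₀ t l))

    R₀-as-ag : ∀ y → prodL (edges H₀) (ag y) ≡ R₀ y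
    R₀-as-ag y = prodL-cong {as = edges H₀} (ag-low y)

    0≤ag : ∀ y t → 0ℚ ≤ℚ ag y t
    0≤ag y t = 0≤ind (agree col y y₀ t)

    ag≤1 : ∀ y t → ag y t ≤ℚ 1ℚ
    ag≤1 y t = ind≤1 (agree col y y₀ t)

    0≤R₀ : ∀ y → 0ℚ ≤ℚ R₀ y
    0≤R₀ y = prodL-nonneg {as = edges H₀} λ {t} _ → 0≤ind (agree T.col y y₀ t)

    -- `R₀` holds the lower levels fixed while `ts` lists the top edges that have not yet been
    -- replaced by their densities.
    X : List (Edge v w) → ℚ
    X ts = E w (λ y → prodL ts (ag y) * R₀ y)

    module TopEdge {σ : Edge v w} (σ∈ : σ ∈ edges H) (σ-high : ¬ (level σ ≤ j)) where

      e : Subset v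
      e = supp σ

      z₀ : Tuple
      z₀ = ev y₀ σ

      κ : Colour
      κ = c z₀

      lσ : Labelled (lab H) σ
      lσ = labelled H σ∈

      inj-σ : Inj σ
      inj-σ = labelled⇒inj {lab = lab H} {σ} lσ

      level-σ : level σ ≡ suc j
      level-σ = ℕP.≤-antisym (levels σ∈) (ℕP.≰⇒> σ-high)

      κ∈ : κ ∈ codes M
      κ∈ = ∈-codes M κ (length-c z₀)

      f g g′ U L : Tuple → ℚ
      f = isColour c κ
      g = density q e κ
      g′ = density q′ e κ
      U z = f z - g′ z
      L z = g′ z - g z

      good-top : θ₁ ≤ℚ top z₀ × localSpread z₀ ≤ℚ α * α
      good-top = topBad-false z₀ (trans (sym (high T.bad topBad (ev y₀ σ) (ev-high y₀ σ σ-high))) (good σ∈))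

      D : ℚ
      D = top z₀

      D-as : D ≡ g z₀
      D-as = cong (λ e → density q e κ z₀) (supp-ev y₀ σ)

      hit : Tuple → ℚ
      hit z = ind (does (profile z ≟ˡ profile z₀))

      hit-idem : ∀ z → hit z * hit z ≡ hit z
      hit-idem z = ind-idem (does (profile z ≟ˡ profile z₀))

      P : Complex v w
      P = faces σ H₀

      O : List (Edge v w)
      O = others σ H₀

      ∈P⇒ : ∀ {t} → t ∈ edges P → t ∈ edges H₀ × t ≼ σ
      ∈P⇒ = ∈P.∈-filter⁻ (_⊑? σ) {xs = edges H₀}

      R₀-split : ∀ y → R₀ y ≡ matches T.col P y y₀ * prodL O (λ t → ind (agree T.col y y₀ t))
      R₀-split y = prodL-filter (_⊑? σ) (edges H₀) (λ t → ind (agree T.col y y₀ t))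

      entry-ev : ∀ y b → entry (ev y σ) b ≡ (if does (level (σ ↾ b) ℕP.≤? j) then T.col (ev y (σ ↾ b)) else [])
      entry-ev y b = trans (cong (λ x → if does (level x ℕP.≤? j) then T.col x else []) (sym (ev-↾ y σ b)))
        (cong (λ l → if does (l ℕP.≤? j) then T.col (ev y (σ ↾ b)) else []) (level-ev y (σ ↾ b)))

      -- Closedness puts every restriction of `σ` of level at most `j` into `H₀`, and conversely
      -- each face below `σ` is the restriction to its own support. So the two sides compare the
      -- same colours.
      matches-P : ∀ y → matches T.col P y y₀ ≡ hit (ev y σ)
      matches-P y = trans (prodL-ind (edges P) (agree T.col y y₀)) (cong ind (bool-ext to from))
        where
          to : allL (agree T.col y y₀) (edges P) ≡ true → does (profile (ev y σ) ≟ˡ profile z₀) ≡ true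
          to h = dec-true (profile (ev y σ) ≟ˡ profile z₀) (map-cong-∈ λ {b} _ → trans (entry-ev y b) (trans (go b) (sym
              (entry-ev y₀ b))))
            where
              same : ∀ b → level (σ ↾ b) ≤ j → T.col (ev y (σ ↾ b)) ≡ T.col (ev y₀ (σ ↾ b))
              same b l = does-true (T.col (ev y (σ ↾ b)) ≟ᶜ T.col (ev y₀ (σ ↾ b)))
                (allL-∈ h (∈P.∈-filter⁺ (_⊑? σ) (∈P.∈-filter⁺ (λ t → level t ℕP.≤? j) (closed H σ∈ b) l) (↾-≼ σ b)))
              go : ∀ b → (if does (level (σ ↾ b) ℕP.≤? j) then T.col (ev y (σ ↾ b)) else [])
                       ≡ (if does (level (σ ↾ b) ℕP.≤? j) then T.col (ev y₀ (σ ↾ b)) else [])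
              go b with level (σ ↾ b) ℕP.≤? j
              ... | no ¬l = trans (cong (if_then T.col (ev y (σ ↾ b)) else []) (dec-false (level (σ ↾ b) ℕP.≤? j) ¬l))
                (sym (cong (if_then T.col (ev y₀ (σ ↾ b)) else []) (dec-false (level (σ ↾ b) ℕP.≤? j) ¬l)))
              ... | yes l = trans (cong (if_then T.col (ev y (σ ↾ b)) else []) (dec-true (level (σ ↾ b) ℕP.≤? j) l))
                (trans (same b l) (sym (cong (if_then T.col (ev y₀ (σ ↾ b)) else []) (dec-true (level (σ ↾ b) ℕP.≤? j) l))))
          from : does (profile (ev y σ) ≟ˡ profile z₀) ≡ true → allL (agree T.col y y₀) (edges P) ≡ true
          from h = allL-intro λ {t} i → let (i′ , t≼σ) = ∈P⇒ i ; (_ , l) = ∈H₀⇒ i′ in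
              dec-true (T.col (ev y t) ≟ᶜ T.col (ev y₀ t)) (subst (λ x → T.col (ev y x) ≡ T.col (ev y₀ x)) (≼-↾ t σ t≼σ)
                (trans (sym (unfold y (supp t) (subst (λ x → level x ≤ j) (sym (≼-↾ t σ t≼σ)) l)))
                  (trans (map-≡-∈ (does-true (profile (ev y σ) ≟ˡ profile z₀) h) (∈-masks (supp t)))
                    (unfold y₀ (supp t) (subst (λ x → level x ≤ j) (sym (≼-↾ t σ t≼σ)) l)))))
            where
              unfold : ∀ y b → level (σ ↾ b) ≤ j → entry (ev y σ) b ≡ T.col (ev y (σ ↾ b))
              unfold y b l = trans (entry-ev y b) (cong (if_then T.col (ev y (σ ↾ b)) else []) (dec-true (level
                  (σ ↾ b) ℕP.≤? j) l))

      R₀-hit : ∀ y → R₀ y ≡ hit (ev y σ) * R₀ y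
      R₀-hit y = trans (R₀-split y) (trans (cong (_* o) (matches-P y)) (trans (cong (_* o) (sym (hit-idem (ev y σ))))
        (trans (*-assoc (hit (ev y σ)) (hit (ev y σ)) o) (cong (hit (ev y σ) *_) (trans (cong (_* o) (sym (matches-P y)))
            (sym (R₀-split y)))))))
        where
          o : ℚ
          o = prodL O (λ t → ind (agree T.col y y₀ t))

      -- Where `R₀` does not vanish, the profile on `σ` is that of `z₀`; it determines the facet
      -- key, on which alone `g` depends.
      g-const : ∀ y → g (ev y σ) * R₀ y ≡ D * R₀ y
      g-const y = trans (cong (g (ev y σ) *_) (R₀-hit y)) (trans (go (profile (ev y σ) ≟ˡ profile z₀)) (cong (D *_) (sym
          (R₀-hit y))))
        where
          zeros : ∀ a b r → a * (0ℚ * r) ≡ b * (0ℚ * r)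
          zeros = solve-∀ ℚ-ring
          go : (d : Dec (profile (ev y σ) ≡ profile z₀)) → g (ev y σ) * (ind (does d) * R₀ y) ≡ D * (ind (does d) * R₀ y)
          go (no _) = zeros (g (ev y σ)) D (R₀ y)
          go (yes eq) = cong (_* (1ℚ * R₀ y)) (trans (Faces.Π-cong-key e q f {ev y σ} {z₀}
            (profile⇒faceKey (ev y σ) z₀ (trans (supp-ev y σ) (sym (supp-ev y₀ σ))) (trans (level-ev y σ) level-σ) eq))
                (sym D-as))

      ag-σ : ∀ y → ag y σ ≡ f (ev y σ)
      ag-σ y = cong₂ (λ a b → ind (does (a ≟ᶜ b))) (high T.col c (ev y σ) (ev-high y σ σ-high)) (high T.col c (ev y₀ σ)
          (ev-high y₀ σ σ-high))

      -- The proportion of completions of a tuple on `σ` that match `y₀` on all of `H₀`.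
      τ : Tuple → ℚ
      τ z = E w (λ y → R₀ (overwrite y σ z))

      ev-ow : ∀ (y : Point n w) (z : Tuple) → supp z ≡ e → ev (overwrite y σ z) σ ≡ z
      ev-ow y z = ev-overwrite y σ z inj-σ

      mass-P : Eₛ e hit ≡ frequency T.col P y₀
      mass-P = sym (begin
        E w (λ y → matches T.col P y y₀)  ≡⟨ cong-≡ (E-linear w) matches-P ⟩
        E w (λ y → hit (ev y σ))          ≡⟨ sym (E-overwrite σ (λ y → hit (ev y σ))) ⟩
        E w (λ y → Eₛ e (λ z → hit (ev (overwrite y σ z) σ)))
          ≡⟨ cong-≡ (E-linear w) (λ y → Mean.cong-on (Eₛ-mean e) λ z i → cong hit (ev-ow y z i)) ⟩
        E w (λ y → Eₛ e hit)              ≡⟨ Mean.const (E-mean w) (Eₛ e hit) ⟩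
        Eₛ e hit                          ∎)
        where open ≡-Reasoning

      module Dbl = Double H₀ σ lσ

      -- The square counts pairs of independent completions of a common tuple on `σ`, which are the
      -- maps of the doubled complex.
      second-moment : Eₛ e (λ z → τ z * τ z) ≡ frequency T.col Dbl.double (y₀ Vec.++ y₀)
      second-moment = sym (begin
        E (w ℕ.+ w) (λ Y → matches T.col Dbl.double Y (y₀ Vec.++ y₀))
          ≡⟨ E-++ w w (λ Y → matches T.col Dbl.double Y (y₀ Vec.++ y₀)) ⟩
        E w (λ y → E w (λ y′ → matches T.col Dbl.double (y Vec.++ y′) (y₀ Vec.++ y₀)))
          ≡⟨ cong-≡ (E-linear w) (λ y → cong-≡ (E-linear w) (λ y′ → pointwise y y′)) ⟩
        E w (λ y → E w (λ y′ → R₀ y * R₀ (overwrite y′ σ (ev y σ))))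
          ≡⟨ cong-≡ (E-linear w) (λ y → scale (E-linear w) (R₀ y) (λ y′ → R₀ (overwrite y′ σ (ev y σ)))) ⟩
        E w (λ y → R₀ y * τ (ev y σ))
          ≡⟨ sym (E-overwrite σ (λ y → R₀ y * τ (ev y σ))) ⟩
        E w (λ y → Eₛ e (λ z → R₀ (overwrite y σ z) * τ (ev (overwrite y σ z) σ)))
          ≡⟨ cong-≡ (E-linear w) (λ y → Mean.cong-on (Eₛ-mean e) λ z i → cong (λ x → R₀ (overwrite y σ z) * τ x) (ev-ow y z i)) ⟩
        E w (λ y → Eₛ e (λ z → R₀ (overwrite y σ z) * τ z))
          ≡⟨ Mean.comm (E-mean w) (Mean.linear (Eₛ-mean e)) (λ y z → R₀ (overwrite y σ z) * τ z) ⟩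
        Eₛ e (λ z → E w (λ y → R₀ (overwrite y σ z) * τ z))
          ≡⟨ cong-≡ (Mean.linear (Eₛ-mean e)) (λ z → scaleʳ (E-linear w) (τ z) (λ y → R₀ (overwrite y σ z))) ⟩
        Eₛ e (λ z → τ z * τ z) ∎)
        where
          open ≡-Reasoning
          pointwise : ∀ y y′ → matches T.col Dbl.double (y Vec.++ y′) (y₀ Vec.++ y₀) ≡ R₀ y * R₀ (overwrite y′ σ (ev y σ))
          pointwise y y′ = begin
            prodL (Dbl.left ++ Dbl.right) F
              ≡⟨ prodL-++ Dbl.left Dbl.right F ⟩
            prodL Dbl.left F * prodL Dbl.right F
              ≡⟨ cong₂ _*_ (trans (prodL-map (relabel (_↑ˡ w)) (edges H₀) F) (prodL-cong {as = edges H₀} λ {t} _ → left-eq t))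
                           (trans (prodL-map (relabel Dbl.ρ) O F) (prodL-cong {as = O} λ {t} _ → right-eq t)) ⟩
            R₀ y * o
              -- The second copy lacks the faces of `σ`. They are supplied by a spare factor `hit`,
              -- which the first copy yields for free because it is idempotent.
              ≡⟨ cong (_* o) (trans (R₀-hit y) (*-comm (hit (ev y σ)) (R₀ y))) ⟩
            R₀ y * hit (ev y σ) * o
              ≡⟨ *-assoc (R₀ y) (hit (ev y σ)) o ⟩
            R₀ y * (hit (ev y σ) * o)
              ≡⟨ cong (λ h → R₀ y * (h * o)) (trans (cong hit (sym (ev-ow y′ (ev y σ) (supp-ev y σ)))) (sym (matches-P y″))) ⟩
            R₀ y * (matches T.col P y″ y₀ * o)
              ≡⟨ cong (R₀ y *_) (sym (R₀-split y″)) ⟩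
            R₀ y * R₀ y″ ∎
            where
              y″ : Point n w
              y″ = overwrite y′ σ (ev y σ)
              F : Partial (Fin (w ℕ.+ w)) v → ℚ
              F t = ind (agree T.col (y Vec.++ y′) (y₀ Vec.++ y₀) t)
              o : ℚ
              o = prodL O (λ t → ind (agree T.col y″ y₀ t))
              left-eq : ∀ t → F (relabel (_↑ˡ w) t) ≡ ind (agree T.col y y₀ t)
              left-eq t = cong₂ (λ a b → ind (does (T.col a ≟ᶜ T.col b))) (Dbl.ev-left y y′ t) (Dbl.ev-left y₀ y₀ t)
              right-eq : ∀ t → F (relabel Dbl.ρ t) ≡ ind (agree T.col y″ y₀ t)
              right-eq t = cong₂ (λ a b → ind (does (T.col a ≟ᶜ T.col b)))
                (Dbl.ev-right y y′ y″ t (Dbl.lookup-ρ y y′)) (Dbl.ev-right y₀ y₀ y₀ t (Dbl.lookup-ρ-diag y₀))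

      hatP hatO : ℚ
      hatP = predicted T.dens P y₀
      hatO = prodL O (λ t → T.dens (ev y₀ t))

      hat₀-split : hat₀ ≡ hatP * hatO
      hat₀-split = prodL-filter (_⊑? σ) (edges H₀) (λ t → T.dens (ev y₀ t))

      0≤hatP : 0ℚ ≤ℚ hatP
      0≤hatP = prodL-nonneg {as = edges P} λ i → 0≤dens₀ (proj₁ (∈P⇒ i))

      0≤hatO : 0ℚ ≤ℚ hatO
      0≤hatO = prodL-nonneg {as = O} λ i → 0≤dens₀ (proj₁ (∈P.∈-filter⁻ (λ t → ¬? (t ⊑? σ)) {xs = edges H₀} i))

      count-P : frequency T.col P y₀ ≤ℚ 2ℚ * hatP
      count-P = hat-≤ θ′≤1 0≤hatP (T.count P (λ i → proj₂ (∈H₀⇒ (proj₁ (∈P⇒ i))))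
        (ℕP.≤-trans (ℕP.≤-trans (ListP.length-filter (_⊑? σ) (edges H₀)) size₀) (ℕP.m≤m+n s s)) y₀ (λ i → good₀ (proj₁ (∈P⇒ i))))

      hat-double : predicted T.dens Dbl.double (y₀ Vec.++ y₀) ≡ hat₀ * hatO
      hat-double = trans (prodL-++ Dbl.left Dbl.right F) (cong₂ _*_
        (trans (prodL-map (relabel (_↑ˡ w)) (edges H₀) F) (prodL-cong {as = edges H₀} λ {t} _ → cong T.dens
            (Dbl.ev-left y₀ y₀ t)))
        (trans (prodL-map (relabel Dbl.ρ) O F) (prodL-cong {as = O} λ {t} _ → cong T.dens (Dbl.ev-right y₀ y₀ y₀ t
            (Dbl.lookup-ρ-diag y₀)))))
        where
          F : Partial (Fin (w ℕ.+ w)) v → ℚ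
          F t = T.dens (ev (y₀ Vec.++ y₀) t)

      double-edge : ∀ {t} → t ∈ edges Dbl.double → Σ (Edge v w) λ t′ → t′ ∈ edges H₀ × ev
          (y₀ Vec.++ y₀) t ≡ ev y₀ t′ × level t ≡ level t′
      double-edge {t} i with ∈P.∈-++⁻ Dbl.left i
      ... | inj₁ i₁ with ∈P.∈-map⁻ (relabel (_↑ˡ w)) i₁
      ...   | t′ , i′ , refl = t′ , i′ , Dbl.ev-left y₀ y₀ t′ , cong card (supp-relabel (_↑ˡ w) t′)
      double-edge {t} i | inj₂ i₂ with ∈P.∈-map⁻ (relabel Dbl.ρ) i₂
      ... | t′ , i′ , refl = t′ , proj₁ (∈P.∈-filter⁻ (λ t → ¬? (t ⊑? σ)) {xs = edges H₀} i′) , Dbl.ev-right y₀ y₀ y₀ t′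
          (Dbl.lookup-ρ-diag y₀) , cong card (supp-relabel Dbl.ρ t′)

      -- Here complexes with twice as many faces are counted, hence the size `s + s` in the lower
      -- tower. The doubled base map has only patterns of `y₀`, so it avoids the same exceptional
      -- tuples.
      count-double : frequency T.col Dbl.double (y₀ Vec.++ y₀) ≤ℚ 2ℚ * (hat₀ * hatO)
      count-double = hat-≤ θ′≤1 (0≤-* 0≤hat₀ 0≤hatO) (subst (λ h → ∣ frequency T.col Dbl.double
          (y₀ Vec.++ y₀) - h ∣ ≤ℚ θ′ * h) hat-double
        (T.count Dbl.double (λ i → let (t′ , i′ , _ , l) = double-edge i in subst (_≤ j) (sym l) (proj₂ (∈H₀⇒ i′)))
          (ℕP.≤-trans Dbl.length-double (ℕP.+-mono-≤ size₀ size₀)) (y₀ Vec.++ y₀)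
          (λ i → let (t′ , i′ , eq , _) = double-edge i in trans (cong T.bad eq) (good₀ i′))))

      A : Tuple → ℚ
      A z = ∣ L z ∣ * hit z

      B : ℚ
      B = E w (λ y → ∣ L (ev y σ) ∣ * R₀ y)

      B-as : B ≡ Eₛ e (λ z → A z * τ z)
      B-as = begin
        E w (λ y → ∣ L (ev y σ) ∣ * R₀ y)
          ≡⟨ sym (E-overwrite σ (λ y → ∣ L (ev y σ) ∣ * R₀ y)) ⟩
        E w (λ y → Eₛ e (λ z → ∣ L (ev (overwrite y σ z) σ) ∣ * R₀ (overwrite y σ z)))
          ≡⟨ cong-≡ (E-linear w) (λ y → Mean.cong-on (Eₛ-mean e) λ z i → trans (cong₂ _*_ (cong (λ x → ∣ L x ∣) (ev-ow y z i))
               (trans (R₀-hit (overwrite y σ z)) (cong (λ x → hit x * R₀ (overwrite y σ z)) (ev-ow y z i))))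
               (sym (*-assoc ∣ L z ∣ (hit z) (R₀ (overwrite y σ z))))) ⟩
        E w (λ y → Eₛ e (λ z → A z * R₀ (overwrite y σ z)))
          ≡⟨ Mean.comm (E-mean w) (Mean.linear (Eₛ-mean e)) (λ y z → A z * R₀ (overwrite y σ z)) ⟩
        Eₛ e (λ z → E w (λ y → A z * R₀ (overwrite y σ z)))
          ≡⟨ cong-≡ (Mean.linear (Eₛ-mean e)) (λ z → scale (E-linear w) (A z) (λ y → R₀ (overwrite y σ z))) ⟩
        Eₛ e (λ z → A z * τ z) ∎
        where open ≡-Reasoning

      A²-≤ : Eₛ e (λ z → A z * A z) ≤ℚ α * α * Eₛ e hit
      A²-≤ = ≤-trans (Mean.mono (Eₛ-mean e) {g = λ z → spread e z * hit z} λ z _ → subst (_≤ℚ spread e z * hit z) (sym (sq z))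
          (*-monoˡ (0≤ind (does (profile z ≟ˡ profile z₀))) (sumL-term {f = λ κ → deviation e κ z * deviation e κ z}
              (λ κ → 0≤-sq (deviation e κ z)) κ∈)))
        (subst (_≤ℚ α * α * Eₛ e hit) (Prof.Π-mass e (spread e) {z₀} (supp-ev y₀ σ))
          (*-monoˡ (Prof.mass-nonneg e (profile z₀)) (subst (_≤ℚ α * α) (cong (λ e → Prof.Π e (spread e) z₀) (supp-ev y₀ σ))
              (proj₂ good-top))))
        where
          shuffle : ∀ a h → a * h * (a * h) ≡ a * a * (h * h)
          shuffle = solve-∀ ℚ-ring
          sq : ∀ z → A z * A z ≡ L z * L z * hit z
          sq z = trans (shuffle ∣ L z ∣ (hit z)) (cong₂ _*_ (sq-∣∣ (L z)) (hit-idem z))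

      -- Cauchy-Schwarz with the mass `hatP` of the cell in `A²-≤` and with `hatP * hatO * hatO` for
      -- the second moment. Their product is a perfect square, so the error is proportional to
      -- `hat₀` although `α` is unrelated to `δ₀`.
      B-≤ : B ≤ℚ 2ℚ * α * hat₀
      B-≤ = sq-cancel-≤ (0≤-* (0≤-* 0≤2 0≤α) 0≤hat₀) (≤-trans
        (subst (λ b → b * b ≤ℚ AA * TT) (sym B-as) (Mean.cauchy-schwarz (Eₛ-mean e) A τ))
        (subst (AA * TT ≤ℚ_) (trans (final α hatP hatO) (cong (λ h → 2ℚ * α * h * (2ℚ * α * h)) (sym hat₀-split)))
          (*-mono (Mean.nonneg (Eₛ-mean e) λ z _ → 0≤-sq (A z))
            (≤-trans A²-≤ (*-monoʳ (0≤-sq α) (subst (_≤ℚ 2ℚ * hatP) (sym mass-P) count-P)))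
            (Mean.nonneg (Eₛ-mean e) λ z _ → 0≤-sq (τ z))
            (subst (_≤ℚ 2ℚ * (hatP * hatO * hatO)) (sym second-moment)
              (subst (λ h → frequency T.col Dbl.double (y₀ Vec.++ y₀) ≤ℚ 2ℚ * (h * hatO)) hat₀-split count-double)))))
        where
          AA TT : ℚ
          AA = Eₛ e (λ z → A z * A z)
          TT = Eₛ e (λ z → τ z * τ z)
          final : ∀ a p o → a * a * ((1ℚ + 1ℚ) * p) * ((1ℚ + 1ℚ) * (p * o * o)) ≡ (1ℚ + 1ℚ) * a * (p * o) * ((1ℚ + 1ℚ) * a *
              (p * o))
          final = solve-∀ ℚ-ring

      module _ (ts : List (Edge v w)) (ts∈ : ∀ {t} → t ∈ ts → t ∈ edges H × t ≢ σ) where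

        W : Point n w → ℚ
        W y = prodL ts (ag y) * R₀ y

        0≤W : ∀ y → 0ℚ ≤ℚ W y
        0≤W y = 0≤-* (prodL-nonneg {as = ts} λ {t} _ → 0≤ag y t) (0≤R₀ y)

        W≤R₀ : ∀ y → W y ≤ℚ R₀ y
        W≤R₀ y = *-shrinkˡ (0≤R₀ y) (prodL-≤1 {as = ts} (λ {t} _ → 0≤ag y t) λ {t} _ → ag≤1 y t)

        W-as : ∀ y → prodL (ts ++ edges H₀) (ag y) ≡ W y
        W-as y = trans (prodL-++ ts (edges H₀) (ag y)) (cong (prodL ts (ag y) *_) (R₀-as-ag y))

        other-edge : ∀ {t} → t ∈ ts ++ edges H₀ → t ∈ edges H × t ≢ σ
        other-edge i with ∈P.∈-++⁻ ts i
        ... | inj₁ i₁ = ts∈ i₁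
        ... | inj₂ i₂ = let (i′ , l) = ∈H₀⇒ i₂ in i′ , λ { refl → σ-high l }

        -- `σ` has the highest level in `H`, so a face containing it would equal it; every other
        -- face differs from `σ` somewhere on the support of `σ`.
        separated : ∀ {t} → t ∈ ts ++ edges H₀ → Labelled (lab H) t × Σ (Fin v) λ r → Σ (Fin w)
            λ u → lookup σ r ≡ just u × lookup t r ≢ just u
        separated {t} i = let (i′ , t≢σ) = other-edge i in labelled H i′ ,
          ¬≼-witness Fin._≟_ σ t (λ h → t≢σ (sym (≼-antisym σ t h (subst (level t ≤_) (sym level-σ) (levels i′)))))

        U-≤ : ∣ E w (λ y → U (ev y σ) * W y) ∣ ≤ℚ ε
        U-≤ = subst (λ x → ∣ x ∣ ≤ℚ ε) (cong-≡ (E-linear w) λ y → cong (U (ev y σ) *_) (W-as y))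
          (E-test-≤ (lab H) σ lσ (ts ++ edges H₀) separated col y₀ U λ A → uniform e κ∈ A)

        -- The remaining top edges are dropped by `W≤R₀`. What is left to count lies on levels up to
        -- `j`, where the lower tower already counts.
        L-≤ : ∣ E w (λ y → L (ev y σ) * W y) ∣ ≤ℚ 2ℚ * α * hat₀
        L-≤ = ≤-trans (Mean.abs-≤ (E-mean w) {g = λ y → ∣ L (ev y σ) ∣ * R₀ y} λ y _ → subst (_≤ℚ ∣ L (ev y σ) ∣ * R₀ y)
          (sym (trans (ℚP.∣p*q∣≡∣p∣*∣q∣ (L (ev y σ)) (W y)) (cong (∣ L (ev y σ) ∣ *_) (ℚP.0≤p⇒∣p∣≡p (0≤W y)))))
          (*-monoʳ (ℚP.0≤∣p∣ (L (ev y σ))) (W≤R₀ y))) B-≤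

        X-decomposition : X (σ ∷ ts) ≡ E w (λ y → U (ev y σ) * W y) + (E w (λ y → L (ev y σ) * W y) + D * X ts)
        X-decomposition = trans (cong-≡ (E-linear w) pointwise)
          (trans (add (E-linear w) (λ y → U (ev y σ) * W y) (λ y → L (ev y σ) * W y + D * W y)) (cong (E w (λ y → U
              (ev y σ) * W y) +_)
            (trans (add (E-linear w) (λ y → L (ev y σ) * W y) (λ y → D * W y)) (cong (E w (λ y → L (ev y σ) * W y) +_)
              (scale (E-linear w) D W)))))
          where
            split : ∀ f g g′ p r → f * p * r ≡ (f - g′) * (p * r) + ((g′ - g) * (p * r) + p * (g * r))
            split = solve-∀ ℚ-ring
            merge : ∀ p d r → p * (d * r) ≡ d * (p * r)
            merge = solve-∀ ℚ-ring
            pointwise : ∀ y → prodL (σ ∷ ts) (ag y) * R₀ y ≡ U (ev y σ) * W y + (L (ev y σ) * W y + D * W y)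
            pointwise y = trans (cong (λ a → a * prodL ts (ag y) * R₀ y) (ag-σ y))
              (trans (split (f (ev y σ)) (g (ev y σ)) (g′ (ev y σ)) (prodL ts (ag y)) (R₀ y))
                (cong (λ x → U (ev y σ) * W y + (L (ev y σ) * W y + x))
                  (trans (cong (prodL ts (ag y) *_) (g-const y)) (merge (prodL ts (ag y)) D (R₀ y)))))

        peel : ∣ X (σ ∷ ts) - D * X ts ∣ ≤ℚ ε + 2ℚ * α * hat₀
        peel = subst (λ x → ∣ x ∣ ≤ℚ ε + 2ℚ * α * hat₀) (sym (trans (cong (_- D * X ts) X-decomposition)
            (cancel (E w (λ y → U (ev y σ) * W y)) (E w (λ y → L (ev y σ) * W y)) (D * X ts))))
          (≤-trans (ℚP.∣p+q∣≤∣p∣+∣q∣ (E w (λ y → U (ev y σ) * W y)) (E w (λ y → L (ev y σ) * W y))) (+-mono-≤ U-≤ L-≤))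
          where cancel : ∀ a b c → a + (b + c) - c ≡ a + b
                cancel = solve-∀ ℚ-ring

-- `β` bounds each of the two kinds of exceptional top tuples. `τ`, relative to `hat₀`, bounds each
-- of three errors: all uniformity terms, all deviations, and the lower count. Three of them are
-- paid by `θ` times the least product `θ₁ ^ℚ s` of top densities.
module Assemble {n v : ℕ} (M j s : ℕ) (c q q′ : Partial (Fin (suc n)) v → Colour) (length-c : ∀ z → length (c z) ≤ M)
  (θ θ′ δ₀ ε α β τ θ₁ : ℚ) (T₀ : Tower j (s ℕ.+ s) θ′ δ₀ q)
  (θ′≤1 : θ′ ≤ℚ 1ℚ) (θ′≤θ : θ′ ≤ℚ θ) (0<δ₀ : 0ℚ <ℚ δ₀) (δ₀≤1 : δ₀ ≤ℚ 1ℚ) (0<α : 0ℚ <ℚ α) (0≤ε : 0ℚ ≤ℚ ε)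
  (0<θ₁ : 0ℚ <ℚ θ₁) (θ₁≤1 : θ₁ ≤ℚ 1ℚ) (0≤θ : 0ℚ ≤ℚ θ)
  (Kθ₁≤β : fromℕ (length (codes M)) * θ₁ ≤ℚ β) (β+β≤θ : β + β ≤ℚ θ)
  (sε≤ : fromℕ s * ε ≤ℚ τ * δ₀ ^ℚ s) (sα≤ : fromℕ s * (2ℚ * α) ≤ℚ τ) (θ′≤τ : θ′ ≤ℚ τ) (0≤τ : 0ℚ ≤ℚ τ)
      (3τ≤ : τ + τ + τ ≤ℚ θ * θ₁ ^ℚ s)
  (gain≤ : Regularity.Energy.total {n} {v} M c (Regularity.Energy.gain {n} {v} M c q q′) ≤ℚ α * α * β)
  (uniform : Regularity.Energy.Uniform {n} {v} M c q′ ε) where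

  open Regularity {n} {v}
  open Energy M c
  open Step {n} {v} M j s c q q′ length-c θ′ δ₀ ε α θ₁ T₀ θ′≤1 0<δ₀ (<⇒≤ 0<α) uniform

  0≤top : ∀ z → 0ℚ ≤ℚ top z
  0≤top z = density-nonneg q (supp z) (c z) z

  top≤1 : ∀ z → top z ≤ℚ 1ℚ
  top≤1 z = density-≤1 q (supp z) (c z) refl

  module _ (e : Subset v) where

    -- For a fixed colour, the event of low density depends on the facet key only, so `𝔼-Π` replaces
    -- the indicator of the colour by its density, which is below `θ₁` there. The colours contribute
    -- the factor `length (codes M)`.
    sparse-small : Eₛ e (λ z → ind (lessᵇ (top z) θ₁)) ≤ℚ β
    sparse-small = ≤-trans (Mean.mono (Eₛ-mean e) {g = λ z → sumL (codes M) (λ κ → F κ z)} one)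
      (subst (_≤ℚ β) (sym (Mean.comm (Eₛ-mean e) (sumL-linear (codes M)) (λ z κ → F κ z)))
        (≤-trans (sumL-mono (codes M) λ {κ} _ → each κ) (subst (_≤ℚ β) (sym (sumL-const (codes M) θ₁)) Kθ₁≤β)))
      where
        S : Colour → Tuple → ℚ
        S κ z = ind (lessᵇ (density q e κ z) θ₁)
        F : Colour → Tuple → ℚ
        F κ z = isColour c κ z * S κ z
        one : ∀ z → supp z ≡ e → ind (lessᵇ (top z) θ₁) ≤ℚ sumL (codes M) (λ κ → F κ z)
        one z refl = subst (_≤ℚ sumL (codes M) (λ κ → F κ z))
          (trans (cong (λ t → ind t * S (c z) z) (dec-true (c z ≟ᶜ c z) refl)) (*-identityˡ (S (c z) z)))
          (sumL-term (λ κ → 0≤-* (0≤ind (does (c z ≟ᶜ κ))) (0≤ind (lessᵇ (density q e κ z) θ₁))) (∈-codes M (c z) (length-c z)))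
        each : ∀ κ → Eₛ e (F κ) ≤ℚ θ₁
        each κ = subst (_≤ℚ θ₁) (Faces.𝔼-Π e q (isColour c κ) (S κ) λ x z eq → cong (λ t → ind (lessᵇ t θ₁))
            (Faces.Π-cong-key e q (isColour c κ) {x} {z} eq))
          (Mean.upper (Eₛ-mean e) λ z _ → below-threshold (density q e κ z))
          where
            below-threshold : ∀ d → d * ind (lessᵇ d θ₁) ≤ℚ θ₁
            below-threshold d with lessᵇ-cases d θ₁
            ... | inj₁ (eq , d<θ₁) rewrite eq = subst (_≤ℚ θ₁) (sym (*-identityʳ d)) (<⇒≤ d<θ₁)
            ... | inj₂ (eq , _) rewrite eq = subst (_≤ℚ θ₁) (sym (*-zeroʳ d)) (<⇒≤ 0<θ₁)

    -- Markov's inequality; conditioning preserves the mean, and the mean of the spread is at most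
    -- the total energy gain.
    spread-small : Eₛ e (λ z → ind (lessᵇ (α * α) (localSpread z))) ≤ℚ β
    spread-small = *-cancel-≤ {α * α} (0<-* 0<α 0<α) (≤-trans
      (subst (_≤ℚ Eₛ e (Prof.Π e (spread e))) (scale (Mean.linear (Eₛ-mean e)) (α * α) (λ z → ind (lessᵇ (α * α)
          (localSpread z))))
        (Mean.mono (Eₛ-mean e) markov))
      (subst (_≤ℚ α * α * β) (sym (trans (Prof.𝔼-Π-1 e (spread e)) (Mean.comm (Eₛ-mean e) (sumL-linear (codes M))
          (λ z κ → deviation e κ z * deviation e κ z))))
        (≤-trans (sumL-term {f = λ e → sumL (codes M) (gain q q′ e)} (λ e → sumL-nonneg (codes M) (gain-nonneg q q′ e))
            (∈-masks e)) gain≤)))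
      where
        markov : ∀ z → supp z ≡ e → α * α * ind (lessᵇ (α * α) (localSpread z)) ≤ℚ Prof.Π e (spread e) z
        markov z refl with lessᵇ-cases (α * α) (localSpread z)
        ... | inj₁ (eq , lt) rewrite eq = subst (_≤ℚ localSpread z) (sym (*-identityʳ (α * α))) (<⇒≤ lt)
        ... | inj₂ (eq , _) rewrite eq = subst (_≤ℚ localSpread z) (sym (*-zeroʳ (α * α)))
          (Prof.Π-nonneg e (λ x → sumL-nonneg (codes M) λ κ → 0≤-sq (deviation e κ x)) z)

    ind-∨ : ∀ a b → ind (a ∨ b) ≤ℚ ind a + ind b
    ind-∨ true b = ≤-by (0≤ind b) refl
    ind-∨ false b = ≤-reflexive (sym (+-identityˡ (ind b)))

    all-bad-small : Eₛ e (λ z → ind (bad z)) ≤ℚ θ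
    all-bad-small with card e ℕP.≤? j
    ... | yes l = subst (_≤ℚ θ) (Mean.cong-on (Eₛ-mean e) {f = λ z → ind (T.bad z)} {g = λ z → ind (bad z)}
        λ { z refl → cong ind (sym (low T.bad topBad z l)) }) (≤-trans (T.bad-small e) θ′≤θ)
    ... | no ¬l = subst (_≤ℚ θ) (Mean.cong-on (Eₛ-mean e) {f = λ z → ind (topBad z)} {g = λ z → ind (bad z)}
        λ { z refl → cong ind (sym (high T.bad topBad z ¬l)) })
      (≤-trans (Mean.mono (Eₛ-mean e) {f = λ z → ind (topBad z)} {g = λ z → ind (lessᵇ (top z) θ₁) + ind (lessᵇ (α * α)
          (localSpread z))} λ z _ → ind-∨ (lessᵇ (top z) θ₁) (lessᵇ (α * α) (localSpread z)))
        (subst (_≤ℚ θ) (sym (add (Mean.linear (Eₛ-mean e)) (λ z → ind (lessᵇ (top z) θ₁)) (λ z → ind (lessᵇ (α * α)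
            (localSpread z)))))
          (≤-trans (+-mono-≤ sparse-small spread-small) β+β≤θ)))

  module _ {w : ℕ} (H : Complex v w) (levels : ∀ {t} → t ∈ edges H → level t ≤ suc j) (size : length (edges H) ≤ s)
    (y₀ : Point n w) (good : ∀ {t} → t ∈ edges H → bad (ev y₀ t) ≡ false) where
    open Count H levels size y₀ good

    D : Edge v w → ℚ
    D t = top (ev y₀ t)

    err : ℚ
    err = ε + 2ℚ * α * hat₀

    0≤err : 0ℚ ≤ℚ err
    0≤err = 0≤-+ 0≤ε (0≤-* (0≤-* 0≤2 (<⇒≤ 0<α)) 0≤hat₀)

    -- The top edges are peeled off one at a time; as the densities already taken out are at most 1,
    -- earlier errors are not amplified.
    telescope : ∀ ts → Unique ts → (∀ {t} → t ∈ ts → t ∈ tops) → ∣ X ts - prodL ts D * X [] ∣ ≤ℚ fromℕ (length ts) * err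
    telescope [] _ _ = ≤-reflexive (trans (cong ∣_∣ (zero₁ (X []))) (sym (*-zeroˡ err)))
      where zero₁ : ∀ x → x - 1ℚ * x ≡ 0ℚ
            zero₁ = solve-∀ ℚ-ring
    telescope (σ ∷ ts) (σ∉ ∷ uts) ts⊆ = subst (λ x → ∣ x ∣ ≤ℚ fromℕ (suc (length ts)) * err) (regroup (X (σ ∷ ts)) (D σ)
        (X ts) (prodL ts D) (X []))
      (≤-trans (ℚP.∣p+q∣≤∣p∣+∣q∣ (X (σ ∷ ts) - D σ * X ts) (D σ * (X ts - prodL ts D * X [])))
        (subst (_ ≤ℚ_) (distrib (fromℕ (length ts)) err) (+-mono-≤
          (TopEdge.peel σ∈H σ-high ts λ i → proj₁ (∈tops⇒ (ts⊆ (there i))) , λ { refl → All.lookup σ∉ i refl })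
          (≤-trans (≤-reflexive (trans (ℚP.∣p*q∣≡∣p∣*∣q∣ (D σ) (X ts - prodL ts D * X [])) (cong
              (_* ∣ X ts - prodL ts D * X [] ∣) (ℚP.0≤p⇒∣p∣≡p (0≤top (ev y₀ σ))))))
            (≤-trans (*-shrinkˡ (ℚP.0≤∣p∣ (X ts - prodL ts D * X [])) (top≤1 (ev y₀ σ))) (telescope ts uts λ i → ts⊆
                (there i)))))))
      where
        σ∈H : σ ∈ edges H
        σ∈H = proj₁ (∈tops⇒ (ts⊆ (here refl)))
        σ-high : ¬ (level σ ≤ j)
        σ-high = proj₂ (∈tops⇒ (ts⊆ (here refl)))
        regroup : ∀ x d y p z → x - d * y + d * (y - p * z) ≡ x - d * p * z
        regroup = solve-∀ ℚ-ring
        distrib : ∀ l e → e + l * e ≡ (1ℚ + l) * e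
        distrib = solve-∀ ℚ-ring

    X[] : X [] ≡ frequency T.col H₀ y₀
    X[] = cong-≡ (E-linear w) λ y → *-identityˡ (R₀ y)

    frequency-split : frequency col H y₀ ≡ X tops
    frequency-split = cong-≡ (E-linear w) λ y → trans (prodL-filter (λ t → level t ℕP.≤? j) (edges H) (ag y))
      (trans (cong (_* prodL tops (ag y)) (R₀-as-ag y)) (*-comm (R₀ y) (prodL tops (ag y))))

    predicted-split : predicted dens H y₀ ≡ prodL tops D * hat₀
    predicted-split = trans (prodL-filter (λ t → level t ℕP.≤? j) (edges H) (λ t → dens (ev y₀ t)))
      (trans (cong₂ _*_ (prodL-cong {as = edges H₀} λ {t} i → low T.dens top (ev y₀ t) (ev-low y₀ t (proj₂ (∈H₀⇒ i))))
        (prodL-cong {as = tops} λ {t} i → high T.dens top (ev y₀ t) (ev-high y₀ t (proj₂ (∈tops⇒ i)))))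
        (*-comm hat₀ (prodL tops D)))

    D-≥ : θ₁ ^ℚ s ≤ℚ prodL tops D
    D-≥ = ≤-trans (^-antitone 0<θ₁ θ₁≤1 length-tops)
      (prodL-≥^ {as = tops} 0<θ₁ λ {t} i → let (i′ , h) = ∈tops⇒ i in
        proj₁ (topBad-false (ev y₀ t) (trans (sym (high T.bad topBad (ev y₀ t) (ev-high y₀ t h))) (good i′))))

    -- The uniformity error is absolute; this bound turns it into a multiple of `hat₀`.
    hat₀-≥ : δ₀ ^ℚ s ≤ℚ hat₀
    hat₀-≥ = ≤-trans (^-antitone 0<δ₀ δ₀≤1 size₀) (prodL-≥^ {as = edges H₀} 0<δ₀ dens₀-≥)

    tops-count : ∣ frequency col H y₀ - predicted dens H y₀ ∣ ≤ℚ θ * predicted dens H y₀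
    tops-count = subst₂ (λ a b → ∣ a - b ∣ ≤ℚ θ * b) (sym frequency-split) (sym predicted-split)
      (subst (λ x → ∣ x ∣ ≤ℚ θ * (p * hat₀)) (regroup (X tops) p (X []) hat₀)
        (≤-trans (ℚP.∣p+q∣≤∣p∣+∣q∣ (X tops - p * X []) (p * (X [] - hat₀)))
          (≤-trans (+-mono-≤ first second) bound)))
      where
        p : ℚ
        p = prodL tops D
        0≤p : 0ℚ ≤ℚ p
        0≤p = prodL-nonneg {as = tops} λ {t} _ → 0≤top (ev y₀ t)
        p≤1 : p ≤ℚ 1ℚ
        p≤1 = prodL-≤1 {as = tops} (λ {t} _ → 0≤top (ev y₀ t)) λ {t} _ → top≤1 (ev y₀ t)
        regroup : ∀ x p y h → x - p * y + p * (y - h) ≡ x - p * h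
        regroup = solve-∀ ℚ-ring
        expand : ∀ s e a h → s * (e + (1ℚ + 1ℚ) * a * h) ≡ s * e + s * ((1ℚ + 1ℚ) * a) * h
        expand = solve-∀ ℚ-ring
        collect : ∀ t h → t * h + t * h + t * h ≡ (t + t + t) * h
        collect = solve-∀ ℚ-ring
        first : ∣ X tops - p * X [] ∣ ≤ℚ τ * hat₀ + τ * hat₀
        first = ≤-trans (telescope tops (UniqueP.filter⁺ high? (unique H)) (λ i → i))
          (≤-trans (*-monoˡ 0≤err (fromℕ-mono length-tops))
            (subst (_≤ℚ τ * hat₀ + τ * hat₀) (sym (expand (fromℕ s) ε α hat₀))
              (+-mono-≤ (≤-trans sε≤ (*-monoʳ 0≤τ hat₀-≥)) (*-monoˡ 0≤hat₀ sα≤))))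
        second : ∣ p * (X [] - hat₀) ∣ ≤ℚ τ * hat₀
        second = ≤-trans (≤-reflexive (trans (ℚP.∣p*q∣≡∣p∣*∣q∣ p (X [] - hat₀)) (cong (_* ∣ X [] - hat₀ ∣)
            (ℚP.0≤p⇒∣p∣≡p 0≤p))))
          (≤-trans (*-shrinkˡ (ℚP.0≤∣p∣ (X [] - hat₀)) p≤1)
            (≤-trans (subst (λ x → ∣ x - hat₀ ∣ ≤ℚ θ′ * hat₀) (sym X[])
              (T.count H₀ (λ i → proj₂ (∈H₀⇒ i)) (ℕP.≤-trans size₀ (ℕP.m≤m+n s s)) y₀ good₀)) (*-monoˡ 0≤hat₀ θ′≤τ)))
        bound : τ * hat₀ + τ * hat₀ + τ * hat₀ ≤ℚ θ * (p * hat₀)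
        bound = subst₂ _≤ℚ_ (sym (collect τ hat₀)) (*-assoc θ p hat₀) (*-monoˡ 0≤hat₀ (≤-trans 3τ≤ (*-monoʳ 0≤θ D-≥)))

  tower : Tower (suc j) s θ (θ₁ * δ₀) c
  tower = record
    { col = col
    ; dens = dens
    ; bad = bad
    ; col-top = λ z l → high T.col c z (λ h → ℕP.1+n≰n (subst (_≤ j) l h))
    ; bad-small = all-bad-small
    ; dens-≥ = λ z _ → dens-lower z
    ; count = tops-count
    }
    where
      -- Both factors are at most 1, so the product serves as a common lower bound for the old and
      -- the new level.
      dens-lower : ∀ z → bad z ≡ false → θ₁ * δ₀ ≤ℚ dens z
      dens-lower z b with level z ℕP.≤? j
      ... | yes l = subst (θ₁ * δ₀ ≤ℚ_) (sym (low T.dens top z l))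
                      (≤-trans (*-shrinkˡ (<⇒≤ 0<δ₀) θ₁≤1) (T.dens-≥ z l (trans (sym (low T.bad topBad z l)) b)))
      ... | no ¬l = subst (θ₁ * δ₀ ≤ℚ_) (sym (high T.dens top z ¬l))
                      (≤-trans (*-shrink (<⇒≤ 0<θ₁) δ₀≤1) (proj₁ (topBad-false z (trans (sym (high T.bad topBad z ¬l)) b))))

-- The regularity theorem

weaken : ∀ {n v j s θ δ δ′} {c : Partial (Fin (suc n)) v → Colour} → δ′ ≤ℚ δ → Tower {n} {v} j s θ δ c → Tower j s θ δ′ c
weaken le T = record { Tower T ; dens-≥ = λ z l b → ≤-trans le (Tower.dens-≥ T z l b) }

ev-level-0 : ∀ {A : Set} {w v} (y y′ : Vec A w) (t : Edge v w) → level t ≤ 0 → ev y t ≡ ev y′ t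
ev-level-0 y y′ [] h = refl
ev-level-0 y y′ (nothing ∷ t) h = cong (nothing ∷_) (ev-level-0 y y′ t h)

-- On level 0 there is only the empty tuple, whose colour is the same for all maps: every match is
-- certain and the density 1 is exact.
tower-0 : ∀ {n v s θ} {c : Partial (Fin (suc n)) v → Colour} → 0ℚ ≤ℚ θ → Tower {n} {v} 0 s θ 1ℚ c
tower-0 {n} {v} {s} {θ} {c} 0≤θ = record
  { col = c
  ; dens = λ _ → 1ℚ
  ; bad = λ _ → false
  ; col-top = λ _ _ → refl
  ; bad-small = λ e → subst (_≤ℚ θ) (sym (null (Mean.linear (Eₛ-mean e)))) 0≤θ
  ; dens-≥ = λ _ _ _ → ≤-refl
  ; count = λ {w} H levels _ y₀ _ → subst (λ x → ∣ x ∣ ≤ℚ θ * predicted (λ _ → 1ℚ) H y₀)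
      (sym (trans (cong₂ _-_ (frequency-1 H levels y₀) (predicted-1 H y₀)) (ℚP.+-inverseʳ 1ℚ)))
      (0≤-* 0≤θ (subst (0ℚ ≤ℚ_) (sym (predicted-1 H y₀)) 0≤1))
  }
  where
    prodL-1 : ∀ {A : Set} (as : List A) {f : A → ℚ} → (∀ {a} → a ∈ as → f a ≡ 1ℚ) → prodL as f ≡ 1ℚ
    prodL-1 [] h = refl
    prodL-1 (a ∷ as) h = trans (cong₂ _*_ (h (here refl)) (prodL-1 as λ i → h (there i))) (*-identityʳ 1ℚ)
    predicted-1 : ∀ {w} (H : Complex v w) (y₀ : Point n w) → predicted (λ _ → 1ℚ) H y₀ ≡ 1ℚ
    predicted-1 H y₀ = prodL-1 (edges H) λ _ → refl
    frequency-1 : ∀ {w} (H : Complex v w) → (∀ {t} → t ∈ edges H → level t ≤ 0) → ∀ y₀ → frequency c H y₀ ≡ 1ℚ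
    frequency-1 {w} H levels y₀ = trans (cong-≡ (E-linear w) λ y → prodL-1 (edges H) λ {t} i →
      cong ind (dec-true (c (ev y t) ≟ᶜ c (ev y₀ t)) (cong c (ev-level-0 y y₀ t (levels i))))) (Mean.unit (E-mean w))

archimedean-* : ∀ p {e} → 0ℚ <ℚ e → Σ ℕ λ m → p ≤ℚ fromℕ m * e
archimedean-* p {e} 0<e = let (m , h) = archimedean (p * inv e) in m ,
  subst (_≤ℚ fromℕ m * e) (trans (*-assoc p (inv e) e) (trans (cong (p *_) (inv-* 0<e)) (*-identityʳ p))) (*-monoˡ
      (<⇒≤ 0<e) h)

0<length-codes : ∀ M → 1 ≤ length (codes M)
0<length-codes zero = s≤s z≤n
0<length-codes (suc M) = s≤s z≤n

inv-≤1 : ∀ {p} → 1ℚ ≤ℚ p → inv p ≤ℚ 1ℚ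
inv-≤1 {p} 1≤p = subst₂ _≤ℚ_ (*-identityʳ (inv p)) (inv-* 0<p) (*-monoʳ (<⇒≤ (0<inv 0<p)) 1≤p)
  where 0<p : 0ℚ <ℚ p
        0<p = <-≤-trans 0<1 1≤p

-- `δ` precedes `n` and the colouring: the final contradiction compares a power of `δ` with a
-- quantity that tends to 0 with growing `n`.
TowerBound : (v j M s : ℕ) (θ : ℚ) → Set
TowerBound v j M s θ = Σ ℚ λ δ → 0ℚ <ℚ δ × δ ≤ℚ 1ℚ ×
  (∀ {n} (c : Partial (Fin (suc n)) v → Colour) → (∀ z → length (c z) ≤ M) → ¬ ¬ Tower {n} {v} j s θ δ c)

module Induct (v j M s : ℕ) (θ : ℚ) (0<θ : 0ℚ <ℚ θ) (θ≤1 : θ ≤ℚ 1ℚ)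
  (lower : ∀ L θ → 0ℚ <ℚ θ → θ ≤ℚ 1ℚ → TowerBound v j L (s ℕ.+ s) θ) where

  -- The requirements of `Assemble`, met mostly with equality. `ω` is `1 / (s + 1)`, which also
  -- covers `s = 0`. `τ` is at the same time the precision demanded of the lower tower, and `η` is
  -- the largest gain that Markov's inequality allows.
  K β θ₁ target τ ω α η : ℚ
  K = fromℕ (length (codes M))
  β = inv 2ℚ * θ
  θ₁ = inv K * β
  target = θ * θ₁ ^ℚ s
  τ = inv 3ℚ * target
  ω = inv (fromℕ (suc s))
  α = inv 2ℚ * (τ * ω)
  η = α * α * β

  1≤K : 1ℚ ≤ℚ K
  1≤K = fromℕ-mono {1} {length (codes M)} (0<length-codes M)

  0<K : 0ℚ <ℚ K
  0<K = <-≤-trans 0<1 1≤K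

  0<β : 0ℚ <ℚ β
  0<β = 0<-* (0<inv 0<2) 0<θ

  half : ∀ e → e + e ≡ 2ℚ * e
  half e = lem e
    where lem : ∀ e → e + e ≡ (1ℚ + 1ℚ) * e
          lem = solve-∀ ℚ-ring

  cancel-inv : ∀ {p} x → 0ℚ <ℚ p → p * (inv p * x) ≡ x
  cancel-inv {p} x 0<p = trans (sym (*-assoc p (inv p) x)) (trans (cong (_* x) (trans (*-comm p (inv p)) (inv-* 0<p)))
      (*-identityˡ x))

  β+β≡θ : β + β ≡ θ
  β+β≡θ = trans (half β) (cancel-inv θ 0<2)

  β≤1 : β ≤ℚ 1ℚ
  β≤1 = ≤-trans (≤-by (<⇒≤ 0<β) (sym β+β≡θ)) θ≤1

  0<θ₁ : 0ℚ <ℚ θ₁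
  0<θ₁ = 0<-* (0<inv 0<K) 0<β

  θ₁≤1 : θ₁ ≤ℚ 1ℚ
  θ₁≤1 = *-≤1 (<⇒≤ (0<inv 0<K)) (inv-≤1 1≤K) (<⇒≤ 0<β) β≤1

  0<target : 0ℚ <ℚ target
  0<target = 0<-* 0<θ (0<^ s 0<θ₁)

  target≤θ : target ≤ℚ θ
  target≤θ = *-shrink (<⇒≤ 0<θ) (^-≤1 s 0<θ₁ θ₁≤1)

  0<τ : 0ℚ <ℚ τ
  0<τ = 0<-* (0<inv 0<3) 0<target

  3τ≡ : τ + τ + τ ≡ target
  3τ≡ = trans (lem τ) (cancel-inv target 0<3)
    where lem : ∀ e → e + e + e ≡ (1ℚ + (1ℚ + 1ℚ)) * e
          lem = solve-∀ ℚ-ring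

  τ≤θ : τ ≤ℚ θ
  τ≤θ = ≤-trans (≤-by (0≤-+ (<⇒≤ 0<τ) (<⇒≤ 0<τ)) (trans (sym 3τ≡) (+-assoc τ τ τ))) target≤θ

  0<ω : 0ℚ <ℚ ω
  0<ω = 0<inv (0<fromℕ-suc s)

  sω≤1 : fromℕ s * ω ≤ℚ 1ℚ
  sω≤1 = subst (fromℕ s * ω ≤ℚ_) (trans (*-comm (fromℕ (suc s)) ω) (inv-* (0<fromℕ-suc s))) (*-monoˡ (<⇒≤ 0<ω)
      (fromℕ-mono (ℕP.n≤1+n s)))

  sω-absorb : ∀ x → 0ℚ ≤ℚ x → fromℕ s * (x * ω) ≤ℚ x
  sω-absorb x 0≤x = subst (_≤ℚ x) (lem x (fromℕ s) ω) (*-shrink 0≤x sω≤1)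
    where lem : ∀ x s w → x * (s * w) ≡ s * (x * w)
          lem = solve-∀ ℚ-ring

  0<α : 0ℚ <ℚ α
  0<α = 0<-* (0<inv 0<2) (0<-* 0<τ 0<ω)

  0<η : 0ℚ <ℚ η
  0<η = 0<-* (0<-* 0<α 0<α) 0<β

  -- This unfolds to `maxEnergy`, but mentions neither `n` nor a colouring, so the number of rounds
  -- can be fixed before both.
  maxE : ℚ
  maxE = sumL (masks v) (λ _ → sumL (codes M) (λ _ → 1ℚ))

  module _ (L : ℕ) where

    low-bound : TowerBound v j L (s ℕ.+ s) τ
    low-bound = lower L τ 0<τ (≤-trans τ≤θ θ≤1)

    δ₀ ε : ℚ
    δ₀ = proj₁ low-bound
    ε = τ * δ₀ ^ℚ s * ω

    0<δ₀ : 0ℚ <ℚ δ₀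
    0<δ₀ = proj₁ (proj₂ low-bound)

    δ₀≤1 : δ₀ ≤ℚ 1ℚ
    δ₀≤1 = proj₁ (proj₂ (proj₂ low-bound))

    0<ε : 0ℚ <ℚ ε
    0<ε = 0<-* (0<-* 0<τ (0<^ s 0<δ₀)) 0<ω

    refinements : Σ ℕ λ m → maxE ≤ℚ fromℕ m * (ε * ε)
    refinements = archimedean-* maxE (0<-* 0<ε 0<ε)

    nextLength : ℕ
    nextLength = proj₁ refinements ℕ.* v ℕ.+ L

  module _ {n : ℕ} (c : Partial (Fin (suc n)) v → Colour) (length-c : ∀ z → length (c z) ≤ M) where
    open Regularity {n} {v}
    open Energy M c

    energy-nonneg : ∀ q → 0ℚ ≤ℚ energy q
    energy-nonneg q = sumL-nonneg (masks v) λ e → sumL-nonneg (codes M) λ κ → Mean.nonneg (Eₛ-mean e) λ z _ → 0≤-sq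
        (density q e κ z)

    assemble : ∀ L q q′ → (∀ z → length (q z) ≤ L) → Uniform q′ (ε L) → total (gain q q′) ≤ℚ η → ¬ ¬ Tower {n} {v}
        (suc j) s θ (θ₁ * δ₀ L) c
    assemble L q q′ length-q uniform gain≤ = ¬¬-bind (proj₂ (proj₂ (proj₂ (low-bound L))) q length-q) λ T₀ k → k
      (Assemble.tower M j s c q q′ length-c θ τ (δ₀ L) (ε L) α β τ θ₁ T₀
        (≤-trans τ≤θ θ≤1) τ≤θ (0<δ₀ L) (δ₀≤1 L) 0<α (<⇒≤ (0<ε L)) 0<θ₁ θ₁≤1 (<⇒≤ 0<θ)
        (≤-reflexive (cancel-inv β 0<K)) (≤-reflexive β+β≡θ)
        (sω-absorb (τ * δ₀ L ^ℚ s) (<⇒≤ (0<-* 0<τ (0<^ s (0<δ₀ L)))))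
        (subst (λ x → fromℕ s * x ≤ℚ τ) (sym (cancel-inv (τ * ω) 0<2)) (sω-absorb τ (<⇒≤ 0<τ)))
        ≤-refl (<⇒≤ 0<τ) (≤-reflexive 3τ≡) gain≤ uniform)

    regularise : ∀ L q → (∀ z → length (q z) ≤ L) → ¬ ¬ Σ (Tuple → Colour) λ q′ → Refines q q′ × (∀ z → length
        (q′ z) ≤ nextLength L) × Uniform q′ (ε L)
    regularise L q length-q = weak-regularity (0<ε L) (proj₁ (refinements L)) q length-q
      (≤-trans (proj₂ (refinements L)) (≤-by (energy-nonneg q) (+-comm (energy q) _)))

    -- An energy that is already maximal cannot grow, so the next uniform refinement gains at most
    -- 0.
    finish : ∀ L q → (∀ z → length (q z) ≤ L) → maxE ≤ℚ energy q → ¬ ¬ Tower {n} {v} (suc j) s θ (θ₁ * δ₀ L) c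
    finish L q length-q h = ¬¬-bind (regularise L q length-q) go
      where
        lem : ∀ a g → a - (a + g) ≡ 0ℚ - g
        lem = solve-∀ ℚ-ring
        go : Σ (Tuple → Colour) (λ q′ → Refines q q′ × (∀ z → length (q′ z) ≤ nextLength L) × Uniform q′
            (ε L)) → ¬ ¬ Tower {n} {v} (suc j) s θ (θ₁ * δ₀ L) c
        go (q′ , ref , _ , u) = assemble L q q′ length-q u (≤-trans gain≤0 (<⇒≤ 0<η))
          where
            gain≤0 : total (gain q q′) ≤ℚ 0ℚ
            gain≤0 = diff-≤ {total (gain q q′)} {0ℚ} (subst (0ℚ ≤ℚ_) (lem (energy q) (total (gain q q′)))
              (0≤-diff (≤-trans (subst (_≤ℚ maxE) (energy-gain q q′ ref) (energy-≤ q′)) h)))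

    -- If passing to `q′` gains at most `η`, the pair `q`, `q′` is good enough. Otherwise `η` of the
    -- missing energy has been won, and the search resumes at `q′` with `x` left.
    continue : ∀ L q x {δ′} → 0ℚ <ℚ δ′ → δ′ ≤ℚ 1ℚ → (∀ z → length (q z) ≤ L) → maxE ≤ℚ energy q + (η + x) →
      (∀ q′ → (∀ z → length (q′ z) ≤ nextLength L) → maxE ≤ℚ energy q′ + x → ¬ ¬ Tower {n} {v} (suc j) s θ δ′ c) →
      ¬ ¬ Tower {n} {v} (suc j) s θ (θ₁ * δ₀ L * δ′) c
    continue L q x {δ′} 0<δ′ δ′≤1 length-q h rest = ¬¬-bind (regularise L q length-q) go
      where
        go : Σ (Tuple → Colour) (λ q′ → Refines q q′ × (∀ z → length (q′ z) ≤ nextLength L) × Uniform q′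
            (ε L)) → ¬ ¬ Tower {n} {v} (suc j) s θ (θ₁ * δ₀ L * δ′) c
        go (q′ , ref , length-q′ , u) = [ small-gain , large-gain ]′ (ℚP.≤-total (total (gain q q′)) η)
          where
            small-gain : total (gain q q′) ≤ℚ η → ¬ ¬ Tower {n} {v} (suc j) s θ (θ₁ * δ₀ L * δ′) c
            small-gain small = ¬¬-bind (assemble L q q′ length-q u small) λ T k → k (weaken (*-shrink (<⇒≤ (0<-* 0<θ₁
                (0<δ₀ L))) δ′≤1) T)
            large-gain : η ≤ℚ total (gain q q′) → ¬ ¬ Tower {n} {v} (suc j) s θ (θ₁ * δ₀ L * δ′) c
            large-gain large = ¬¬-bind (rest q′ length-q′ (≤-trans (subst (maxE ≤ℚ_) (sym (+-assoc (energy q) η x)) h)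
                (+-monoˡ-≤ x (subst (energy q + η ≤ℚ_) (sym (energy-gain q q′ ref)) (+-monoʳ-≤ (energy q) large)))))
              λ T k → k (weaken (*-shrinkˡ (<⇒≤ 0<δ′) (*-≤1 (<⇒≤ 0<θ₁) θ₁≤1 (<⇒≤ (0<δ₀ L)) (δ₀≤1 L))) T)

  -- The round in which the search stops depends on the colouring, while `δ` may not. The bound
  -- therefore multiplies the constants of all rounds; each is at most 1, so the product is weaker
  -- than any single one.
  Reach : ℕ → ℕ → ℚ → Set
  Reach fuel L δ = 0ℚ <ℚ δ × δ ≤ℚ 1ℚ × (∀ {n} (c : Partial (Fin (suc n)) v → Colour) → (∀ z → length (c z) ≤ M) →
    ∀ q → (∀ z → length (q z) ≤ L) → maxE ≤ℚ Regularity.Energy.energy {n} {v} M c q + fromℕ fuel * η → ¬ ¬ Tower {n} {v}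
        (suc j) s θ δ c)

  reach-zero : ∀ L → Reach zero L (θ₁ * δ₀ L)
  reach-zero L = 0<-* 0<θ₁ (0<δ₀ L) , *-≤1 (<⇒≤ 0<θ₁) θ₁≤1 (<⇒≤ (0<δ₀ L)) (δ₀≤1 L) ,
    λ {n} c length-c q length-q h → finish {n} c length-c L q length-q (subst (maxE ≤ℚ_) (lem
        (Regularity.Energy.energy {n} {v} M c q) η) h)
    where
      lem : ∀ a η → a + 0ℚ * η ≡ a
      lem = solve-∀ ℚ-ring

  reach-suc : ∀ fuel L {δ} → Reach fuel (nextLength L) δ → Reach (suc fuel) L (θ₁ * δ₀ L * δ)
  reach-suc fuel L {δ} (0<δ , δ≤1 , rest) = 0<-* (0<-* 0<θ₁ (0<δ₀ L)) 0<δ ,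
    *-≤1 (<⇒≤ (0<-* 0<θ₁ (0<δ₀ L))) (*-≤1 (<⇒≤ 0<θ₁) θ₁≤1 (<⇒≤ (0<δ₀ L)) (δ₀≤1 L)) (<⇒≤ 0<δ) δ≤1 ,
    λ {n} c length-c q length-q h → continue {n} c length-c L q (fromℕ fuel * η) 0<δ δ≤1 length-q
      (subst (maxE ≤ℚ_) (lem (Regularity.Energy.energy {n} {v} M c q) (fromℕ fuel) η) h) (rest {n} c length-c)
    where
      lem : ∀ a f η → a + (1ℚ + f) * η ≡ a + (η + f * η)
      lem = solve-∀ ℚ-ring

  reach : ∀ fuel L → Σ ℚ (Reach fuel L)
  reach zero L = θ₁ * δ₀ L , reach-zero L
  reach (suc fuel) L = let (δ , r) = reach fuel (nextLength L) in θ₁ * δ₀ L * δ , reach-suc fuel L r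

  bound : TowerBound v (suc j) M s θ
  -- The search starts from the constant colouring of length 0, and `fuel` rounds of gain `η`
  -- exhaust the energy.
  bound = let (fuel , enough) = archimedean-* maxE 0<η ; (δ , 0<δ , δ≤1 , r) = reach fuel 0 in
    δ , 0<δ , δ≤1 , λ {n} c length-c → r {n} c length-c (λ _ → []) (λ _ → z≤n)
      (≤-trans enough (≤-by (energy-nonneg {n} c length-c (λ _ → [])) (+-comm (Regularity.Energy.energy {n} {v} M c
          (λ _ → [])) (fromℕ fuel * η))))

towerBound : ∀ v j M s θ → 0ℚ <ℚ θ → θ ≤ℚ 1ℚ → TowerBound v j M s θ
towerBound v zero M s θ 0<θ θ≤1 = 1ℚ , 0<1 , ≤-refl , λ c _ k → k (tower-0 (<⇒≤ 0<θ))
towerBound v (suc j) M s θ 0<θ θ≤1 = Induct.bound v j M s θ 0<θ θ≤1 λ L θ → towerBound v j L (s ℕ.+ s) θ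

-- Images and packings

image-∈⁺ : ∀ {a b} (φ : Fin a → Fin b) e {i} → lookup e i ≡ true → lookup (image φ e) (φ i) ≡ true
image-∈⁺ φ e {i} h = trans (VecP.lookup∘tabulate _ (φ i)) (dec-true (FinP.any? λ i′ → (lookup e i′ BoolP.≟ true) Dec.×-dec
    (φ i′ Fin.≟ φ i)) (i , h , refl))

image-∈⁻ : ∀ {a b} (φ : Fin a → Fin b) e {j} → lookup (image φ e) j ≡ true → Σ (Fin a) λ i → lookup e i ≡ true × φ i ≡ j
image-∈⁻ φ e {j} h = does-true (FinP.any? λ i → (lookup e i BoolP.≟ true) Dec.×-dec (φ i Fin.≟ j)) (trans (sym
    (VecP.lookup∘tabulate _ j)) h)

subset-ext : ∀ {n} {p q : Subset n} → (∀ i → lookup p i ≡ true → lookup q i ≡ true) →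
    (∀ i → lookup q i ≡ true → lookup p i ≡ true) → p ≡ q
subset-ext f g = vec-ext λ i → bool-ext (f i) (g i)

image-cong : ∀ {a b} (φ ψ : Fin a → Fin b) e → (∀ i → lookup e i ≡ true → φ i ≡ ψ i) → image φ e ≡ image ψ e
image-cong φ ψ e h = subset-ext
  (λ j m → let (i , i∈ , eq) = image-∈⁻ φ e m in subst (λ x → lookup (image ψ e) x ≡ true) (trans (sym (h i i∈)) eq) (image-∈⁺ ψ e i∈))
  (λ j m → let (i , i∈ , eq) = image-∈⁻ ψ e m in subst (λ x → lookup (image φ e) x ≡ true) (trans (h i i∈) eq) (image-∈⁺ φ e i∈))

image-∘ : ∀ {a b c} (ψ : Fin b → Fin c) (φ : Fin a → Fin b) e → image ψ (image φ e) ≡ image (λ i → ψ (φ i)) e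
image-∘ ψ φ e = subset-ext
  (λ j m → let (i , i∈ , eq) = image-∈⁻ ψ (image φ e) m ; (i′ , i′∈ , eq′) = image-∈⁻ φ e i∈ in
    subst (λ x → lookup (image (λ i → ψ (φ i)) e) x ≡ true) (trans (cong ψ eq′) eq) (image-∈⁺ (λ i → ψ (φ i)) e i′∈))
  (λ j m → let (i , i∈ , eq) = image-∈⁻ (λ i → ψ (φ i)) e m in
    subst (λ x → lookup (image ψ (image φ e)) x ≡ true) eq (image-∈⁺ ψ (image φ e) (image-∈⁺ φ e i∈)))

image-id : ∀ {a} e → image {a} (λ i → i) e ≡ e
image-id e = subset-ext
  (λ j m → let (i , i∈ , eq) = image-∈⁻ (λ i → i) e m in subst (λ x → lookup e x ≡ true) eq i∈)
  (λ j m → image-∈⁺ (λ i → i) e m)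

sumF-≤1 : ∀ {m} (b : Fin m → Bool) → (∀ i i′ → b i ≡ true → b i′ ≡ true → i ≡ i′) → sumF (λ i → ind (b i)) ≤ℚ 1ℚ
sumF-≤1 {zero} b h = 0≤1
sumF-≤1 {suc m} b h with b zero in eq
... | false = subst (_≤ℚ 1ℚ) (sym (+-identityˡ _)) (sumF-≤1 (λ i → b (suc i)) λ i i′ p p′ → FinP.suc-injective (h (suc i)
    (suc i′) p p′))
... | true = ≤-reflexive (trans (cong (1ℚ +_) (trans (cong-≡ sumF-linear zeros) (null (sumF-linear {m})))) (+-identityʳ 1ℚ))
  where
    zeros : ∀ i → ind (b (suc i)) ≡ 0ℚ
    zeros i with b (suc i) in eq′
    ... | false = refl
    ... | true = contradiction (h zero (suc i) eq eq′) λ ()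

avg-≤ : ∀ {n} (b : Fin (suc n) → Bool) → (∀ i i′ → b i ≡ true → b i′ ≡ true → i ≡ i′) → avg (λ i → ind (b i)) ≤ℚ avgWeight n
avg-≤ {n} b h = subst (_≤ℚ avgWeight n) (sym (avg-sumF (λ i → ind (b i)))) (*-shrink (<⇒≤ (0<avgWeight n)) (sumF-≤1 b h))

-- When coordinate `u` is resampled, at most one of the `suc n` values satisfies `b`.
E-determined : ∀ {n w} (u : Fin w) (b : Point n w → Bool) →
  (∀ y a a′ → b (y [ u ]≔ a) ≡ true → b (y [ u ]≔ a′) ≡ true → a ≡ a′) → E w (λ y → ind (b y)) ≤ℚ avgWeight n
E-determined {n} {w} u b h = subst (_≤ℚ avgWeight n) (E-resample u (λ y → ind (b y)))
  (Mean.upper (E-mean w) λ y _ → avg-≤ (λ a → b (y [ u ]≔ a)) (h y))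

sameOn : ∀ {n v} → Subset v → (x x₀ : Vec (Fin n) v) → Bool
sameOn [] [] [] = true
sameOn (true ∷ e) (a ∷ x) (a₀ ∷ x₀) = does (a Fin.≟ a₀) ∧ sameOn e x x₀
sameOn (false ∷ e) (_ ∷ x) (_ ∷ x₀) = sameOn e x x₀

sameOn-⇂ : ∀ {n v} e (x x₀ : Vec (Fin n) v) → sameOn e x x₀ ≡ true → x ⇂ e ≡ x₀ ⇂ e
sameOn-⇂ [] [] [] _ = refl
sameOn-⇂ (true ∷ e) (a ∷ x) (a₀ ∷ x₀) h = let (p , q) = ∧-true h in cong₂ (λ b z → just b ∷ z) (does-true (a Fin.≟ a₀) p) (sameOn-⇂ e x x₀ q)
sameOn-⇂ (false ∷ e) (_ ∷ x) (_ ∷ x₀) h = cong (nothing ∷_) (sameOn-⇂ e x x₀ h)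

sumF-point : ∀ {m} (j : Fin m) → sumF (λ i → ind (does (i Fin.≟ j))) ≡ 1ℚ
sumF-point {suc m} zero = trans (cong (1ℚ +_) (null (sumF-linear {m}))) (+-identityʳ 1ℚ)
sumF-point {suc m} (suc j) = trans (+-identityˡ _) (trans (cong-≡ sumF-linear λ i → cong ind (does-⇔ (suc i Fin.≟ suc j)
    (i Fin.≟ j) FinP.suc-injective (cong suc))) (sumF-point j))

E-sameOn : ∀ {n v} e (x₀ : Point n v) → E v (λ x → ind (sameOn e x x₀)) ≡ avgWeight n ^ℚ card e
E-sameOn [] [] = refl
E-sameOn {n} {suc v} (true ∷ e) (a₀ ∷ x₀) = begin
  avg (λ a → E v (λ x → ind (does (a Fin.≟ a₀) ∧ sameOn e x x₀)))
    ≡⟨ cong-≡ avg-linear (λ a → trans (cong-≡ (E-linear v) λ x → ind-∧ (does (a Fin.≟ a₀)) (sameOn e x x₀))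
         (scale (E-linear v) (ind (does (a Fin.≟ a₀))) (λ x → ind (sameOn e x x₀)))) ⟩
  avg (λ a → ind (does (a Fin.≟ a₀)) * E v (λ x → ind (sameOn e x x₀)))
    ≡⟨ scaleʳ avg-linear (E v (λ x → ind (sameOn e x x₀))) (λ a → ind (does (a Fin.≟ a₀))) ⟩
  avg (λ a → ind (does (a Fin.≟ a₀))) * E v (λ x → ind (sameOn e x x₀))
    ≡⟨ cong₂ _*_ (trans (avg-sumF (λ a → ind (does (a Fin.≟ a₀)))) (trans (cong (avgWeight n *_) (sumF-point a₀))
        (*-identityʳ (avgWeight n)))) (E-sameOn e x₀) ⟩
  avgWeight n * avgWeight n ^ℚ card e ∎
  where open ≡-Reasoning
E-sameOn {n} {suc v} (false ∷ e) (a₀ ∷ x₀) = trans (avg-const (E v (λ x → ind (sameOn e x x₀)))) (E-sameOn e x₀)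

inv-^-cancel : ∀ {p} k → 0ℚ <ℚ p → p ^ℚ k * inv p ^ℚ k ≡ 1ℚ
inv-^-cancel zero _ = *-identityʳ 1ℚ
inv-^-cancel {p} (suc k) 0<p = trans (lem p (p ^ℚ k) (inv p) (inv p ^ℚ k)) (trans (cong₂ _*_ (inv-* 0<p)
    (inv-^-cancel k 0<p)) (*-identityʳ 1ℚ))
  where lem : ∀ a b c d → a * b * (c * d) ≡ c * a * (b * d)
        lem = solve-∀ ℚ-ring

-- A family of tuples that is injective on e meets each e-tuple at most once.
sumF-injective-≤ : ∀ {n v m} (e : Subset v) (ι : Fin m → Point n v) → (∀ a a′ → ι a ⇂ e ≡ ι a′ ⇂ e → a ≡ a′) →
  (B : Partial (Fin (suc n)) v → ℚ) → (∀ z → 0ℚ ≤ℚ B z) →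
  sumF (λ a → B (ι a ⇂ e)) ≤ℚ fromℕ (suc n) ^ℚ card e * Eₛ e B
sumF-injective-≤ {n} {v} e ι inj B 0≤B = subst (_≤ℚ N ^ℚ card e * Eₛ e B) undo (*-monoʳ (<⇒≤ (0<^ (card e)
    (0<fromℕ-suc n))) weighted)
  where
    N W S : ℚ
    N = fromℕ (suc n)
    W = inv N ^ℚ card e
    S = sumF (λ a → B (ι a ⇂ e))
    undo : N ^ℚ card e * (W * S) ≡ S
    undo = trans (sym (*-assoc (N ^ℚ card e) W S)) (trans (cong (_* S) (inv-^-cancel (card e) (0<fromℕ-suc n)))
        (*-identityˡ S))
    pointwise : ∀ a x → B (ι a ⇂ e) * ind (sameOn e x (ι a)) ≡ B (x ⇂ e) * ind (sameOn e x (ι a))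
    pointwise a x with sameOn e x (ι a) in eq
    ... | true = cong (λ z → B z * 1ℚ) (sym (sameOn-⇂ e x (ι a) eq))
    ... | false = trans (*-zeroʳ (B (ι a ⇂ e))) (sym (*-zeroʳ (B (x ⇂ e))))
    term : ∀ a → W * B (ι a ⇂ e) ≡ E v (λ x → B (x ⇂ e) * ind (sameOn e x (ι a)))
    term a = trans (*-comm W (B (ι a ⇂ e))) (trans (cong (B (ι a ⇂ e) *_) (sym (E-sameOn e (ι a))))
      (trans (sym (scale (E-linear v) (B (ι a ⇂ e)) (λ x → ind (sameOn e x (ι a))))) (cong-≡ (E-linear v) (pointwise a))))
    weighted : W * S ≤ℚ Eₛ e B
    weighted = subst (_≤ℚ Eₛ e B) (sym (trans (sym (scale sumF-linear W (λ a → B (ι a ⇂ e)))) (trans (cong-≡ sumF-linear term)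
        (sumF-comm (E-linear v) (λ a x → B (x ⇂ e) * ind (sameOn e x (ι a)))))))
      (E-mono v λ x → subst (_≤ℚ B (x ⇂ e)) (sym (scale sumF-linear (B (x ⇂ e)) (λ a → ind (sameOn e x (ι a)))))
        (*-shrink (0≤B (x ⇂ e)) (sumF-≤1 (λ a → sameOn e x (ι a)) λ a a′ p p′ → inj a a′ (trans (sym (sameOn-⇂ e x (ι a) p))
            (sameOn-⇂ e x (ι a′) p′)))))

⇂-lookup : ∀ {A : Set} {v} (x y : Vec A v) e → x ⇂ e ≡ y ⇂ e → ∀ r → lookup e r ≡ true → lookup x r ≡ lookup y r
⇂-lookup (a ∷ x) (b ∷ y) (true ∷ e) eq zero h = MaybeP.just-injective (VecP.∷-injectiveˡ eq)
⇂-lookup (a ∷ x) (b ∷ y) (_ ∷ e) eq (suc r) h = ⇂-lookup x y e (VecP.∷-injectiveʳ eq) r h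

module _ {k} (F : Hypergraph k) {n} (R : FPacking F n) where

  agree-on-edge⇒≡ : ∀ f a a′ → (∀ i → lookup (edge F f) i ≡ true → emb R a i ≡ emb R a′ i) → a ≡ a′
  agree-on-edge⇒≡ f a a′ h = disjoint R a a′ f f (image-cong (emb R a) (emb R a′) (edge F f) h)

-- By edge-disjointness, a copy is determined by the tuple of places that it gives to the vertices
-- of one fixed edge of `F`.
copies-≤ : ∀ {k n} (F : Hypergraph k) → Fin (nE F) → (R : FPacking F (suc n)) → copies R ≤ suc n ^ k
copies-≤ {k} {n} F f R = fromℕ-cancel-≤ (subst₂ _≤ℚ_ (sumF-1 (copies R))
    (trans (cong (N ^ℚ card (edge F f) *_) (Mean.unit (Eₛ-mean (edge F f)))) (trans (*-identityʳ (N ^ℚ card (edge F f)))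
        (trans (cong (N ^ℚ_) (uniform F f)) (sym (fromℕ-^ (suc n) k)))))
    (sumF-injective-≤ (edge F f) (λ a → tabulate (emb R a))
      (λ a a′ eq → agree-on-edge⇒≡ F R f a a′ λ i i∈ → trans (sym (VecP.lookup∘tabulate (emb R a) i))
        (trans (⇂-lookup (tabulate (emb R a)) (tabulate (emb R a′)) (edge F f) eq i i∈) (VecP.lookup∘tabulate (emb R a′) i)))
      (λ _ → 1ℚ) (λ _ → 0≤1)))
  where N : ℚ
        N = fromℕ (suc n)

-- Rainbow copies from homomorphisms

masks-unique : ∀ v → Unique (masks v)
masks-unique zero = All.[] ∷ []
masks-unique (suc v) = UniqueP.++⁺ (UniqueP.map⁺ VecP.∷-injectiveʳ (masks-unique v)) (UniqueP.map⁺ VecP.∷-injectiveʳ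
    (masks-unique v)) disj
  where
    disj : ∀ {b} → ¬ (b ∈ map (true ∷_) (masks v) × b ∈ map (false ∷_) (masks v))
    disj (i , i′) with ∈P.∈-map⁻ (true ∷_) i | ∈P.∈-map⁻ (false ∷_) i′
    ... | _ , _ , refl | _ , _ , ()

section : ∀ {v} → Subset v → Partial (Fin v) v
section b = Vec.allFin _ ⇂ b

ev-⇂ : ∀ {A : Set} {w v} (y : Vec A w) (x : Vec (Fin w) v) b → ev y (x ⇂ b) ≡ Vec.map (lookup y) x ⇂ b
ev-⇂ y [] [] = refl
ev-⇂ y (u ∷ x) (true ∷ b) = cong (_ ∷_) (ev-⇂ y x b)
ev-⇂ y (u ∷ x) (false ∷ b) = cong (_ ∷_) (ev-⇂ y x b)

ev-section : ∀ {A : Set} {v} (y : Vec A v) b → ev y (section b) ≡ y ⇂ b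
ev-section y b = trans (ev-⇂ y (Vec.allFin _) b) (cong (_⇂ b) (VecP.map-lookup-allFin y))

section-true : ∀ {v} (b : Subset v) r → lookup b r ≡ true → lookup (section b) r ≡ just r
section-true b r h = trans (lookup-⇂ (Vec.allFin _) b r) (trans (cong (if_then _ else nothing) h) (cong just
    (VecP.lookup-allFin r)))

section-just : ∀ {v} (b : Subset v) r {u} → lookup (section b) r ≡ just u → lookup b r ≡ true × u ≡ r
section-just b r h with lookup b r | trans (sym (lookup-⇂ (Vec.allFin _) b r)) h
... | true | eq = refl , trans (sym (MaybeP.just-injective eq)) (VecP.lookup-allFin r)

section-injective : ∀ {v} {b b′ : Subset v} → section b ≡ section b′ → b ≡ b′
section-injective {b = b} {b′} eq = trans (sym (supp-⇂ (Vec.allFin _) b)) (trans (cong supp eq) (supp-⇂ (Vec.allFin _) b′))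

level-section : ∀ {v} (b : Subset v) → level (section b) ≡ card b
level-section b = cong card (supp-⇂ (Vec.allFin _) b)

subset-witness : ∀ {v} (p q : Subset v) → card p ≡ card q → p ≢ q → Σ (Fin v) λ u → lookup p u ≡ true × lookup q u ≢ true
subset-witness p q eq ne =
  let (r , u , h , h′) = ¬≼-witness Fin._≟_ (section p) (section q)
        (λ h → ne (section-injective (≼-antisym (section p) (section q) h (ℕP.≤-reflexive (trans (level-section q) (trans
            (sym eq) (sym (level-section p))))))))
      (p∋r , u≡r) = section-just p r h
  in r , p∋r , λ q∋r → h′ (trans (section-true q r q∋r) (cong just (sym u≡r)))

ind-∨-sumL : ∀ {A : Set} (b : A → Bool) as → allL (λ a → not (b a)) as ≡ false → 1ℚ ≤ℚ sumL as (λ a → ind (b a))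
ind-∨-sumL b (a ∷ as) h with b a
... | true = ≤-by (sumL-nonneg as λ a → 0≤ind (b a)) refl
... | false = subst (1ℚ ≤ℚ_) (sym (+-identityˡ _)) (ind-∨-sumL b as h)

not-true : ∀ {b} → not b ≡ true → b ≡ false
not-true {false} _ = refl

≢true⇒false : ∀ {b} → b ≢ true → b ≡ false
≢true⇒false {true} h = contradiction refl h
≢true⇒false {false} _ = refl

-- Every vertex of `G` is a part of its own, so vertices and positions coincide and a face `b`
-- becomes the identity `section b` on `b`. All subsets of edges are included to make the complex
-- closed.
module FaceComplex {k} (G : Hypergraph k) where

  v : ℕ
  v = nV G

  IsFace : Subset v → Set
  IsFace b = Σ (Fin (nE G)) λ g → b ∩ edge G g ≡ b

  face? : ∀ b → Dec (IsFace b)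
  face? b = FinP.any? λ g → VecP.≡-dec BoolP._≟_ (b ∩ edge G g) b

  faceList : List (Subset v)
  faceList = filter face? (masks v)

  subface : ∀ {b} b′ → IsFace b → IsFace (b ∩ b′)
  subface {b} b′ (g , eq) = g , trans (SubsetP.∩-assoc b b′ (edge G g)) (trans (cong (b ∩_) (SubsetP.∩-comm b′ (edge G g)))
    (trans (sym (SubsetP.∩-assoc b (edge G g) b′)) (cong (_∩ b′) eq)))

  ∈faceList : ∀ {b} → IsFace b → b ∈ faceList
  ∈faceList {b} f = ∈P.∈-filter⁺ face? (∈-masks b) f

  ∈faceList⇒ : ∀ {b} → b ∈ faceList → IsFace b
  ∈faceList⇒ i = proj₂ (∈P.∈-filter⁻ face? {xs = masks v} i)

  complex : Complex v v
  complex = record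
    { lab = λ u → u
    ; edges = map section faceList
    ; unique = UniqueP.map⁺ section-injective (UniqueP.filter⁺ face? (masks-unique v))
    ; labelled = λ i r u h → let (b , _ , eq) = ∈P.∈-map⁻ section i in proj₂ (section-just b r (trans (cong (λ t → lookup t r) (sym eq)) h))
    ; closed = λ i b′ → let (b , b∈ , eq) = ∈P.∈-map⁻ section i in
        subst (_∈ map section faceList) (trans (sym (⇂-↾ (Vec.allFin v) b b′)) (cong (_↾ b′) (sym eq))) (∈P.∈-map⁺ section
            (∈faceList (subface b′ (∈faceList⇒ b∈))))
    }

  complex-edge : ∀ {t} → t ∈ edges complex → Σ (Subset v) λ b → IsFace b × t ≡ section b
  complex-edge i = let (b , b∈ , eq) = ∈P.∈-map⁻ section i in b , ∈faceList⇒ b∈ , eq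

  edge-∈ : ∀ g → section (edge G g) ∈ edges complex
  edge-∈ g = ∈P.∈-map⁺ section (∈faceList (g , SubsetP.∩-idem (edge G g)))

  card-face : ∀ {b} → IsFace b → card b ≤ k
  card-face {b} (g , eq) = subst₂ _≤_ (cong card eq) (uniform G g) (SubsetP.∣p∩q∣≤∣q∣ b (edge G g))

  complex-level : ∀ {t} → t ∈ edges complex → level t ≤ k
  complex-level i = let (b , f , eq) = complex-edge i in subst (_≤ k) (sym (trans (cong level eq) (level-section b))) (card-face f)

module Packed {k} (G F : Hypergraph k) (φ : Fin (nV G) → Fin (nV F)) (hom : ∀ e → IsEdge F (image φ (edge G e)))
  {n} (R : FPacking F (suc n)) (¬rainbow : ¬ RainbowCopy G F R) where
  open FaceComplex G

  copy : Fin (copies R) → Point n v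
  copy a = tabulate λ r → emb R a (φ r)

  trace : Fin (copies R) → Partial (Fin (suc n)) v
  trace a = tabulate λ r → just (emb R a (φ r))

  covered? : (z : Partial (Fin (suc n)) v) → Dec (Σ (Fin (copies R)) λ a → z ≼ trace a)
  covered? z = FinP.any? λ a → _≼?_ Fin._≟_ z (trace a)

  -- A single bit, so colours of length 1 suffice at the top level and the constants do not depend
  -- on the packing.
  coverColour : Partial (Fin (suc n)) v → Colour
  coverColour z = does (covered? z) ∷ []

  ⇂-≼-trace : ∀ (y : Point n v) e a → y ⇂ e ≼ trace a → ∀ r → lookup e r ≡ true → lookup y r ≡ emb R a (φ r)
  ⇂-≼-trace y e a h r r∈ = MaybeP.just-injective (sym (trans (sym (VecP.lookup∘tabulate (λ r → just (emb R a (φ r))) r))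
    (h r (lookup y r) (trans (lookup-⇂ y e r) (cong (if_then just (lookup y r) else nothing) r∈)))))

  ≼-trace-⇂ : ∀ (y : Point n v) e a → (∀ r → lookup e r ≡ true → lookup y r ≡ emb R a (φ r)) → y ⇂ e ≼ trace a
  ≼-trace-⇂ y e a h r u eq with lookup e r in r∈ | trans (sym (lookup-⇂ y e r)) eq
  ... | true | refl = trans (VecP.lookup∘tabulate (λ r → just (emb R a (φ r))) r) (cong just (sym (h r r∈)))

  copy-covered : ∀ a e → copy a ⇂ e ≼ trace a
  copy-covered a e = ≼-trace-⇂ (copy a) e a λ r _ → VecP.lookup∘tabulate (λ r → emb R a (φ r)) r

  -- The homomorphism makes the image of `edge G g` an edge of `F`, so two copies agreeing on it
  -- would share an edge of the packing.
  determined : ∀ g a a′ → (∀ r → lookup (edge G g) r ≡ true → emb R a (φ r) ≡ emb R a′ (φ r)) → a ≡ a′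
  determined g a a′ h = let (f , eq) = hom g in disjoint R a a′ f f (begin
    image (emb R a) (edge F f)               ≡⟨ cong (image (emb R a)) eq ⟩
    image (emb R a) (image φ (edge G g))     ≡⟨ image-∘ (emb R a) φ (edge G g) ⟩
    image (λ r → emb R a (φ r)) (edge G g)   ≡⟨ image-cong _ _ (edge G g) h ⟩
    image (λ r → emb R a′ (φ r)) (edge G g)  ≡⟨ sym (image-∘ (emb R a′) φ (edge G g)) ⟩
    image (emb R a′) (image φ (edge G g))    ≡⟨ cong (image (emb R a′)) (sym eq) ⟩
    image (emb R a′) (edge F f)              ∎)
    where open ≡-Reasoning

  Repeats : Fin v → Fin v → Point n v → Set
  Repeats r r′ y = r ≢ r′ × lookup y r ≡ lookup y r′

  repeats? : ∀ r r′ y → Dec (Repeats r r′ y)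
  repeats? r r′ y = ¬? (r Fin.≟ r′) Dec.×-dec (lookup y r Fin.≟ lookup y r′)

  SameCopy : Fin (nE G) → Fin (nE G) → Point n v → Set
  SameCopy g g′ y = g ≢ g′ × Σ (Fin (copies R)) λ a → y ⇂ edge G g ≼ trace a × y ⇂ edge G g′ ≼ trace a

  sameCopy? : ∀ g g′ y → Dec (SameCopy g g′ y)
  sameCopy? g g′ y = ¬? (g Fin.≟ g′) Dec.×-dec FinP.any? λ a → _≼?_ Fin._≟_ (y ⇂ edge G g) (trace a) Dec.×-dec _≼?_ Fin._≟_
      (y ⇂ edge G g′) (trace a)

  E-repeats : ∀ r r′ → E v (λ y → ind (does (repeats? r r′ y))) ≤ℚ avgWeight n
  E-repeats r r′ = E-determined r (λ y → does (repeats? r r′ y)) λ y a a′ h h′ →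
    trans (value y a (does-true (repeats? r r′ (y [ r ]≔ a)) h)) (sym (value y a′ (does-true (repeats? r r′ (y [ r ]≔ a′)) h′)))
    where
      value : ∀ y a → Repeats r r′ (y [ r ]≔ a) → a ≡ lookup y r′
      value y a (ne , eq) = trans (sym (VecP.lookup∘update r y a)) (trans eq (VecP.lookup∘update′ (λ e → ne (sym e)) y a))

  -- Distinct edges of equal size leave a vertex `u` of `g′` outside `g`. The values on `g`
  -- determine the copy, and the copy determines the value at `u`.
  E-sameCopy : ∀ g g′ → E v (λ y → ind (does (sameCopy? g g′ y))) ≤ℚ avgWeight n
  E-sameCopy g g′ = [ equal , different ]′ (Dec.toSum (g Fin.≟ g′))
    where
    equal : g ≡ g′ → E v (λ y → ind (does (sameCopy? g g′ y))) ≤ℚ avgWeight n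
    equal g≡g′ = subst (_≤ℚ avgWeight n) (sym (trans (cong-≡ (E-linear v) λ y → cong ind (dec-false (sameCopy? g g′ y)
        λ s → proj₁ s g≡g′)) (null (E-linear v))))
                     (<⇒≤ (0<avgWeight n))
    different : g ≢ g′ → E v (λ y → ind (does (sameCopy? g g′ y))) ≤ℚ avgWeight n
    different g≢g′ = E-determined u (λ y → does (sameCopy? g g′ y)) λ y a a′ h h′ →
        same y (does-true (sameCopy? g g′ (y [ u ]≔ a)) h) (does-true (sameCopy? g g′ (y [ u ]≔ a′)) h′)
      where
        wit = subset-witness (edge G g′) (edge G g) (trans (uniform G g′) (sym (uniform G g))) (λ eq → g≢g′ (simple G (sym eq)))
        u : Fin v
        u = proj₁ wit
        u∈g′ : lookup (edge G g′) u ≡ true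
        u∈g′ = proj₁ (proj₂ wit)
        u∉g : lookup (edge G g) u ≢ true
        u∉g = proj₂ (proj₂ wit)
        same : ∀ y {a a′} → SameCopy g g′ (y [ u ]≔ a) → SameCopy g g′ (y [ u ]≔ a′) → a ≡ a′
        same y {a} {a′} (_ , b , p , q) (_ , b′ , p′ , q′) = begin
          a                        ≡⟨ sym (VecP.lookup∘update u y a) ⟩
          lookup (y [ u ]≔ a) u    ≡⟨ ⇂-≼-trace (y [ u ]≔ a) (edge G g′) b q u u∈g′ ⟩
          emb R b (φ u)            ≡⟨ cong (λ b → emb R b (φ u)) (determined g b b′ λ r r∈ → trans (sym (off a b p r r∈))
              (off a′ b′ p′ r r∈)) ⟩
          emb R b′ (φ u)           ≡⟨ sym (⇂-≼-trace (y [ u ]≔ a′) (edge G g′) b′ q′ u u∈g′) ⟩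
          lookup (y [ u ]≔ a′) u   ≡⟨ VecP.lookup∘update u y a′ ⟩
          a′                       ∎
          where
            open ≡-Reasoning
            off : ∀ a b → (y [ u ]≔ a) ⇂ edge G g ≼ trace b → ∀ r → lookup (edge G g) r ≡ true → lookup y r ≡ emb R b (φ r)
            off a b p r r∈ = trans (sym (VecP.lookup∘update′ (λ { refl → u∉g r∈ }) y a)) (⇂-≼-trace (y [ u ]≔ a)
                (edge G g) b p r r∈)

  repetitions sharedCopies : Point n v → ℚ
  repetitions y = sumF (λ r → sumF (λ r′ → ind (does (repeats? r r′ y))))
  sharedCopies y = sumF (λ g → sumF (λ g′ → ind (does (sameCopy? g g′ y))))

  degenerate : Point n v → ℚ
  degenerate y = repetitions y + sharedCopies y

  E-pairs : ∀ {m} (b : Fin m → Fin m → Point n v → Bool) → (∀ i j → E v (λ y → ind (b i j y)) ≤ℚ avgWeight n) →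
    E v (λ y → sumF (λ i → sumF (λ j → ind (b i j y)))) ≤ℚ fromℕ (m ℕ.* m) * avgWeight n
  E-pairs {m} b h = subst₂ _≤ℚ_ (trans (cong-≡ (sumF-linear {m}) λ i → sumF-comm (E-linear v) (λ j y → ind (b i j y)))
      (sumF-comm (E-linear v) (λ i y → sumF (λ j → ind (b i j y)))))
      total (sumF-mono λ i → sumF-mono λ j → h i j)
    where
      I : ℚ
      I = avgWeight n
      constant : ∀ c → sumF {m} (λ _ → c) ≡ fromℕ m * c
      constant c = trans (cong-≡ (sumF-linear {m}) λ _ → sym (*-identityˡ c)) (trans (scaleʳ (sumF-linear {m}) c
          (λ _ → 1ℚ)) (cong (_* c) (sumF-1 m)))
      total : sumF {m} (λ _ → sumF {m} (λ _ → I)) ≡ fromℕ (m ℕ.* m) * I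
      total = trans (constant (sumF {m} (λ _ → I))) (trans (cong (fromℕ m *_) (constant I)) (trans (sym (*-assoc (fromℕ m)
          (fromℕ m) I)) (cong (_* I) (sym (fromℕ-* m m)))))

  pairs : ℕ
  pairs = v ℕ.* v ℕ.+ nE G ℕ.* nE G

  E-degenerate : E v degenerate ≤ℚ fromℕ pairs * avgWeight n
  E-degenerate = subst₂ _≤ℚ_ (sym (add (E-linear v) repetitions sharedCopies))
    (trans (sym (ℚP.*-distribʳ-+ I (fromℕ (v ℕ.* v)) (fromℕ (nE G ℕ.* nE G)))) (cong (_* I) (sym (fromℕ-+ (v ℕ.* v)
        (nE G ℕ.* nE G)))))
    (+-mono-≤ (E-pairs (λ r r′ y → does (repeats? r r′ y)) E-repeats) (E-pairs (λ g g′ y → does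
        (sameCopy? g g′ y)) E-sameCopy))
    where I : ℚ
          I = avgWeight n

  pairs-nonneg : ∀ {m} (b : Fin m → Fin m → Bool) → 0ℚ ≤ℚ sumF (λ i → sumF (λ j → ind (b i j)))
  pairs-nonneg b = sumF-nonneg λ i → sumF-nonneg λ j → 0≤ind (b i j)

  pairs-≥1 : ∀ {m} (b : Fin m → Fin m → Bool) i j → b i j ≡ true → 1ℚ ≤ℚ sumF (λ i → sumF (λ j → ind (b i j)))
  pairs-≥1 b i j h = ≤-trans (≤-reflexive (sym (cong ind h)))
    (≤-trans (sumF-term {f = λ j → ind (b i j)} (λ j → 0≤ind (b i j)) j) (sumF-term {f = λ i → sumF (λ j → ind (b i j))}
        (λ i → sumF-nonneg λ j → 0≤ind (b i j)) i))

  -- A covered map without repeated vertices and without a copy shared by two edges would be a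
  -- rainbow copy of `G`.
  degenerate-≥1 : ∀ y → (∀ g → Σ (Fin (copies R)) λ a → y ⇂ edge G g ≼ trace a) → 1ℚ ≤ℚ degenerate y
  degenerate-≥1 y cov with FinP.any? (λ r → FinP.any? λ r′ → repeats? r r′ y)
  ... | yes (r , r′ , h) = ≤-trans (pairs-≥1 (λ r r′ → does (repeats? r r′ y)) r r′ (dec-true (repeats? r r′ y) h)) (≤-by
      (pairs-nonneg λ g g′ → does (sameCopy? g g′ y)) refl)
  ... | no injective with FinP.any? (λ g → FinP.any? λ g′ → sameCopy? g g′ y)
  ...   | yes (g , g′ , h) = ≤-trans (pairs-≥1 (λ g g′ → does (sameCopy? g g′ y)) g g′ (dec-true (sameCopy? g g′ y) h))
      (≤-by (pairs-nonneg λ r r′ → does (repeats? r r′ y)) (+-comm (repetitions y) _))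
  ...   | no distinct = contradiction (lookup y , (λ {r} {r′} eq → decidable-stable (r Fin.≟ r′) λ ne → injective
      (r , r′ , ne , eq)) ,
            (λ g → proj₁ (cov g)) , (λ {g} {g′} eq → decidable-stable (g Fin.≟ g′) λ ne → distinct (g , g′ , ne , proj₁
                (cov g) , proj₂ (cov g) ,
              subst (λ a → y ⇂ edge G g′ ≼ trace a) (sym eq) (proj₂ (cov g′)))) , rainbow-edge) ¬rainbow
    where
      rainbow-edge : ∀ g → ∃ λ f → image (lookup y) (edge G g) ≡ image (emb R (proj₁ (cov g))) (edge F f)
      rainbow-edge g = let (f , eq) = hom g ; (a , h) = cov g in f , trans (image-cong (lookup y) (λ r → emb R a (φ r)) (edge G g) (⇂-≼-trace y (edge G g) a h))
        (trans (sym (image-∘ (emb R a) φ (edge G g))) (cong (image (emb R a)) (sym eq)))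

  edgeCount : ℕ
  edgeCount = length (edges complex)

  -- Many copies may share a tuple on a small face, so the copies are counted on an edge containing
  -- it, where they are distinct. Pulling the exceptional set back to that edge leaves its
  -- proportion unchanged.
  copies-bad-≤ : ∀ {θ} (bad : Partial (Fin (suc n)) v → Bool) → (∀ e → Eₛ e (λ z → ind
      (bad z)) ≤ℚ θ) → ∀ {t} → t ∈ edges complex →
    sumF (λ a → ind (bad (ev (copy a) t))) ≤ℚ fromℕ (suc n) ^ℚ k * θ
  copies-bad-≤ {θ} bad small {t} t∈ = let (b , (g , b⊆g) , eq) = complex-edge t∈ in go b g b⊆g eq
    where
      go : ∀ b g → b ∩ edge G g ≡ b → t ≡ section b → sumF (λ a → ind (bad (ev (copy a) t))) ≤ℚ fromℕ (suc n) ^ℚ k * θ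
      go b g b⊆g refl = subst₂ _≤ℚ_ (cong-≡ sumF-linear λ a → cong (λ z → ind (bad z)) (trans (restrict (copy a)) (sym
          (ev-section (copy a) b))))
          (cong (λ c → fromℕ (suc n) ^ℚ c * θ) (uniform G g))
          (≤-trans (sumF-injective-≤ e copy inj B (λ z → 0≤ind (bad (z ↾ b))))
            (*-monoʳ (<⇒≤ (0<^ (card e) (0<fromℕ-suc n))) (subst (_≤ℚ θ) (cong-≡ (E-linear v) λ x → cong (λ z → ind
                (bad z)) (sym (restrict x))) (small b))))
        where
          e : Subset v
          e = edge G g
          B : Partial (Fin (suc n)) v → ℚ
          B z = ind (bad (z ↾ b))
          restrict : ∀ x → x ⇂ e ↾ b ≡ x ⇂ b
          restrict x = trans (⇂-↾ x e b) (cong (x ⇂_) (trans (SubsetP.∩-comm e b) b⊆g))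
          inj : ∀ a a′ → copy a ⇂ e ≡ copy a′ ⇂ e → a ≡ a′
          inj a a′ eq = determined g a a′ λ r r∈ → trans (sym (VecP.lookup∘tabulate (λ r → emb R a (φ r)) r))
            (trans (⇂-lookup (copy a) (copy a′) e eq r r∈) (VecP.lookup∘tabulate (λ r → emb R a′ (φ r)) r))

  -- A union bound over the faces: if every copy met an exceptional tuple, the bounds of
  -- `copies-bad-≤` would add up to the number of copies.
  good-copy : ∀ {θ} (bad : Partial (Fin (suc n)) v → Bool) → (∀ e → Eₛ e (λ z → ind (bad z)) ≤ℚ θ) →
    fromℕ edgeCount * (fromℕ (suc n) ^ℚ k * θ) <ℚ fromℕ (copies R) → Σ (Fin (copies R)) λ a → ∀ {t} → t ∈ edges complex → bad
        (ev (copy a) t) ≡ false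
  good-copy {θ} bad small few with FinP.any? (λ a → allL (λ t → not (bad (ev (copy a) t))) (edges complex) BoolP.≟ true)
  ... | yes (a , h) = a , λ i → not-true (allL-∈ h i)
  ... | no none = contradiction (≤-<-trans (≤-trans all-bad swapped) few) (<-irrefl refl)
    where
      all-bad : fromℕ (copies R) ≤ℚ sumF (λ a → sumL (edges complex) (λ t → ind (bad (ev (copy a) t))))
      all-bad = subst (_≤ℚ sumF (λ a → sumL (edges complex) (λ t → ind (bad (ev (copy a) t))))) (sumF-1 (copies R))
        (sumF-mono λ a → ind-∨-sumL (λ t → bad (ev (copy a) t)) (edges complex) (≢true⇒false λ h → none (a , h)))
      swapped : sumF (λ a → sumL (edges complex) (λ t → ind (bad (ev (copy a) t)))) ≤ℚ fromℕ edgeCount * (fromℕ (suc n) ^ℚ k * θ)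
      swapped = subst₂ _≤ℚ_ (sym (sumF-comm (sumL-linear (edges complex)) (λ a t → ind (bad (ev (copy a) t))))) (sumL-const
          (edges complex) (fromℕ (suc n) ^ℚ k * θ))
        (sumL-mono (edges complex) (copies-bad-≤ bad small))

  module _ {θ δ} (T : Tower k edgeCount θ δ coverColour) (0<δ : 0ℚ <ℚ δ) (θ≤1 : θ ≤ℚ 1ℚ)
    (few : fromℕ edgeCount * (fromℕ (suc n) ^ℚ k * θ) <ℚ fromℕ (copies R)) where
    module T = Tower T

    chosen = good-copy T.bad T.bad-small few

    y₀ : Point n v
    y₀ = copy (proj₁ chosen)

    -- On level `k` the tower's colour is `coverColour`. As `y₀` comes from a copy, its edges are
    -- covered, and a map of the same pattern inherits this.
    matches-≤ : ∀ y → matches T.col complex y y₀ ≤ℚ degenerate y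
    matches-≤ y with allL (agree T.col y y₀) (edges complex) in eq
    ... | false = subst (_≤ℚ degenerate y) (sym (trans (prodL-ind (edges complex) (agree T.col y y₀)) (cong ind eq)))
                    (0≤-+ (pairs-nonneg λ r r′ → does (repeats? r r′ y)) (pairs-nonneg λ g g′ → does (sameCopy? g g′ y)))
    ... | true = subst (_≤ℚ degenerate y) (sym (trans (prodL-ind (edges complex) (agree T.col y y₀)) (cong ind eq)))
        (degenerate-≥1 y cov)
      where
        top-level : ∀ (x : Point n v) g → level (x ⇂ edge G g) ≡ k
        top-level x g = trans (cong card (supp-⇂ x (edge G g))) (uniform G g)
        cov : ∀ g → Σ (Fin (copies R)) λ a → y ⇂ edge G g ≼ trace a
        cov g = does-true (covered? (y ⇂ edge G g)) (trans (ListP.∷-injectiveˡ same) (dec-true (covered? (y₀ ⇂ edge G g))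
            (proj₁ chosen , copy-covered (proj₁ chosen) (edge G g))))
          where
            t = section (edge G g)
            same : coverColour (y ⇂ edge G g) ≡ coverColour (y₀ ⇂ edge G g)
            same = trans (sym (T.col-top (y ⇂ edge G g) (top-level y g))) (trans
              (subst₂ (λ a b → T.col a ≡ T.col b) (ev-section y (edge G g)) (ev-section y₀ (edge G g)) (does-true (T.col
                  (ev y t) ≟ᶜ T.col (ev y₀ t)) (allL-∈ eq (edge-∈ g))))
              (T.col-top (y₀ ⇂ edge G g) (top-level y₀ g)))

    -- The counting lemma bounds the frequency of the pattern of `y₀` from below independently of
    -- `n`, whereas all these maps are degenerate.
    many-copies : (1ℚ - θ) * δ ^ℚ edgeCount ≤ℚ fromℕ pairs * avgWeight n
    many-copies = ≤-trans (*-monoʳ (0≤-diff θ≤1) hat-≥) (≤-trans (lower-bound (frequency T.col complex y₀) hat count)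
        (≤-trans (E-mono v matches-≤) E-degenerate))
      where
        hat : ℚ
        hat = predicted T.dens complex y₀
        hat-≥ : δ ^ℚ edgeCount ≤ℚ hat
        hat-≥ = prodL-≥^ {as = edges complex} 0<δ λ {t} i → T.dens-≥ (ev y₀ t) (subst (_≤ k) (sym (level-ev y₀ t))
            (complex-level i)) (proj₂ chosen i)
        count : ∣ frequency T.col complex y₀ - hat ∣ ≤ℚ θ * hat
        count = T.count complex complex-level ℕP.≤-refl y₀ (proj₂ chosen)
        lower-bound : ∀ x h → ∣ x - h ∣ ≤ℚ θ * h → (1ℚ - θ) * h ≤ℚ x
        lower-bound x h near = diff-≤ (subst (0ℚ ≤ℚ_) (lem x h θ) (0≤-diff (≤-trans (-x≤∣x∣ (x - h)) near)))
          where lem : ∀ x h t → t * h - - (x - h) ≡ x - (1ℚ - t) * h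
                lem = solve-∀ ℚ-ring

<-diff : ∀ {a b c} → 0ℚ <ℚ c → b ≡ a + c → a <ℚ b
<-diff {a} {b} 0<c eq = subst₂ _<ℚ_ (+-identityʳ a) (sym eq) (ℚP.+-monoʳ-< a 0<c)

0<fromℕ-factor : ∀ {a} D c → 1 ≤ a → a ≤ D ℕ.* c → 0ℚ <ℚ fromℕ c
0<fromℕ-factor D (suc c) _ _ = 0<fromℕ-suc c
0<fromℕ-factor D zero 1≤a h = contradiction (ℕP.≤-trans 1≤a (ℕP.≤-trans h (ℕP.≤-reflexive (ℕP.*-zeroʳ D)))) ℕP.1+n≰n

-- Choice of the constants for packings of positive density

module Dense {k} (G F : Hypergraph k) (φ : Fin (nV G) → Fin (nV F)) (hom : ∀ e → IsEdge F (image φ (edge G e))) (D : ℕ) where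
  open FaceComplex G

  h pairs : ℕ
  h = length (edges complex)
  pairs = v ℕ.* v ℕ.+ nE G ℕ.* nE G

  -- The denominator `hD + 2` keeps both `θ` and `hD * θ` strictly below 1, also when `hD` is 0.
  hD θ : ℚ
  hD = fromℕ (h ℕ.* D)
  θ = inv (fromℕ (suc (suc (h ℕ.* D))))

  0<θ : 0ℚ <ℚ θ
  0<θ = 0<inv (0<fromℕ-suc (suc (h ℕ.* D)))

  θ-eq : 1ℚ ≡ θ * (1ℚ + (1ℚ + hD))
  θ-eq = sym (inv-* (0<fromℕ-suc (suc (h ℕ.* D))))

  θ<1 : θ <ℚ 1ℚ
  θ<1 = <-diff (0<-* 0<θ (0<-+ 0<1 (0≤fromℕ (h ℕ.* D)))) (trans θ-eq (lem θ hD))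
    where lem : ∀ t x → t * (1ℚ + (1ℚ + x)) ≡ t + t * (1ℚ + x)
          lem = solve-∀ ℚ-ring

  hDθ<1 : hD * θ <ℚ 1ℚ
  hDθ<1 = <-diff (0<-* 0<θ 0<2) (trans θ-eq (lem θ hD))
    where lem : ∀ t x → t * (1ℚ + (1ℚ + x)) ≡ x * t + t * (1ℚ + 1ℚ)
          lem = solve-∀ ℚ-ring

  0<1-θ : 0ℚ <ℚ 1ℚ - θ
  0<1-θ = subst (_<ℚ 1ℚ - θ) (ℚP.+-inverseʳ θ) (ℚP.+-monoˡ-< (- θ) θ<1)

  few-bad : ∀ {n c} → suc n ^ k ≤ D ℕ.* c → fromℕ h * (fromℕ (suc n) ^ℚ k * θ) <ℚ fromℕ c
  few-bad {n} {c} dense = ≤-<-trans (≤-trans (*-monoʳ (0≤fromℕ h) (*-monoˡ (<⇒≤ 0<θ) power≤))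
        (≤-reflexive (trans (lem (fromℕ h) (fromℕ D) (fromℕ c) θ) (cong (λ x → fromℕ c * (x * θ)) (sym (fromℕ-* h D))))))
      (subst (fromℕ c * (hD * θ) <ℚ_) (*-identityʳ (fromℕ c)) (ℚP.*-monoʳ-<-pos (fromℕ c) {{ℚ.positive (0<fromℕ-factor D c
          (ℕP.m^n>0 (suc n) k) dense)}} hDθ<1))
    where
      power≤ : fromℕ (suc n) ^ℚ k ≤ℚ fromℕ D * fromℕ c
      power≤ = subst₂ _≤ℚ_ (fromℕ-^ (suc n) k) (fromℕ-* D c) (fromℕ-mono dense)
      lem : ∀ h d c t → h * (d * c * t) ≡ c * (h * d * t)
      lem = solve-∀ ℚ-ring

  few-degenerate : ∀ {c₀} m N → 0ℚ <ℚ c₀ → fromℕ pairs ≤ℚ fromℕ m * c₀ → fromℕ pairs * avgWeight (m ℕ.+ N) <ℚ c₀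
  few-degenerate {c₀} m N 0<c₀ size = ≤-<-trans (*-monoˡ (<⇒≤ 0<I) size)
      (<-diff (0<-* 0<c₀ (0<-* 0<I (0<-+ 0<1 (0≤fromℕ N)))) (trans (sym (*-identityʳ c₀)) (trans (cong (c₀ *_) I-eq)
          (lem c₀ I (fromℕ m) (fromℕ N)))))
    where
      I : ℚ
      I = avgWeight (m ℕ.+ N)
      0<I : 0ℚ <ℚ I
      0<I = 0<inv (0<fromℕ-suc (m ℕ.+ N))
      I-eq : 1ℚ ≡ I * (1ℚ + (fromℕ m + fromℕ N))
      I-eq = trans (sym (inv-* (0<fromℕ-suc (m ℕ.+ N)))) (cong (λ x → I * (1ℚ + x)) (fromℕ-+ m N))
      lem : ∀ c i m n → c * (i * (1ℚ + (m + n))) ≡ m * c * i + c * (i * (1ℚ + n))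
      lem = solve-∀ ℚ-ring

  rainbow-exists : ∀ {δ n} → 0ℚ <ℚ δ →
    (∀ (c : Partial (Fin (suc n)) v → Colour) → (∀ z → length (c z) ≤ 1) → ¬ ¬ Tower {n} {v} k h θ δ c) →
    fromℕ pairs * avgWeight n <ℚ (1ℚ - θ) * δ ^ℚ h →
    (R : FPacking F (suc n)) → suc n ^ k ≤ D ℕ.* copies R → ¬ ¬ RainbowCopy G F R
  rainbow-exists 0<δ towers large R dense ¬rainbow = towers P.coverColour (λ _ → s≤s z≤n) λ T →
      <-irrefl refl (≤-<-trans (P.many-copies T 0<δ (<⇒≤ θ<1) (few-bad dense)) large)
    where module P = Packed G F φ hom R ¬rainbow

  no-dense-packings : TowerBound v k 1 h θ → ∀ N → (∀ n → N ≤ n → ∃ λ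
      (R : FPacking F n) → ¬ RainbowCopy G F R × n ^ k ≤ D ℕ.* copies R) → ⊥
  no-dense-packings (δ , 0<δ , _ , towers) N build = at (archimedean-* (fromℕ pairs) 0<c₀)
    where
      0<c₀ : 0ℚ <ℚ (1ℚ - θ) * δ ^ℚ h
      0<c₀ = 0<-* 0<1-θ (0<^ h 0<δ)
      at : (Σ ℕ λ m → fromℕ pairs ≤ℚ fromℕ m * ((1ℚ - θ) * δ ^ℚ h)) → ⊥
      -- The number `m + N + 1` of vertices is beyond `N`, and large enough that the share
      -- `pairs / (m + N + 1)` of degenerate maps falls below the constant.
      at (m , size) = let (R , ¬rainbow , dense) = build (suc (m ℕ.+ N)) (ℕP.m≤n⇒m≤1+n (ℕP.m≤n+m N m)) in
        rainbow-exists 0<δ towers (few-degenerate m N 0<c₀ size) R dense ¬rainbow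

dense-packings⇒¬hom : ∀ {k} (G F : Hypergraph k) →
  (∃ λ D → ∃ λ N → ∀ n → N ≤ n → ∃ λ (R : FPacking F n) → ¬ RainbowCopy G F R × n ^ k ≤ D ℕ.* copies R) →
  ¬ Homomorphism G F
dense-packings⇒¬hom {k} G F (D , N , build) (φ , hom) =
    no-dense-packings (towerBound (nV G) k 1 h θ 0<θ (<⇒≤ θ<1)) N build
  where open Dense G F φ hom D

-- Dense packings without homomorphic images

element : ∀ {n} (p : Subset n) → 1 ≤ card p → Fin n
element (true ∷ p) _ = zero
element (false ∷ p) h = suc (element p h)

copies-≤-all : ∀ {k} (F : Hypergraph k) → 1 ≤ k → Fin (nE F) → ∀ n (R : FPacking F n) → copies R ≤ 1 ℕ.* n ^ k
copies-≤-all {k} F 1≤k f (suc n) R = subst (copies R ≤_) (sym (ℕP.*-identityˡ (suc n ^ k))) (copies-≤ F f R)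
copies-≤-all F 1≤k f zero R with copies R | emb R
... | zero | _ = z≤n
... | suc _ | φ = contradiction (φ zero (element (edge F f) (subst (1 ≤_) (sym (uniform F f)) 1≤k))) λ ()

-- Polynomials with few coefficients have few roots

eval : ∀ {k} → Vec ℤ.ℤ k → ℤ.ℤ → ℤ.ℤ
eval [] x = ℤ.0ℤ
eval (c ∷ cs) x = c ℤ.+ x ℤ.* eval cs x

-- Synthetic division of c ∷ cs by x − y, in which the constant term c plays no role.
quotient : ∀ {k} → Vec ℤ.ℤ k → ℤ.ℤ → Vec ℤ.ℤ k
quotient [] y = []
quotient (c ∷ cs) y = eval (c ∷ cs) y ∷ quotient cs y

eval-quotient : ∀ {k} c (cs : Vec ℤ.ℤ k) x y → eval (c ∷ cs) x ℤ.- eval (c ∷ cs) y ≡ (x ℤ.- y) ℤ.* eval (quotient cs y) x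
eval-quotient c [] x y = lem c x y
  where lem : ∀ c x y → c ℤ.+ x ℤ.* ℤ.0ℤ ℤ.- (c ℤ.+ y ℤ.* ℤ.0ℤ) ≡ (x ℤ.- y) ℤ.* ℤ.0ℤ
        lem = ℤSolver.solve-∀
eval-quotient c (d ∷ cs) x y = trans (lem₁ c x y (eval (d ∷ cs) x) (eval (d ∷ cs) y))
  (trans (cong (λ t → (x ℤ.- y) ℤ.* eval (d ∷ cs) y ℤ.+ x ℤ.* t) (eval-quotient d cs x y)) (lem₂ x y (eval (d ∷ cs) y) (eval
      (quotient cs y) x)))
  where
    lem₁ : ∀ c x y a b → c ℤ.+ x ℤ.* a ℤ.- (c ℤ.+ y ℤ.* b) ≡ (x ℤ.- y) ℤ.* b ℤ.+ x ℤ.* (a ℤ.- b)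
    lem₁ = ℤSolver.solve-∀
    lem₂ : ∀ x y b q → (x ℤ.- y) ℤ.* b ℤ.+ x ℤ.* ((x ℤ.- y) ℤ.* q) ≡ (x ℤ.- y) ℤ.* (b ℤ.+ x ℤ.* q)
    lem₂ = ℤSolver.solve-∀

Zero : ∀ {k} → Vec ℤ.ℤ k → Set
Zero cs = ∀ l → lookup cs l ≡ ℤ.0ℤ

eval-zero : ∀ {k} (cs : Vec ℤ.ℤ k) → Zero cs → ∀ x → eval cs x ≡ ℤ.0ℤ
eval-zero [] z x = refl
eval-zero (c ∷ cs) z x = trans (cong₂ (λ a b → a ℤ.+ x ℤ.* b) (z zero) (eval-zero cs (λ l → z (suc l)) x)) (trans
    (ℤP.+-identityˡ (x ℤ.* ℤ.0ℤ)) (ℤP.*-zeroʳ x))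

constant-zero : ∀ {k} c (cs : Vec ℤ.ℤ k) x → Zero cs → eval (c ∷ cs) x ≡ ℤ.0ℤ → c ≡ ℤ.0ℤ
constant-zero c cs x z h = trans (sym (trans (cong (λ t → c ℤ.+ x ℤ.* t) (eval-zero cs z x)) (trans (cong (λ t → c ℤ.+ t)
    (ℤP.*-zeroʳ x)) (ℤP.+-identityʳ c)))) h

quotient-zero : ∀ {k} (cs : Vec ℤ.ℤ k) y → Zero (quotient cs y) → Zero cs
quotient-zero (c ∷ cs) y z (suc l) = quotient-zero cs y (λ l → z (suc l)) l
quotient-zero (c ∷ cs) y z zero = constant-zero c cs y (quotient-zero cs y (λ l → z (suc l))) (z zero)

-- Divide by the root at the first element of `e`: the quotient has one coefficient less and keeps
-- the other roots, as ℤ has no zero divisors. A vanishing quotient forces `cs` to vanish, from the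
-- leading coefficient downwards.
few-roots : ∀ {v} (xs : Fin v → ℤ.ℤ) → (∀ {i i′} → xs i ≡ xs i′ → i ≡ i′) → (e : Subset v) (cs : Vec ℤ.ℤ (card e)) →
  (∀ i → lookup e i ≡ true → eval cs (xs i) ≡ ℤ.0ℤ) → Zero cs
few-roots xs inj [] [] h ()
few-roots xs inj (false ∷ e) cs h = few-roots (λ i → xs (suc i)) (λ eq → FinP.suc-injective (inj eq)) e cs (λ i → h (suc i))
few-roots xs inj (true ∷ e) (c ∷ cs) h = all
  where
    rest : Zero cs
    rest = quotient-zero cs (xs zero) (few-roots (λ i → xs (suc i)) (λ eq → FinP.suc-injective (inj eq)) e (quotient cs
        (xs zero)) root)
      where
        root : ∀ i → lookup e i ≡ true → eval (quotient cs (xs zero)) (xs (suc i)) ≡ ℤ.0ℤ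
        root i i∈ with ℤP.i*j≡0⇒i≡0∨j≡0 (xs (suc i) ℤ.- xs zero) (trans (sym (eval-quotient c cs (xs (suc i)) (xs zero))) (cong₂ ℤ._-_ (h (suc i) i∈) (h zero refl)))
        ... | inj₂ q = q
        ... | inj₁ p = contradiction (inj (ℤP.i-j≡0⇒i≡j (xs (suc i)) (xs zero) p)) λ ()
    all : Zero (c ∷ cs)
    all zero = constant-zero c cs (xs zero) rest (h zero refl)
    all (suc l) = rest l

evalℕ : ∀ {k} → Vec ℕ k → ℕ → ℕ
evalℕ [] x = 0
evalℕ (c ∷ cs) x = c ℕ.+ x ℕ.* evalℕ cs x

eval-difference : ∀ {k} (cs ds : Vec ℕ k) x → eval (zipWith (λ c d → ℤ.+ c ℤ.- ℤ.+ d) cs ds)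
    (ℤ.+ x) ≡ ℤ.+ evalℕ cs x ℤ.- ℤ.+ evalℕ ds x
eval-difference [] [] x = refl
eval-difference (c ∷ cs) (d ∷ ds) x = trans (cong (λ t → ℤ.+ c ℤ.- ℤ.+ d ℤ.+ ℤ.+ x ℤ.* t) (eval-difference cs ds x))
  (trans (lem (ℤ.+ c) (ℤ.+ d) (ℤ.+ x) (ℤ.+ evalℕ cs x) (ℤ.+ evalℕ ds x)) (sym (cong₂ ℤ._-_ (homo c (evalℕ cs x)) (homo d
      (evalℕ ds x)))))
  where
    homo : ∀ c e → ℤ.+ (c ℕ.+ x ℕ.* e) ≡ ℤ.+ c ℤ.+ ℤ.+ x ℤ.* ℤ.+ e
    homo c e = trans (ℤP.pos-+ c (x ℕ.* e)) (cong (λ t → ℤ.+ c ℤ.+ t) (ℤP.pos-* x e))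
    lem : ∀ c d x a b → c ℤ.- d ℤ.+ x ℤ.* (a ℤ.- b) ≡ c ℤ.+ x ℤ.* a ℤ.- (d ℤ.+ x ℤ.* b)
    lem = ℤSolver.solve-∀

-- Over the integers the two polynomials can be subtracted; the difference has as many roots as
-- coefficients.
evalℕ-unique : ∀ {v k} (e : Subset v) → card e ≡ k → (cs ds : Vec ℕ k) → (∀ i → lookup e i ≡ true → evalℕ cs
    (toℕ i) ≡ evalℕ ds (toℕ i)) → cs ≡ ds
evalℕ-unique e refl cs ds h = vec-ext λ l → ℤP.+-injective (ℤP.i-j≡0⇒i≡j (ℤ.+ lookup cs l) (ℤ.+ lookup ds l)
  (trans (sym (VecP.lookup-zipWith (λ c d → ℤ.+ c ℤ.- ℤ.+ d) l cs ds))
    (few-roots (λ i → ℤ.+ toℕ i) (λ eq → FinP.toℕ-injective (ℤP.+-injective eq)) e (zipWith (λ c d → ℤ.+ c ℤ.- ℤ.+ d) cs ds)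
      (λ i i∈ → trans (eval-difference cs ds (toℕ i)) (ℤP.i≡j⇒i-j≡0 (cong (λ t → ℤ.+ t) (h i i∈)))) l)))

*-^ : ∀ a b k → (a ℕ.* b) ^ k ≡ a ^ k ℕ.* b ^ k
*-^ a b zero = refl
*-^ a b (suc k) = trans (cong (a ℕ.* b ℕ.*_) (*-^ a b k)) (lem a b (a ^ k) (b ^ k))
  where lem : ∀ a b c d → a ℕ.* b ℕ.* (c ℕ.* d) ≡ a ℕ.* c ℕ.* (b ℕ.* d)
        lem = ℕSolver.solve-∀

-- Copies of `F` along graphs of polynomials

module Construction {k} (G F : Hypergraph (suc k)) (f₀ : Fin (nE F)) where

  v : ℕ
  v = nV F

  -- The geometric sum `1 + v + … + v ^ (j - 1)`: `t` times it bounds the values at arguments up to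
  -- `v` of polynomials with coefficients below `t`.
  growth : ℕ → ℕ
  growth zero = 0
  growth (suc j) = 1 ℕ.+ v ℕ.* growth j

  evalℕ-≤ : ∀ {j} t (cs : Vec ℕ j) → (∀ l → lookup cs l < t) → ∀ x → x ≤ v → evalℕ cs x ≤ t ℕ.* growth j
  evalℕ-< : ∀ {j} t (cs : Vec ℕ (suc j)) → (∀ l → lookup cs l < t) → ∀ x → x ≤ v → evalℕ cs x < t ℕ.* growth (suc j)
  evalℕ-≤ t [] h x x≤v = z≤n
  evalℕ-≤ t (c ∷ cs) h x x≤v = ℕP.<⇒≤ (evalℕ-< t (c ∷ cs) h x x≤v)
  evalℕ-< {j} t (c ∷ cs) h x x≤v = subst (c ℕ.+ x ℕ.* evalℕ cs x <_) eq (ℕP.+-mono-<-≤ (h zero) (ℕP.*-mono-≤ x≤v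
      (evalℕ-≤ t cs (λ l → h (suc l)) x x≤v)))
    where
      eq : t ℕ.+ v ℕ.* (t ℕ.* growth j) ≡ t ℕ.* (1 ℕ.+ v ℕ.* growth j)
      eq = lem t v (growth j)
        where lem : ∀ t v g → t ℕ.+ v ℕ.* (t ℕ.* g) ≡ t ℕ.* (1 ℕ.+ v ℕ.* g)
              lem = ℕSolver.solve-∀

  module _ (t n : ℕ) (fits : v ℕ.* (t ℕ.* growth (suc k)) ≤ n) where

    s : ℕ
    s = t ℕ.* growth (suc k)

    coefficient : Fin (t ^ suc k) → Fin (suc k) → Fin t
    coefficient = Fin.finToFun {t} {suc k}

    coefficients : Fin (t ^ suc k) → Vec ℕ (suc k)
    coefficients a = tabulate λ l → toℕ (coefficient a l)

    lookup-coefficients : ∀ a l → lookup (coefficients a) l ≡ toℕ (coefficient a l)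
    lookup-coefficients a l = VecP.lookup∘tabulate (λ l → toℕ (coefficient a l)) l

    coefficients-injective : ∀ {a a′} → coefficients a ≡ coefficients a′ → a ≡ a′
    coefficients-injective {a} {a′} eq = trans (sym (FinP.funToFin-finToFin {suc k} {t} a)) (trans (funToFin-cong
        λ l → FinP.toℕ-injective (begin
        toℕ (coefficient a l)     ≡⟨ sym (lookup-coefficients a l) ⟩
        lookup (coefficients a) l   ≡⟨ cong (λ c → lookup c l) eq ⟩
        lookup (coefficients a′) l  ≡⟨ lookup-coefficients a′ l ⟩
        toℕ (coefficient a′ l)    ∎)) (FinP.funToFin-finToFin {suc k} {t} a′))
      where
        open ≡-Reasoning
        funToFin-cong : ∀ {j} {p q : Fin j → Fin t} → (∀ l → p l ≡ q l) → Fin.funToFin p ≡ Fin.funToFin q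
        funToFin-cong {zero} h = refl
        funToFin-cong {suc j} h = cong₂ Fin.combine (h zero) (funToFin-cong λ l → h (suc l))

    value : Fin (t ^ suc k) → Fin v → Fin s
    value a i = Fin.fromℕ< (evalℕ-< t (coefficients a) (λ l → subst (_< t) (sym (lookup-coefficients a l)) (FinP.toℕ<n
        (coefficient a l))) (toℕ i) (FinP.toℕ≤n i))

    toℕ-value : ∀ a i → toℕ (value a i) ≡ evalℕ (coefficients a) (toℕ i)
    toℕ-value a i = FinP.toℕ-fromℕ< _

    place : Fin (t ^ suc k) → Fin v → Fin n
    place a i = Fin.inject≤ (Fin.combine i (value a i)) fits

    place-injective : ∀ {a a′ i i′} → place a i ≡ place a′ i′ → i ≡ i′ × value a i ≡ value a′ i′
    place-injective {a} {a′} {i} {i′} eq = FinP.combine-injective i (value a i) i′ (value a′ i′)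
        (FinP.inject≤-injective fits fits _ _ eq)

    packing : FPacking F n
    packing = record
      { copies = t ^ suc k
      ; emb = place
      ; embInj = λ a {i} {i′} eq → proj₁ (place-injective {a} {a} {i} {i′} eq)
      -- A vertex remembers its block, so a common edge meets the block of each `i` in `e` in one
      -- vertex, where both polynomials take the same value.
      ; disjoint = λ a b e f eq → coefficients-injective (evalℕ-unique (edge F e) (uniform F e) (coefficients a)
          (coefficients b) λ i i∈ →
          let (j , _ , pj) = image-∈⁻ (place b) (edge F f) (subst (λ p → lookup p (place a i) ≡ true) eq (image-∈⁺ (place a) (edge F e) i∈))
              (j≡i , val) = place-injective {b} {a} {j} {i} pj in
          trans (sym (toℕ-value a i)) (trans (cong toℕ (trans (sym val) (cong (value b) j≡i))) (toℕ-value b i)))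
      }

    origin : Fin v
    origin = element (edge F f₀) (subst (1 ≤_) (sym (uniform F f₀)) (s≤s z≤n))

    -- Vertices from `v * s` on lie in no copy; `origin` is a default for them, available because an
    -- edge of `F` is nonempty.
    class : Fin n → Fin v
    class w with toℕ w ℕP.<? v ℕ.* s
    ... | yes lt = proj₁ (Fin.remQuot {v} s (Fin.fromℕ< lt))
    ... | no _ = origin

    class-place : ∀ a i → class (place a i) ≡ i
    class-place a i with toℕ (place a i) ℕP.<? v ℕ.* s
    ... | yes lt = trans (cong (λ w → proj₁ (Fin.remQuot {v} s w)) (FinP.toℕ-injective (trans (FinP.toℕ-fromℕ< lt)
        (FinP.toℕ-inject≤ (Fin.combine i (value a i)) fits))))
                     (cong proj₁ (FinP.remQuot-combine i (value a i)))
    ... | no ¬lt = contradiction (subst (_< v ℕ.* s) (sym (FinP.toℕ-inject≤ (Fin.combine i (value a i)) fits)) (FinP.toℕ<n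
        (Fin.combine i (value a i)))) ¬lt

    rainbow⇒hom : RainbowCopy G F packing → Homomorphism G F
    rainbow⇒hom (ψ , _ , col , _ , h) = (λ u → class (ψ u)) , λ e → let (f , eq) = h e in f , sym (begin
      image (λ u → class (ψ u)) (edge G e)                   ≡⟨ sym (image-∘ class ψ (edge G e)) ⟩
      image class (image ψ (edge G e))                       ≡⟨ cong (image class) eq ⟩
      image class (image (place (col e)) (edge F f))         ≡⟨ image-∘ class (place (col e)) (edge F f) ⟩
      image (λ i → class (place (col e) i)) (edge F f)       ≡⟨ image-cong _ (λ i → i) (edge F f) (λ i _ → class-place
          (col e) i) ⟩
      image (λ i → i) (edge F f)                             ≡⟨ image-id (edge F f) ⟩
      edge F f                                               ∎)
      where open ≡-Reasoning

  unit-size : ℕ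
  unit-size = v ℕ.* growth (suc k)

  0<unit-size : 1 ≤ unit-size
  0<unit-size = ℕP.*-mono-≤ {1} {v} {1} {growth (suc k)} (ℕP.≤-trans (s≤s z≤n) (FinP.toℕ<n (element (edge F f₀) (subst (1 ≤_)
      (sym (uniform F f₀)) (s≤s z≤n))))) (s≤s z≤n)

  dense-packings : ¬ Homomorphism G F → ∃ λ D → ∃ λ N → ∀ n → N ≤ n → ∃ λ
      (R : FPacking F n) → ¬ RainbowCopy G F R × n ^ suc k ≤ D ℕ.* copies R
  -- With `t` the quotient of `n` by `unit-size`, there are `t ^ suc k` copies. From `N` on, `t` is
  -- at least 1, so rounding down costs at most a factor 2.
  dense-packings ¬hom = (2 ℕ.* unit-size) ^ suc k , unit-size , λ n N≤n → build n N≤n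
    where
      instance
        unit-nonZero : ℕ.NonZero unit-size
        unit-nonZero = ℕ.>-nonZero 0<unit-size
      build : ∀ n → unit-size ≤ n → ∃ λ (R : FPacking F n) → ¬ RainbowCopy G F R × n ^ suc k ≤
          (2 ℕ.* unit-size) ^ suc k ℕ.* copies R
      build n N≤n = packing t n fits , (λ r → ¬hom (rainbow⇒hom t n fits r)) ,
          subst (n ^ suc k ≤_) (*-^ (2 ℕ.* unit-size) t (suc k)) (ℕP.^-monoˡ-≤ (suc k) n≤)
        where
          t : ℕ
          t = n ℕD./ unit-size
          fits : v ℕ.* (t ℕ.* growth (suc k)) ≤ n
          fits = subst (_≤ n) (lem v t (growth (suc k))) (ℕD.m/n*n≤m n unit-size)
            where lem : ∀ v t g → t ℕ.* (v ℕ.* g) ≡ v ℕ.* (t ℕ.* g)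
                  lem = ℕSolver.solve-∀
          1≤t : 1 ≤ t
          1≤t = ℕD.m≥n⇒m/n>0 N≤n
          n≤ : n ≤ 2 ℕ.* unit-size ℕ.* t
          n≤ = subst₂ _≤_ (sym (ℕD.m≡m%n+[m/n]*n n unit-size)) (lem unit-size t)
                 (ℕP.+-monoˡ-≤ (t ℕ.* unit-size) (ℕP.≤-trans (ℕP.<⇒≤ (ℕD.m%n<n n unit-size))
                     (ℕP.m≤n*m unit-size t {{ℕ.>-nonZero 1≤t}})))
            where lem : ∀ u t → t ℕ.* u ℕ.+ t ℕ.* u ≡ 2 ℕ.* u ℕ.* t
                  lem = ℕSolver.solve-∀

theorem1p8 : (k : ℕ) → 2 ≤ k → (G F : Hypergraph k) → 0 < nE F →
    (ExIsThetaNk k G F ⇔ (¬ Homomorphism G F))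
theorem1p8 (suc k) (s≤s 1≤k) G F 0<nE = mk⇔
  (λ (_ , dense) → dense-packings⇒¬hom G F dense)
  (λ ¬hom → (1 , λ n R _ → copies-≤-all F (s≤s z≤n) f₀ n R) , Construction.dense-packings G F f₀ ¬hom)
  where
    f₀ : Fin (nE F)
    f₀ = Fin.fromℕ< 0<nE
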